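{- Let $G$ be a finite simple graph that is triangle-free and has maximum degree at most $3$. Then $\chi_f(G) \leq 3 - \frac{3}{43}$.
   Context: For a finite simple graph $G$, let $\mathcal{I}(G)$ be the family of independent sets of $G$. A map $f\colon \mathcal{I}(G)\to[0,1]$ is an $r$-fractional coloring if $\sum_{S\in\mathcal{I}(G)} f(S)\le r$ and $\sum_{S\in\mathcal{I}(G),\, v\in S} f(S)\ge 1$ for every vertex $v$. The fractional chromatic number $\chi_f(G)$ is the least $r$ for which $G$ has an $r$-fractional coloring. Equivalently, $\chi_f(G)=\min a/b$ over all $a$:$b$-colorings, i.e. assignments of $b$-element subsets of an $a$-element palette to the vertices such that adjacent vertices receive disjoint sets. -}

module Defs where

open import Data.Nat using (ℕ; _≤_; _*_; _<_)
open import Data.Bool using (Bool; true; false)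
open import Data.Fin using (Fin)
open import Data.Fin.Subset using (Subset; ∣_∣; _∈_; _∉_)
open import Data.Vec using (tabulate)
open import Data.Product using (Σ; _×_; ∃)
open import Relation.Binary.PropositionalEquality using (_≡_)

record Graph : Set where
  field
    n      : ℕ
    adj    : Fin n → Fin n → Bool
    sym    : ∀ u v → adj u v ≡ adj v u
    irrefl : ∀ v → adj v v ≡ false

open Graph public

Adj : (G : Graph) → Fin (n G) → Fin (n G) → Set
Adj G u v = adj G u v ≡ true

degree : (G : Graph) → Fin (n G) → ℕ
degree G v = ∣ tabulate (adj G v) ∣

MaxDegreeAtMost : ℕ → Graph → Set
MaxDegreeAtMost d G = ∀ v → degree G v ≤ d

TriangleFree : Graph → Set
TriangleFree G = ∀ u v w → Adj G u v → Adj G v w → Adj G u w → Data.Empty.⊥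
  where import Data.Empty

record ABColoring (G : Graph) (a b : ℕ) : Set where
  field
    colour   : Fin (n G) → Subset a
    size     : ∀ v → ∣ colour v ∣ ≡ b
    disjoint : ∀ u v → Adj G u v → ∀ i → i ∈ colour u → i ∉ colour v

-- χ_f(G) ≤ p / q  (q > 0), using χ_f(G) = min a/b over a:b-colourings
-- (the minimum is attained).
FracChromatic≤ : Graph → ℕ → ℕ → Set
FracChromatic≤ G p q =
  Σ ℕ λ a → Σ ℕ λ b → (0 < b) × (a * q ≤ p * b) × ABColoring G a b

module Submission where

-- Induction over the induced subgraphs U of G. Each vertex demands a measure of colours out of 2520 that depends on its degree
-- and on whether its component is K₂, C₅ or a certain graph on eight vertices; the demand is 860 in degree three and larger
-- otherwise. Draw a vertex x at random with suitable weights, give it all colours, its neighbours none, and colour the rest of U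
-- by induction. The neighbours of x lose, but the vertices at distance two have lost neighbours and therefore get more; locally
-- the gains outweigh the losses, unless U has a leaf, a C₅ attached at one vertex, three consecutive vertices of degree two on a
-- 5-cycle, two vertices of degree three with the same neighbours, or a 4-cycle with two opposite vertices joined by
-- a path through two vertices of degree two. Such a configuration is deleted instead, and its vertices are coloured by hand
-- after the induction hypothesis has been applied.

open import Defs hiding (sym)
open import Data.Bool using (Bool; true; false; _∧_; _∨_; not; if_then_else_)
import Data.Bool.Properties as Boolₚ
open import Data.Empty using (⊥; ⊥-elim)
open import Data.Fin using (Fin; zero; suc; splitAt)
import Data.Fin.Properties as Fₚ
open import Data.Fin.Subset using (∣_∣)
import Data.Fin.Subset as Subset
open import Data.List using (List; []; _∷_; _++_; length; filter; allFin; map; replicate; concatMap; tabulate)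
open import Data.List.Membership.Propositional using (_∈_; _∉_; find; lose)
open import Data.List.Membership.Propositional.Properties using (∈-allFin; ∈-filter⁺; ∈-filter⁻; ∈-++⁻)
open import Data.List.Properties using (≡-dec; length-replicate; filter-all)
open import Data.List.Relation.Unary.Any as Any using (Any; here; there; any?)
open import Data.List.Relation.Unary.Unique.Propositional using (Unique)
import Data.List.Relation.Unary.Unique.Propositional.Properties as Uₚ
open import Data.Nat hiding (_≟_)
open import Data.Nat.Properties hiding (_≟_)
open import Data.Nat.Tactic.RingSolver using (solve)
open import Data.Product hiding (map; map₂; swap)
open import Data.Sum using (_⊎_; inj₁; inj₂; [_,_]′; swap; map₂)
import Data.Vec as Vec
import Data.Vec.Properties as Vecₚ
open import Function using (_∘_; id)
open import Relation.Binary.PropositionalEquality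
open import Relation.Nullary
open import Relation.Nullary.Decidable using (map′; _×-dec_; _→-dec_; _⊎-dec_; ¬?)
open import Relation.Unary using (Decidable)

-- Sets of colours

-- The demands are dictated by small graphs. A colour occurs at most twice on a 5-cycle, so a
-- 5-cycle with one vertex of demand 860 allows 1045 at the others: 860 + 4 · 1045 = 2 · 2520. A
-- leaf takes the complement of its neighbour, 1475 = 2520 - 1045. In the eight-vertex graph, one
-- pair of opposite vertices of the 4-cycle has its two sets of size 860 within 1260 colours. They
-- share at least 460, which leaves (2520 - 460) / 2 = 1030 for each vertex of the path between
-- them. C₅ and the eight-vertex graph are the obstacle. A vertex that loses neighbours is owed
-- more, but a vertex of degree two that keeps both may end up in such a component and be owed less.
-- Every reduction has to exclude that its deletion creates one, which decides the order of the
-- reductions. In the averaging they do arise. If no 4-cycle passes through a vertex of degree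
-- three, at most two choices of `x` at distance two leave it in C₅; for a vertex of degree two the
-- shortfall is charged to paths of length three that start there.

b2n : Bool → ℕ
b2n true = 1
b2n false = 0

PSet : ℕ → Set
PSet M = Fin M → Bool

cnt : ∀ {M} → PSet M → ℕ
cnt {zero} f = 0
cnt {suc M} f = b2n (f zero) + cnt (f ∘ suc)

infix 4 _⊑_
_⊑_ : ∀ {M} → PSet M → PSet M → Set
f ⊑ g = ∀ i → f i ≡ true → g i ≡ true

Disj : ∀ {M} → PSet M → PSet M → Set
Disj f g = ∀ i → f i ≡ true → g i ≡ true → ⊥

∅ : ∀ {M} → PSet M
∅ _ = false

∁ : ∀ {M} → PSet M → PSet M
∁ f i = not (f i)

infixr 6 _∩_
infixr 5 _∪_
_∩_ _∪_ : ∀ {M} → PSet M → PSet M → PSet M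
(f ∩ g) i = f i ∧ g i
(f ∪ g) i = f i ∨ g i

∧-elim : ∀ {a b} → a ∧ b ≡ true → a ≡ true × b ≡ true
∧-elim {true} {true} _ = refl , refl

∧-intro : ∀ {a b} → a ≡ true → b ≡ true → a ∧ b ≡ true
∧-intro refl refl = refl

∨-elim : ∀ {a b} → a ∨ b ≡ true → a ≡ true ⊎ b ≡ true
∨-elim {true} _ = inj₁ refl
∨-elim {false} e = inj₂ e

∨-introˡ : ∀ {a b} → a ≡ true → a ∨ b ≡ true
∨-introˡ refl = refl

∨-introʳ : ∀ {a b} → b ≡ true → a ∨ b ≡ true
∨-introʳ {true} _ = refl
∨-introʳ {false} e = e

not-true : ∀ {a} → not a ≡ true → a ≡ true → ⊥
not-true {true} () _
not-true {false} _ ()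

true-not : ∀ {a} → (a ≡ true → ⊥) → not a ≡ true
true-not {true} h = ⊥-elim (h refl)
true-not {false} _ = refl

Disj-sym : ∀ {M} {f g : PSet M} → Disj f g → Disj g f
Disj-sym d i a b = d i b a

⊑∁⇒Disj : ∀ {M} {f g : PSet M} → f ⊑ ∁ g → Disj f g
⊑∁⇒Disj h i a b = not-true (h i a) b

Disj⇒⊑∁ : ∀ {M} {f g : PSet M} → Disj f g → f ⊑ ∁ g
Disj⇒⊑∁ d i a = true-not (d i a)

cnt-mono : ∀ {M} {f g : PSet M} → f ⊑ g → cnt f ≤ cnt g
cnt-mono {zero} h = z≤n
cnt-mono {suc M} {f} {g} h = +-mono-≤ (go (f zero) (g zero) (h zero)) (cnt-mono (h ∘ suc))
  where
  go : ∀ a b → (a ≡ true → b ≡ true) → b2n a ≤ b2n b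
  go false b _ = z≤n
  go true true _ = ≤-refl
  go true false h with () ← h refl

private
  interchange : ∀ a b c d → (a + b) + (c + d) ≡ (a + c) + (b + d)
  interchange a b c d = begin
    (a + b) + (c + d) ≡⟨ +-assoc a b (c + d) ⟩
    a + (b + (c + d)) ≡⟨ cong (a +_) (sym (+-assoc b c d)) ⟩
    a + ((b + c) + d) ≡⟨ cong (λ z → a + (z + d)) (+-comm b c) ⟩
    a + ((c + b) + d) ≡⟨ cong (a +_) (+-assoc c b d) ⟩
    a + (c + (b + d)) ≡⟨ sym (+-assoc a c (b + d)) ⟩
    (a + c) + (b + d) ∎
    where open ≡-Reasoning

cnt-∁ : ∀ {M} (f : PSet M) → cnt f + cnt (∁ f) ≡ M
cnt-∁ {zero} f = refl
cnt-∁ {suc M} f = trans (interchange (b2n (f zero)) _ _ _) (cong₂ _+_ (go (f zero)) (cnt-∁ (f ∘ suc)))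
  where
  go : ∀ a → b2n a + b2n (not a) ≡ 1
  go true = refl
  go false = refl

cnt-∪∩ : ∀ {M} (f g : PSet M) → cnt (f ∪ g) + cnt (f ∩ g) ≡ cnt f + cnt g
cnt-∪∩ {zero} f g = refl
cnt-∪∩ {suc M} f g =
  trans (interchange (b2n (f zero ∨ g zero)) _ _ _)
  (trans (cong₂ _+_ (go (f zero) (g zero)) (cnt-∪∩ (f ∘ suc) (g ∘ suc)))
  (interchange (b2n (f zero)) _ _ _))
  where
  go : ∀ a b → b2n (a ∨ b) + b2n (a ∧ b) ≡ b2n a + b2n b
  go true true = refl
  go true false = refl
  go false true = refl
  go false false = refl

cnt-∅ : ∀ {M} → cnt (∅ {M}) ≡ 0
cnt-∅ {zero} = refl
cnt-∅ {suc M} = cnt-∅ {M}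

-- Prescribed overlaps come from here: two sets that are both made to contain `I` meet at least in
-- `I`. An element of `X` outside `I` is taken only when the elements of `X` after it are too few.
between : ∀ {M} (I X : PSet M) m → I ⊑ X → cnt I ≤ m → m ≤ cnt X →
          Σ (PSet M) λ Y → I ⊑ Y × Y ⊑ X × cnt Y ≡ m
between {zero} I X m h a b = I , (λ _ e → e) , h , ≤-antisym a b
between {suc M} I X m h a b with I zero in eI | X zero in eX
... | true | false with () ← trans (sym eX) (h zero eI)
between {suc M} I X (suc m) h (s≤s a) (s≤s b) | true | true
  with Y , p , q , r ← between (I ∘ suc) (X ∘ suc) m (h ∘ suc) a b
  = (λ { zero → true ; (suc i) → Y i }) , (λ { zero _ → refl ; (suc i) → p i })
  , (λ { zero _ → eX ; (suc i) → q i }) , cong suc r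
between {suc M} I X m h a b | false | false
  with Y , p , q , r ← between (I ∘ suc) (X ∘ suc) m (h ∘ suc) a b
  = (λ { zero → false ; (suc i) → Y i }) , (λ { zero e → trans (sym eI) e ; (suc i) → p i })
  , (λ { zero () ; (suc i) → q i }) , r
between {suc M} I X m h a b | false | true with m ≤? cnt (X ∘ suc)
... | yes b′ with Y , p , q , r ← between (I ∘ suc) (X ∘ suc) m (h ∘ suc) a b′
  = (λ { zero → false ; (suc i) → Y i }) , (λ { zero e → trans (sym eI) e ; (suc i) → p i })
  , (λ { zero () ; (suc i) → q i }) , r
between {suc M} I X zero h a b | false | true | no b≰ = ⊥-elim (b≰ z≤n)
between {suc M} I X (suc m) h a b | false | true | no b≰
  with Y , p , q , r ← between (I ∘ suc) (X ∘ suc) m (h ∘ suc)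
                         (≤-trans (cnt-mono {f = I ∘ suc} {g = X ∘ suc} (h ∘ suc)) (≤-pred (≰⇒> b≰))) (≤-pred b)
  = (λ { zero → true ; (suc i) → Y i }) , (λ { zero _ → refl ; (suc i) → p i })
  , (λ { zero _ → eX ; (suc i) → q i }) , cong suc r

cnt-cong : ∀ {M} {f g : PSet M} → (∀ i → f i ≡ g i) → cnt f ≡ cnt g
cnt-cong {zero} h = refl
cnt-cong {suc M} h = cong₂ _+_ (cong b2n (h zero)) (cnt-cong (h ∘ suc))

join : ∀ {M N} → PSet M → PSet N → PSet (M + N)
join {M} f g = [ f , g ]′ ∘ splitAt M

cnt-join : ∀ {M N} (f : PSet M) (g : PSet N) → cnt (join f g) ≡ cnt f + cnt g
cnt-join {zero} f g = refl
cnt-join {suc M} f g = trans (cong (b2n (f zero) +_) (trans (cnt-cong go) (cnt-join (f ∘ suc) g)))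
                       (sym (+-assoc (b2n (f zero)) _ _))
  where
  go : ∀ i → join f g (suc i) ≡ join (f ∘ suc) g i
  go i with splitAt M i
  ... | inj₁ _ = refl
  ... | inj₂ _ = refl

-- Linear arithmetic

-- A linear inequality over ℕ with its certificate. The hypotheses are added up to `l ≤ r`; the
-- equation says that `gr − gl` is `r − l` plus the slack `s`, written without subtraction so that
-- the ring solver can check it.
lin : ∀ {l r gl gr} s → l ≤ r → gl + r + s ≡ gr + l → gl ≤ gr
lin {l} {r} {gl} {gr} s h e = +-cancelʳ-≤ r gl gr
  (≤-trans (m≤m+n (gl + r) s) (≤-trans (≤-reflexive e) (+-monoʳ-≤ gr h)))

-- The sides of *-monoʳ-≤ are not in a form that the ring solver can read.
mul-mono : ∀ K {a b} → a ≤ b → K * a ≤ K * b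
mul-mono K h = *-monoʳ-≤ K h

pent-ar : ∀ K s α → 4 * s + α ≤ 5040 → 4 * (K * s) + K * α ≤ 2 * (K * 2520)
pent-ar K s α h = lin 0 (mul-mono K h) (solve (K ∷ s ∷ α ∷ []))

run-ar : ∀ K → 3 * (K * 1045) ≤ K * 2520 + K * 800
run-ar K = lin (K * 185) (z≤n {0}) (solve (K ∷ []))

overlap-ar : ∀ K u n τ τ′ i → u + n ≡ K * τ + K * τ′ → u + K * 1008 ≤ K * 2520 → i + 1512 ≤ τ + τ′ → K * i ≤ n
overlap-ar K u n τ τ′ i e h h′ = lin 0 (+-mono-≤ (+-mono-≤ (≤-reflexive (sym e)) h) (mul-mono K h′)) (solve (K ∷ u ∷ n ∷ τ ∷ τ′ ∷ i ∷ []))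

room-ar : ∀ K u e e′ i → u + K * i ≤ K * e + K * e′ → e + e′ + 1290 ≤ 2520 + i → u + K * 1290 ≤ K * 2520
room-ar K u e e′ i h h′ = lin 0 (+-mono-≤ h (mul-mono K h′)) (solve (K ∷ u ∷ e ∷ e′ ∷ i ∷ []))

tight-ar : ∀ K n r s → n + K * r ≤ K * 860 + K * 860 → 1720 + s + s ≤ 2520 + r → n + (K * s + K * s) ≤ K * 2520
tight-ar K n r s h h′ = lin 0 (+-mono-≤ h (mul-mono K h′)) (solve (K ∷ n ∷ r ∷ s ∷ []))

credit-ar : ∀ {a b c X C V E D Q} → a + X + (b + c) + C ≤ V + (E + D) → D ≤ C → Q + X ≡ E → a + (b + c) ≤ Q + V
credit-ar {a} {b} {c} {X} {C} {V} {E} {D} {Q} h h′ refl = lin 0 (+-mono-≤ h h′) (solve (a ∷ b ∷ c ∷ X ∷ C ∷ V ∷ D ∷ Q ∷ []))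

gather-ar : ∀ {a b c m ta tb tc ca cb cc va vb vc k} →
            a + ta * m + ca ≤ va + k → b + tb * m + cb ≤ vb + k → c + tc * m + cc ≤ vc + k →
            a + (ta + (tb + tc)) * m + (b + c) + (ca + cb + cc) ≤ va + (vb + vc) + (k + (k + k))
gather-ar {a} {b} {c} {m} {ta} {tb} {tc} {ca} {cb} {cc} {va} {vb} {vc} {k} h₁ h₂ h₃ = lin 0 (+-mono-≤ h₁ (+-mono-≤ h₂ h₃))
  (solve (a ∷ b ∷ c ∷ m ∷ ta ∷ tb ∷ tc ∷ ca ∷ cb ∷ cc ∷ va ∷ vb ∷ vc ∷ k ∷ []))

two-slots-ar : ∀ {Q m t₁ t₂ c₁ c₂ w₁ w₂ k l} → c₁ + l ≤ w₁ + t₁ * m + k → c₂ + l ≤ w₂ + t₂ * m + k → Q + (t₁ + (t₂ + 0)) * m ≡ l + l →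
               Q + 0 + (c₁ + c₂) ≤ w₁ + (w₂ + 0) + (k + k)
two-slots-ar {Q} {m} {t₁} {t₂} {c₁} {c₂} {w₁} {w₂} {k} {l} h₁ h₂ e = lin 0 (+-mono-≤ (+-mono-≤ h₁ h₂) (≤-reflexive e))
  (solve (Q ∷ m ∷ t₁ ∷ t₂ ∷ c₁ ∷ c₂ ∷ w₁ ∷ w₂ ∷ k ∷ l ∷ []))

scale-ar : ∀ r s {q T E} → q + T * s ≡ E → q * r + T * (s * r) ≡ E * r
scale-ar r s {q} {T} refl = solve (r ∷ s ∷ q ∷ T ∷ [])

combine : ∀ {c i i′ s s′ a a′ y} → i ≡ i′ → s ≡ s′ → a ≡ a′ → i′ + s′ + c ≤ a′ → i + s + c ≤ a + y
combine refl refl refl h = ≤-trans h (m≤m+n _ _)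

sum6-ar : ∀ {m A B C a b c} → m + m ≤ A + a * m → m + m ≤ B + b * m → m + m ≤ C + c * m → a + (b + c) ≤ 2 → m + m + (m + m) ≤ A + B + C
sum6-ar {m} {A} {B} {C} {a} {b} {c} h₁ h₂ h₃ h = lin 0 (+-mono-≤ (+-mono-≤ h₁ (+-mono-≤ h₂ h₃)) (mul-mono m h))
  (solve (m ∷ A ∷ B ∷ C ∷ a ∷ b ∷ c ∷ []))

two-ar : ∀ a b x y m → a + x * m + (b + y * m) ≡ (a + b) + (x + y) * m
two-ar a b x y m = solve (a ∷ b ∷ x ∷ y ∷ m ∷ [])

bonus-ar : ∀ a b k → a + k + (b + k) ≡ a + b + (k + k)
bonus-ar a b k = solve (a ∷ b ∷ k ∷ [])

+-swapʳ : ∀ a b k → a + b + k ≡ a + k + b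
+-swapʳ a b k = solve (a ∷ b ∷ k ∷ [])

sum6′-ar : ∀ {m z j k A B C a b c} → m + m ≤ A + a * m → m + m ≤ B + b * m → m + m + z ≤ C + c * m → a + (b + c) ≤ 2 →
           m + m + (m + m) + z + (j + k) ≤ A + (B + j) + (C + k)
sum6′-ar {m} {z} {j} {k} {A} {B} {C} {a} {b} {c} h₁ h₂ h₃ h = lin 0 (+-mono-≤ (+-mono-≤ h₁ (+-mono-≤ h₂ h₃)) (mul-mono m h))
  (solve (m ∷ z ∷ j ∷ k ∷ A ∷ B ∷ C ∷ a ∷ b ∷ c ∷ []))

final-ar : ∀ {A B C a b c} → 19712 + 19712 ≤ A + a * 19712 → 19712 + 19712 ≤ B + b * 19712 → 19712 + 19712 + 13440 ≤ C + c * 19712 →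
           a + (b + c) ≤ 2 → 126920 ≤ A + (B + 15392) + (C + 19240)
final-ar {A} {B} {C} {a} {b} {c} h₁ h₂ h₃ h = sum6′-ar {19712} {13440} {15392} {19240} {A} {B} {C} {a} {b} {c} h₁ h₂ h₃ h

low-ar : ∀ {k l m a b x y} → k ≤ a + x * m → l ≤ b + y * m → k + l ≤ a + b + (x + y) * m
low-ar {m = m} {a} {b} {x} {y} h h′ = ≤-trans (+-mono-≤ h h′) (≤-reflexive (two-ar a b x y m))

two-cost-ar : ∀ {Q m l t₁ t₂ x₁ x₂ w₁ w₂ k₁ k₂} → x₁ + l ≤ w₁ + t₁ * m + k₁ → x₂ + l ≤ w₂ + t₂ * m + k₂ → Q + (t₁ + (t₂ + 0)) * m ≡ l + l →
              Q + (x₁ + (x₂ + 0)) ≤ w₁ + (w₂ + 0) + (k₁ + k₂)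
two-cost-ar {Q} {m} {l} {t₁} {t₂} {x₁} {x₂} {w₁} {w₂} {k₁} {k₂} h₁ h₂ e = lin 0 (+-mono-≤ (+-mono-≤ h₁ h₂) (≤-reflexive e))
  (solve (Q ∷ m ∷ l ∷ t₁ ∷ t₂ ∷ x₁ ∷ x₂ ∷ w₁ ∷ w₂ ∷ k₁ ∷ k₂ ∷ []))

cost-sum-ar : ∀ {qa qb xa xb va vb ka kb P} → qa + xa ≤ va + ka → qb + xb ≤ vb + kb → ka + kb ≤ P → qa + qb + (xa + xb) ≤ P + (va + vb)
cost-sum-ar {qa} {qb} {xa} {xb} {va} {vb} {ka} {kb} {P} h₁ h₂ h₃ = lin 0 (+-mono-≤ h₁ (+-mono-≤ h₂ h₃)) (solve (qa ∷ qb ∷ xa ∷ xb ∷ va ∷ vb ∷ ka ∷ kb ∷ P ∷ []))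

cut52-ar : ∀ {q T} → q + (1 + T) * 52 ≡ 1000 → q + T * 52 ≡ 948
cut52-ar {q} {T} e = +-cancelʳ-≡ 52 (q + T * 52) 948 (trans (swap-ar q T 52) e)
  where
  swap-ar : ∀ q T k → q + T * k + k ≡ q + (1 + T) * k
  swap-ar q T k = solve (q ∷ T ∷ k ∷ [])

combine′ : ∀ {c i i′ s s′ a a′ y} → i ≡ i′ → s ≡ s′ → a ≡ a′ → i′ + s′ + c ≤ a′ + y → i + s + c ≤ a + y
combine′ refl refl refl h = h

*-swapʳ : ∀ a k d → a * k * d ≡ a * d * k
*-swapʳ a k d = solve (a ∷ k ∷ d ∷ [])

*-shift : ∀ a v k → a * v * k ≡ a * (k * v)
*-shift a v k = solve (a ∷ v ∷ k ∷ [])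

-- Colour sets on short paths and on the 5-cycle

private
  variable
    N : ℕ

⊑-trans : {f g h : PSet N} → f ⊑ g → g ⊑ h → f ⊑ h
⊑-trans p q i e = q i (p i e)

⊑-∩ : {f g h : PSet N} → f ⊑ g → f ⊑ h → f ⊑ g ∩ h
⊑-∩ p q i e = ∧-intro (p i e) (q i e)

∩-⊑ˡ : (f g : PSet N) → f ∩ g ⊑ f
∩-⊑ˡ f g i e = proj₁ (∧-elim e)

∩-⊑ʳ : (f g : PSet N) → f ∩ g ⊑ g
∩-⊑ʳ f g i e = proj₂ (∧-elim {f i} e)

∪-⊑ : {f g h : PSet N} → f ⊑ h → g ⊑ h → f ∪ g ⊑ h
∪-⊑ {f = f} p q i e with ∨-elim {f i} e
... | inj₁ a = p i a
... | inj₂ b = q i b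

Disj-⊑ : {f f′ g g′ : PSet N} → f′ ⊑ f → g′ ⊑ g → Disj f g → Disj f′ g′
Disj-⊑ p q d i a b = d i (p i a) (q i b)

abstract
  sub : (X : PSet N) → ∀ m → m ≤ cnt X → Σ (PSet N) λ Y → Y ⊑ X × cnt Y ≡ m
  sub {N} X m h with Y , _ , q , r ← between ∅ X m (λ _ ()) (≤-trans (≤-reflexive (cnt-∅ {N})) z≤n) h = Y , q , r

cnt-∁-≥ : ∀ (f : PSet N) {m} → cnt f + m ≤ N → m ≤ cnt (∁ f)
cnt-∁-≥ f {m} h = +-cancelˡ-≤ (cnt f) m _ (≤-trans h (≤-reflexive (sym (cnt-∁ f))))

cnt-∪-≤ : (f g : PSet N) → cnt (f ∪ g) ≤ cnt f + cnt g
cnt-∪-≤ f g = ≤-trans (m≤m+n _ _) (≤-reflexive (cnt-∪∩ f g))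

cnt-disj : (f g : PSet N) → Disj f g → cnt f + cnt g ≤ cnt (f ∪ g)
cnt-disj {N} f g d = ≤-trans (≤-reflexive (sym (cnt-∪∩ f g)))
  (≤-trans (+-monoʳ-≤ _ (≤-trans (cnt-mono {f = f ∩ g} {∅} λ i e → ⊥-elim (d i (proj₁ (∧-elim e)) (proj₂ (∧-elim {f i} e))))
     (≤-reflexive (cnt-∅ {N})))) (≤-reflexive (+-identityʳ _)))

cnt-∖ : (X Y : PSet N) → cnt X ≤ cnt (X ∩ ∁ Y) + cnt Y
cnt-∖ X Y = ≤-trans (cnt-mono {f = X} {(X ∩ ∁ Y) ∪ Y} go) (cnt-∪-≤ (X ∩ ∁ Y) Y)
  where
  go : X ⊑ (X ∩ ∁ Y) ∪ Y
  go i e with Y i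
  ... | true = ∨-introʳ {X i ∧ false} refl
  ... | false = ∨-introˡ (∧-intro e refl)

cnt-∖≡ : (X Y : PSet N) → Y ⊑ X → cnt (X ∩ ∁ Y) + cnt Y ≡ cnt X
cnt-∖≡ X Y h = ≤-antisym
  (≤-trans (cnt-disj (X ∩ ∁ Y) Y λ i a b → not-true (proj₂ (∧-elim {X i} a)) b)
           (cnt-mono {f = (X ∩ ∁ Y) ∪ Y} {X} (∪-⊑ {f = X ∩ ∁ Y} {Y} {X} (∩-⊑ˡ X (∁ Y)) h)))
  (cnt-∖ X Y)

-- The sets c₁, c₂, c₃, c₄ continue A around a 5-cycle.
record Pent (A : PSet N) (s : ℕ) : Set where
  field
    c₁ c₂ c₃ c₄ : PSet N
    dA₁ : Disj A c₁
    dA₄ : Disj A c₄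
    d₁₂ : Disj c₁ c₂
    d₂₃ : Disj c₂ c₃
    d₃₄ : Disj c₃ c₄
    n₁ : s ≤ cnt c₁
    n₂ : s ≤ cnt c₂
    n₃ : s ≤ cnt c₃
    n₄ : s ≤ cnt c₄

private
  pent-ar₁ : ∀ {N} a a′ d c s → a + a′ ≡ N → d + c ≡ a′ → c ≡ s → N ≤ a + (s + s) → d ≤ s
  pent-ar₁ a a′ d c s refl refl refl h = lin 0 h (solve (a ∷ d ∷ c ∷ []))
  pent-ar₂ : ∀ a c s N → c ≡ s → 4 * s + a ≤ 2 * N → a + s ≤ N → c + s ≤ N
  pent-ar₂ a c s N refl h h′ = *-cancelˡ-≤ 2 (lin a h (solve (a ∷ c ∷ N ∷ [])))
  pent-ar₃ : ∀ a a′ d c₁ c₄ c₂ u n s N → a + a′ ≡ N → d + c₁ ≡ a′ → c₁ ≡ s → c₄ ≡ s → c₂ ≡ s →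
        u + n ≡ c₄ + c₂ → d ≤ n → 4 * s + a ≤ 2 * N → u + s ≤ N
  pent-ar₃ a a′ d c₁ c₄ c₂ u n s N refl refl refl refl refl e h h′ =
    lin 0 (+-mono-≤ (+-mono-≤ (≤-reflexive e) h) h′) (solve (a ∷ d ∷ c₁ ∷ u ∷ n ∷ []))

abstract
  -- Both `c₂` and `c₄` are made to contain everything outside `A` and `c₁`, which makes their union
  -- small, and `c₃` is the complement of that union. It has at least `2N − cnt A − 3s` elements, so
  -- the last hypothesis is the obvious necessary condition: a colour occurs at most twice on a
  -- 5-cycle.
  pent : (A : PSet N) → ∀ s → cnt A + s ≤ N → N ≤ cnt A + (s + s) → 4 * s + cnt A ≤ 2 * N → Pent A s
  pent {N} A s h₁ h₂ h₃
    with c₁ , p₁ , q₁ ← sub (∁ A) s (cnt-∁-≥ A h₁)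
    with sD ← cnt-∖≡ (∁ A) c₁ p₁
    with c₄ , p₄ , p₄′ , q₄ ← between (∁ A ∩ ∁ c₁) (∁ A) s (∩-⊑ˡ (∁ A) (∁ c₁))
           (pent-ar₁ (cnt A) (cnt (∁ A)) (cnt (∁ A ∩ ∁ c₁)) (cnt c₁) s (cnt-∁ A) sD q₁ h₂) (cnt-∁-≥ A h₁)
    with c₂ , p₂ , p₂′ , q₂ ← between (∁ A ∩ ∁ c₁) (∁ c₁) s (∩-⊑ʳ (∁ A) (∁ c₁))
           (pent-ar₁ (cnt A) (cnt (∁ A)) (cnt (∁ A ∩ ∁ c₁)) (cnt c₁) s (cnt-∁ A) sD q₁ h₂)
           (cnt-∁-≥ c₁ (pent-ar₂ (cnt A) (cnt c₁) s N q₁ h₃ h₁))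
    = record { c₁ = c₁ ; c₂ = c₂ ; c₃ = ∁ (c₄ ∪ c₂) ; c₄ = c₄
             ; dA₁ = Disj-sym {f = c₁} {A} (⊑∁⇒Disj {f = c₁} p₁) ; dA₄ = Disj-sym {f = c₄} {A} (⊑∁⇒Disj {f = c₄} p₄′)
             ; d₁₂ = Disj-sym {f = c₂} {c₁} (⊑∁⇒Disj {f = c₂} p₂′)
             ; d₂₃ = λ i a b → not-true b (∨-introʳ {c₄ i} a)
             ; d₃₄ = λ i a b → not-true a (∨-introˡ b)
             ; n₁ = ≤-reflexive (sym q₁) ; n₂ = ≤-reflexive (sym q₂) ; n₄ = ≤-reflexive (sym q₄)
             ; n₃ = cnt-∁-≥ (c₄ ∪ c₂) (pent-ar₃ (cnt A) (cnt (∁ A)) (cnt (∁ A ∩ ∁ c₁)) (cnt c₁) (cnt c₄) (cnt c₂)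
                      (cnt (c₄ ∪ c₂)) (cnt (c₄ ∩ c₂)) s N (cnt-∁ A) sD q₁ q₄ q₂ (cnt-∪∩ c₄ c₂)
                      (cnt-mono {f = ∁ A ∩ ∁ c₁} {c₄ ∩ c₂} (⊑-∩ {f = ∁ A ∩ ∁ c₁} {c₄} {c₂} p₄ p₂)) h₃) }

-- The sets c₁, c₂, c₃ lie on a path between vertices coloured A and B.
record Run (A B : PSet N) (s : ℕ) : Set where
  field
    c₁ c₂ c₃ : PSet N
    dA : Disj A c₁
    dB : Disj B c₃
    d₁₂ : Disj c₁ c₂
    d₂₃ : Disj c₂ c₃
    n₁ : s ≤ cnt c₁
    n₂ : s ≤ cnt c₂
    n₃ : s ≤ cnt c₃

private
  run-ar₁ : ∀ {N i} a b a′ b′ n u → a + a′ ≡ N → b + b′ ≡ N → u + n ≡ a′ + b′ → u ≤ N → a + b + i ≤ N → i ≤ n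
  run-ar₁ {N} {i} a b a′ b′ n u ea eb e hu h =
    lin 0 (+-mono-≤ (+-mono-≤ (≤-reflexive (sym ea)) (≤-reflexive (sym eb))) (+-mono-≤ (≤-reflexive (sym e)) (+-mono-≤ hu h)))
      (solve (N ∷ i ∷ a ∷ b ∷ a′ ∷ b′ ∷ n ∷ u ∷ []))
  run-ar₂ : ∀ c d u n i s N → c ≡ s → d ≡ s → u + n ≡ c + d → i ≤ n → 3 * s ≤ N + i → u + s ≤ N
  run-ar₂ c d u n i s N refl refl e h h′ = lin 0 (+-mono-≤ (≤-reflexive e) (+-mono-≤ h h′)) (solve (c ∷ u ∷ n ∷ i ∷ N ∷ []))

abstract
  -- `c₁` and `c₃` are made to share `i` colours outside `A` and `B`. Their union has at most
  -- `2s − i` elements, and its complement serves as `c₂`.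
  run : (A B : PSet N) → ∀ i s → cnt A + s ≤ N → cnt B + s ≤ N → cnt A + cnt B + i ≤ N → i ≤ s → 3 * s ≤ N + i → Run A B s
  run {N} A B i s hA hB hi hs h
    with I , pI , qI ← sub (∁ A ∩ ∁ B) i (run-ar₁ (cnt A) (cnt B) (cnt (∁ A)) (cnt (∁ B)) (cnt (∁ A ∩ ∁ B)) (cnt (∁ A ∪ ∁ B)) (cnt-∁ A) (cnt-∁ B)
                            (cnt-∪∩ (∁ A) (∁ B)) (≤-trans (m≤m+n _ _) (≤-reflexive (cnt-∁ (∁ A ∪ ∁ B)))) hi)
    with c₁ , p₁ , p₁′ , q₁ ← between I (∁ A) s (⊑-trans {f = I} {∁ A ∩ ∁ B} {∁ A} pI (∩-⊑ˡ (∁ A) (∁ B))) (≤-trans (≤-reflexive qI) hs) (cnt-∁-≥ A hA)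
    with c₃ , p₃ , p₃′ , q₃ ← between I (∁ B) s (⊑-trans {f = I} {∁ A ∩ ∁ B} {∁ B} pI (∩-⊑ʳ (∁ A) (∁ B))) (≤-trans (≤-reflexive qI) hs) (cnt-∁-≥ B hB)
    = record { c₁ = c₁ ; c₂ = ∁ (c₁ ∪ c₃) ; c₃ = c₃
             ; dA = Disj-sym {f = c₁} {A} (⊑∁⇒Disj {f = c₁} p₁′) ; dB = Disj-sym {f = c₃} {B} (⊑∁⇒Disj {f = c₃} p₃′)
             ; d₁₂ = λ i a b → not-true b (∨-introˡ a)
             ; d₂₃ = λ i a b → not-true a (∨-introʳ {c₁ i} b)
             ; n₁ = ≤-reflexive (sym q₁) ; n₃ = ≤-reflexive (sym q₃)
             ; n₂ = cnt-∁-≥ (c₁ ∪ c₃) (run-ar₂ (cnt c₁) (cnt c₃) (cnt (c₁ ∪ c₃)) (cnt (c₁ ∩ c₃)) i s N q₁ q₃ (cnt-∪∩ c₁ c₃)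
                      (≤-trans (≤-reflexive (sym qI)) (cnt-mono {f = I} {c₁ ∩ c₃} (⊑-∩ {f = I} {c₁} {c₃} p₁ p₃))) h) }

record Pair (A B : PSet N) (s : ℕ) : Set where
  field
    c₁ c₂ : PSet N
    dA : Disj A c₁
    dB : Disj B c₂
    d₁₂ : Disj c₁ c₂
    n₁ : s ≤ cnt c₁
    n₂ : s ≤ cnt c₂

abstract
  -- `c₁` prefers the colours of `B` outside `A`, because `c₂` cannot use them. If these suffice,
  -- `c₂` is the complement of `B`. Otherwise `c₁` contains all of them, `B ∪ c₁` has at most
  -- `cnt (A ∩ B) + s` elements, and `c₂` is its complement.
  pair : (A B : PSet N) → ∀ s → cnt A + s ≤ N → cnt B + s ≤ N → cnt (A ∩ B) + (s + s) ≤ N → Pair A B s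
  pair {N} A B s hA hB h with s ≤? cnt (B ∩ ∁ A)
  ... | yes p with c₁ , p₁ , q₁ ← sub (B ∩ ∁ A) s p
    = record { c₁ = c₁ ; c₂ = ∁ B
             ; dA = λ i a b → not-true (proj₂ (∧-elim {B i} (p₁ i b))) a
             ; dB = λ i a b → not-true b a
             ; d₁₂ = λ i a b → not-true b (proj₁ (∧-elim (p₁ i a)))
             ; n₁ = ≤-reflexive (sym q₁) ; n₂ = cnt-∁-≥ B hB }
  ... | no p with c₁ , p₁ , p₁′ , q₁ ← between (B ∩ ∁ A) (∁ A) s (∩-⊑ʳ B (∁ A)) (<⇒≤ (≰⇒> p)) (cnt-∁-≥ A hA)
    = record { c₁ = c₁ ; c₂ = ∁ (B ∪ c₁)
             ; dA = Disj-sym {f = c₁} {A} (⊑∁⇒Disj {f = c₁} p₁′)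
             ; dB = λ i a b → not-true b (∨-introˡ a)
             ; d₁₂ = λ i a b → not-true b (∨-introʳ {B i} a)
             ; n₁ = ≤-reflexive (sym q₁)
             ; n₂ = cnt-∁-≥ (B ∪ c₁) (ar (cnt B) (cnt c₁) (cnt (B ∪ c₁)) (cnt (B ∩ c₁)) (cnt (B ∩ ∁ A)) (cnt (A ∩ B)) s N
                     q₁ (cnt-∪∩ B c₁) (cnt-mono {f = B ∩ ∁ A} {B ∩ c₁} (⊑-∩ {f = B ∩ ∁ A} {B} {c₁} (∩-⊑ˡ B (∁ A)) p₁))
                     (≤-trans (cnt-mono {f = B} {(B ∩ ∁ A) ∪ (A ∩ B)} go) (cnt-∪-≤ (B ∩ ∁ A) (A ∩ B))) h) }
    where
    go : B ⊑ (B ∩ ∁ A) ∪ (A ∩ B)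
    go i e with A i
    ... | true = ∨-introʳ {B i ∧ false} e
    ... | false = ∨-introˡ (∧-intro e refl)
    ar : ∀ b c u n d x s N → c ≡ s → u + n ≡ b + c → d ≤ n → b ≤ d + x → x + (s + s) ≤ N → u + s ≤ N
    ar b c u n d x s N refl e h₁ h₂ h₃ = lin 0 (+-mono-≤ (+-mono-≤ (≤-reflexive e) h₁) (+-mono-≤ h₂ h₃))
      (solve (b ∷ c ∷ u ∷ n ∷ d ∷ x ∷ N ∷ []))

private
  twoIn-ar₁ : ∀ d a c e r → d + a ≡ c → a ≡ e → c ≡ r → r ≤ e + e → d ≤ e
  twoIn-ar₁ d a c e r refl refl refl h = +-cancelʳ-≤ a d a h
  twoIn-ar₂ : ∀ a b u n c e r → a ≡ e → b ≡ e → c ≡ r → u + n ≡ a + b → c ≤ u → n + r ≤ e + e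
  twoIn-ar₂ a b u n c e r refl refl refl h h′ = lin 0 (+-mono-≤ (≤-reflexive h) h′) (solve (a ∷ u ∷ n ∷ c ∷ []))

abstract
  -- The overlap is kept down to `2e − r` by letting the two sets cover `r` elements of `R`. This is
  -- for `pair`, where the common part of `A` and `B` is lost to both vertices in between.
  twoIn : (R : PSet N) → ∀ e r → r ≤ cnt R → e ≤ r → r ≤ e + e →
          Σ (PSet N) λ A → Σ (PSet N) λ B → A ⊑ R × B ⊑ R × cnt A ≡ e × cnt B ≡ e × cnt (A ∩ B) + r ≤ e + e
  twoIn {N} R e r hr he hr′
    with R′ , p , q ← sub R r hr
    with A , pA , qA ← sub R′ e (≤-trans he (≤-reflexive (sym q)))
    with B , pB , pB′ , qB ← between (R′ ∩ ∁ A) R′ e (∩-⊑ˡ R′ (∁ A))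
           (twoIn-ar₁ (cnt (R′ ∩ ∁ A)) (cnt A) (cnt R′) e r (cnt-∖≡ R′ A pA) qA q hr′) (≤-trans he (≤-reflexive (sym q)))
    = A , B , ⊑-trans {f = A} {R′} {R} pA p , ⊑-trans {f = B} {R′} {R} pB′ p , qA , qB
    , twoIn-ar₂ (cnt A) (cnt B) (cnt (A ∪ B)) (cnt (A ∩ B)) (cnt R′) e r qA qB q (cnt-∪∩ A B) (cnt-mono {f = R′} {A ∪ B} go)
    where
    go : R′ ⊑ A ∪ B
    go i e with A i in eq
    ... | true = refl
    ... | false = pB i (∧-intro e (cong not eq))

abstract
  -- The opposite of `twoIn`: a forced overlap keeps the union small.
  spread : (T T′ : PSet N) → ∀ e e′ i → i ≤ cnt (T ∩ T′) → i ≤ e → i ≤ e′ → e ≤ cnt T → e′ ≤ cnt T′ →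
           Σ (PSet N) λ A → Σ (PSet N) λ B → A ⊑ T × B ⊑ T′ × cnt A ≡ e × cnt B ≡ e′ × cnt (A ∪ B) + i ≤ e + e′
  spread {N} T T′ e e′ i hi hie hie′ hT hT′
    with I , p , q ← sub (T ∩ T′) i hi
    with A , pA , pA′ , qA ← between I T e (⊑-trans {f = I} {T ∩ T′} {T} p (∩-⊑ˡ T T′)) (≤-trans (≤-reflexive q) hie) hT
    with B , pB , pB′ , qB ← between I T′ e′ (⊑-trans {f = I} {T ∩ T′} {T′} p (∩-⊑ʳ T T′)) (≤-trans (≤-reflexive q) hie′) hT′
    = A , B , pA′ , pB′ , qA , qB
    , ≤-trans (+-monoʳ-≤ _ (≤-trans (≤-reflexive (sym q)) (cnt-mono {f = I} {A ∩ B} (⊑-∩ {f = I} {A} {B} pA pB))))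
        (≤-reflexive (trans (cnt-∪∩ A B) (cong₂ _+_ qA qB)))

-- Weighted sums over lists

private
  variable
    I I′ : Set

ΣL : (I → ℕ) → List I → ℕ
ΣL f [] = 0
ΣL f (x ∷ xs) = f x + ΣL f xs

ΣL-mono : ∀ {f g : I → ℕ} xs → (∀ x → x ∈ xs → f x ≤ g x) → ΣL f xs ≤ ΣL g xs
ΣL-mono [] h = z≤n
ΣL-mono (x ∷ xs) h = +-mono-≤ (h x (here refl)) (ΣL-mono xs λ y m → h y (there m))

ΣL-cong : ∀ {f g : I → ℕ} xs → (∀ x → x ∈ xs → f x ≡ g x) → ΣL f xs ≡ ΣL g xs
ΣL-cong [] h = refl
ΣL-cong (x ∷ xs) h = cong₂ _+_ (h x (here refl)) (ΣL-cong xs λ y m → h y (there m))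

ΣL-+ : ∀ (f g : I → ℕ) xs → ΣL (λ x → f x + g x) xs ≡ ΣL f xs + ΣL g xs
ΣL-+ f g [] = refl
ΣL-+ f g (x ∷ xs) rewrite ΣL-+ f g xs = ar (f x) (g x) (ΣL f xs) (ΣL g xs)
  where
  ar : ∀ a b c d → a + b + (c + d) ≡ a + c + (b + d)
  ar a b c d = solve (a ∷ b ∷ c ∷ d ∷ [])

ΣL-* : ∀ (f : I → ℕ) c xs → ΣL (λ x → f x * c) xs ≡ ΣL f xs * c
ΣL-* f c [] = refl
ΣL-* f c (x ∷ xs) rewrite ΣL-* f c xs = sym (*-distribʳ-+ c (f x) (ΣL f xs))

ΣL-0 : ∀ (xs : List I) → ΣL (λ _ → 0) xs ≡ 0
ΣL-0 [] = refl
ΣL-0 (x ∷ xs) = ΣL-0 xs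

ΣL-swap : ∀ (f : I → I′ → ℕ) xs ys → ΣL (λ x → ΣL (f x) ys) xs ≡ ΣL (λ y → ΣL (λ x → f x y) xs) ys
ΣL-swap f [] ys = sym (ΣL-0 ys)
ΣL-swap f (x ∷ xs) ys rewrite ΣL-swap f xs ys = sym (ΣL-+ (f x) (λ y → ΣL (λ x → f x y) xs) ys)

ΣL-++ : ∀ (f : I → ℕ) xs ys → ΣL f (xs ++ ys) ≡ ΣL f xs + ΣL f ys
ΣL-++ f [] ys = refl
ΣL-++ f (x ∷ xs) ys rewrite ΣL-++ f xs ys = sym (+-assoc (f x) _ _)

ΣL-filter : ∀ (f : I → ℕ) {P : I → Set} (P? : Decidable P) xs →
            ΣL (λ x → f x * b2n (does (P? x))) xs ≡ ΣL f (filter P? xs)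
ΣL-filter f P? [] = refl
ΣL-filter f P? (x ∷ xs) with P? x
... | yes _ rewrite *-identityʳ (f x) | ΣL-filter f P? xs = refl
... | no _ rewrite *-zeroʳ (f x) = ΣL-filter f P? xs

ΣL-∈ : ∀ (f : I → ℕ) {x} xs → x ∈ xs → f x ≤ ΣL f xs
ΣL-∈ f (x ∷ xs) (here refl) = m≤m+n _ _
ΣL-∈ f (x ∷ xs) (there m) = ≤-trans (ΣL-∈ f xs m) (m≤n+m _ _)

-- Repetition in the list stands for the weights, so that a weighted mean of colourings becomes a
-- concatenation.
layers : (I → ℕ) → List I → List I
layers p = concatMap (λ x → replicate (p x) x)

ΣL-layers : ∀ (p f : I → ℕ) xs → ΣL f (layers p xs) ≡ ΣL (λ x → p x * f x) xs
ΣL-layers p f [] = refl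
ΣL-layers p f (x ∷ xs) rewrite ΣL-++ f (replicate (p x) x) (layers p xs) | ΣL-layers p f xs = cong (_+ _) (go (p x))
  where
  go : ∀ m → ΣL f (replicate m x) ≡ m * f x
  go zero = refl
  go (suc m) = cong (f x +_) (go m)

length-ΣL : ∀ (xs : List I) → length xs ≡ ΣL (λ _ → 1) xs
length-ΣL [] = refl
length-ΣL (x ∷ xs) = cong suc (length-ΣL xs)

module Core (G : Graph) (tf : TriangleFree G) (md : MaxDegreeAtMost 3 G) where
  open import Data.List.Relation.Unary.All as All using (All; []; _∷_; all?)
  open import Data.List.Relation.Unary.AllPairs using ([]; _∷_)
  open import Data.List.Membership.DecPropositional (Fₚ._≟_ {n G}) using (_∈?_)

  -- Local configurations and demands

  V : Set
  V = Fin (n G)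

  infix 4 _≟ᵥ_
  _≟ᵥ_ : (u v : V) → Dec (u ≡ v)
  _≟ᵥ_ = Fₚ._≟_

  VSet : Set
  VSet = V → Bool

  infix 4 _~_
  _~_ : V → V → Set
  u ~ v = adj G u v ≡ true

  ~-sym : ∀ {u v} → u ~ v → v ~ u
  ~-sym {u} {v} e = trans (Graph.sym G v u) e

  ~-irr : ∀ {u} → u ~ u → ⊥
  ~-irr {u} e with () ← trans (sym (irrefl G u)) e

  nb? : (U : VSet) (v w : V) → Dec (U w ∧ adj G v w ≡ true)
  nb? U v w = (U w ∧ adj G v w) Boolₚ.≟ true

  abstract
    nb : VSet → V → List V
    nb U v = filter (nb? U v) (allFin (n G))

    nb-def : ∀ U v → nb U v ≡ filter (nb? U v) (allFin (n G))
    nb-def U v = refl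

  deg : VSet → V → ℕ
  deg U v = length (nb U v)

  abstract
    nb⁺ : ∀ {U v w} → U w ≡ true → v ~ w → w ∈ nb U v
    nb⁺ {U} {v} {w} a b = ∈-filter⁺ (nb? U v) (∈-allFin w) (∧-intro a b)

    nb-U : ∀ {U v w} → w ∈ nb U v → U w ≡ true
    nb-U {U} {v} m = proj₁ (∧-elim (proj₂ (∈-filter⁻ (nb? U v) {xs = allFin (n G)} m)))

    nb-~ : ∀ {U v w} → w ∈ nb U v → v ~ w
    nb-~ {U} {v} {w} m = proj₂ (∧-elim {U w} (proj₂ (∈-filter⁻ (nb? U v) {xs = allFin (n G)} m)))

  nb-sym : ∀ {U v w} → U v ≡ true → w ∈ nb U v → v ∈ nb U w
  nb-sym a m = nb⁺ a (~-sym (nb-~ m))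

  tri : ∀ {u v w} → u ~ v → v ~ w → u ~ w → ⊥
  tri = tf _ _ _

  abstract
    nb-unique : ∀ U v → Unique (nb U v)
    nb-unique U v = Uₚ.filter⁺ (nb? U v) (Uₚ.allFin⁺ (n G))

    deg≤3 : ∀ U v → deg U v ≤ 3
    deg≤3 U v = ≤-trans (go (n G) id) (md v)
      where
      go : ∀ m (h : Fin m → V) → length (filter (nb? U v) (tabulate h)) ≤ ∣ Vec.tabulate (adj G v ∘ h) ∣
      go zero h = z≤n
      go (suc m) h with U (h zero) | adj G v (h zero)
      ... | true | true = s≤s (go m (h ∘ suc))
      ... | true | false = go m (h ∘ suc)
      ... | false | true = m≤n⇒m≤1+n (go m (h ∘ suc))
      ... | false | false = go m (h ∘ suc)

  Sub2 : VSet → V → V → V → Set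
  Sub2 U a x y = ∀ w → w ∈ nb U a → w ≡ x ⊎ w ≡ y

  Sub3 : VSet → V → V → V → V → Set
  Sub3 U a x y z = ∀ w → w ∈ nb U a → w ≡ x ⊎ w ≡ y ⊎ w ≡ z

  sub2? : ∀ U a x y → Dec (Sub2 U a x y)
  sub2? U a x y = Fₚ.all? λ w → (w ∈? nb U a) →-dec ((w ≟ᵥ x) ⊎-dec (w ≟ᵥ y))

  sub3? : ∀ U a x y z → Dec (Sub3 U a x y z)
  sub3? U a x y z = Fₚ.all? λ w → (w ∈? nb U a) →-dec ((w ≟ᵥ x) ⊎-dec ((w ≟ᵥ y) ⊎-dec (w ≟ᵥ z)))

  -- The 5-cycle v a c d b whose vertices other than v have no further neighbours.
  record IsPend (U : VSet) (v a b c d : V) : Set where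
    constructor mkPend
    field
      Uv  : U v ≡ true
      va  : a ∈ nb U v
      vb  : b ∈ nb U v
      a≢b : a ≢ b
      ac  : c ∈ nb U a
      bd  : d ∈ nb U b
      cd  : d ∈ nb U c
      Sa  : Sub2 U a v c
      Sb  : Sub2 U b v d
      Sc  : Sub2 U c a d
      Sd  : Sub2 U d b c

  isPend? : ∀ U v a b c d → Dec (IsPend U v a b c d)
  isPend? U v a b c d = map′
    (λ { (x1 , x2 , x3 , x4 , x5 , x6 , x7 , x8 , x9 , x10 , x11) → mkPend x1 x2 x3 x4 x5 x6 x7 x8 x9 x10 x11 })
    (λ { (mkPend x1 x2 x3 x4 x5 x6 x7 x8 x9 x10 x11) → (x1 , x2 , x3 , x4 , x5 , x6 , x7 , x8 , x9 , x10 , x11) })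
    ((U v Boolₚ.≟ true) ×-dec (a ∈? nb U v) ×-dec (b ∈? nb U v) ×-dec ¬? (a ≟ᵥ b) ×-dec (c ∈? nb U a) ×-dec (d ∈? nb U b)
     ×-dec (d ∈? nb U c) ×-dec sub2? U a v c ×-dec sub2? U b v d ×-dec sub2? U c a d ×-dec sub2? U d b c)

  -- The 5-cycle is closed at `v` as well, so it is the component of `v`.
  C5at : VSet → V → Set
  C5at U v = ∃ λ a → ∃ λ b → ∃ λ c → ∃ λ d → IsPend U v a b c d × Sub2 U v a b

  abstract
    c5? : ∀ U v → Dec (C5at U v)
    c5? U v = Fₚ.any? λ a → Fₚ.any? λ b → Fₚ.any? λ c → Fₚ.any? λ d → isPend? U v a b c d ×-dec sub2? U v a b

  -- The 4-cycle v₂ v₄ v₃ v₅ together with the path v₂ v₀ v₁ v₃.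
  record IsB (U : VSet) (v₀ v₁ v₂ v₃ v₄ v₅ : V) : Set where
    constructor mkB
    field
      U₀   : U v₀ ≡ true
      m₀₁  : v₁ ∈ nb U v₀
      m₀₂  : v₂ ∈ nb U v₀
      1≢2  : v₁ ≢ v₂
      m₁₃  : v₃ ∈ nb U v₁
      0≢3  : v₀ ≢ v₃
      m₂₄  : v₄ ∈ nb U v₂
      m₂₅  : v₅ ∈ nb U v₂
      4≢5  : v₄ ≢ v₅
      m₃₄  : v₄ ∈ nb U v₃
      m₃₅  : v₅ ∈ nb U v₃
      S₀   : Sub2 U v₀ v₁ v₂
      S₁   : Sub2 U v₁ v₀ v₃
      S₂   : Sub3 U v₂ v₀ v₄ v₅
      S₃   : Sub3 U v₃ v₁ v₄ v₅

  isB? : ∀ U v₀ v₁ v₂ v₃ v₄ v₅ → Dec (IsB U v₀ v₁ v₂ v₃ v₄ v₅)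
  isB? U v₀ v₁ v₂ v₃ v₄ v₅ = map′
    (λ { (x1 , x2 , x3 , x4 , x5 , x6 , x7 , x8 , x9 , x10 , x11 , x12 , x13 , x14 , x15) → mkB x1 x2 x3 x4 x5 x6 x7 x8 x9 x10 x11 x12 x13 x14 x15 })
    (λ { (mkB x1 x2 x3 x4 x5 x6 x7 x8 x9 x10 x11 x12 x13 x14 x15) → (x1 , x2 , x3 , x4 , x5 , x6 , x7 , x8 , x9 , x10 , x11 , x12 , x13 , x14 , x15) })
    ((U v₀ Boolₚ.≟ true) ×-dec (v₁ ∈? nb U v₀) ×-dec (v₂ ∈? nb U v₀) ×-dec ¬? (v₁ ≟ᵥ v₂) ×-dec (v₃ ∈? nb U v₁) ×-dec ¬? (v₀ ≟ᵥ v₃)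
     ×-dec (v₄ ∈? nb U v₂) ×-dec (v₅ ∈? nb U v₂) ×-dec ¬? (v₄ ≟ᵥ v₅) ×-dec (v₄ ∈? nb U v₃) ×-dec (v₅ ∈? nb U v₃)
     ×-dec sub2? U v₀ v₁ v₂ ×-dec sub2? U v₁ v₀ v₃ ×-dec sub3? U v₂ v₀ v₄ v₅ ×-dec sub3? U v₃ v₁ v₄ v₅)

  -- Two such paths v₂ v₀ v₁ v₃ and v₄ p q v₅ on one 4-cycle, forming a component.
  record IsKS (U : VSet) (v₀ v₁ v₂ v₃ v₄ v₅ p q : V) : Set where
    constructor mkKS
    field
      isB : IsB U v₀ v₁ v₂ v₃ v₄ v₅
      m₄p : p ∈ nb U v₄
      m₅q : q ∈ nb U v₅
      mpq : q ∈ nb U p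
      p≢2 : p ≢ v₂
      p≢3 : p ≢ v₃
      q≢2 : q ≢ v₂
      q≢3 : q ≢ v₃
      S₄  : Sub3 U v₄ p v₂ v₃
      S₅  : Sub3 U v₅ q v₂ v₃
      Sp  : Sub2 U p q v₄
      Sq  : Sub2 U q p v₅
    open IsB isB public

  isKS? : ∀ U v₀ v₁ v₂ v₃ v₄ v₅ p q → Dec (IsKS U v₀ v₁ v₂ v₃ v₄ v₅ p q)
  isKS? U v₀ v₁ v₂ v₃ v₄ v₅ p q = map′
    (λ { (x1 , x2 , x3 , x4 , x5 , x6 , x7 , x8 , x9 , x10 , x11 , x12) → mkKS x1 x2 x3 x4 x5 x6 x7 x8 x9 x10 x11 x12 })
    (λ { (mkKS x1 x2 x3 x4 x5 x6 x7 x8 x9 x10 x11 x12) → (x1 , x2 , x3 , x4 , x5 , x6 , x7 , x8 , x9 , x10 , x11 , x12) })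
    (isB? U v₀ v₁ v₂ v₃ v₄ v₅ ×-dec (p ∈? nb U v₄) ×-dec (q ∈? nb U v₅) ×-dec (q ∈? nb U p)
     ×-dec ¬? (p ≟ᵥ v₂) ×-dec ¬? (p ≟ᵥ v₃) ×-dec ¬? (q ≟ᵥ v₂) ×-dec ¬? (q ≟ᵥ v₃)
     ×-dec sub3? U v₄ p v₂ v₃ ×-dec sub3? U v₅ q v₂ v₃ ×-dec sub2? U p q v₄ ×-dec sub2? U q p v₅)

  -- Only vertices of degree two are asked for, in the position of `v₀`; those of degree three have
  -- demand 860 in any component.
  KSat : VSet → V → Set
  KSat U v₀ = ∃ λ v₁ → ∃ λ v₂ → ∃ λ v₃ → ∃ λ v₄ → ∃ λ v₅ → ∃ λ p → ∃ λ q → IsKS U v₀ v₁ v₂ v₃ v₄ v₅ p q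

  abstract
    ks? : ∀ U v → Dec (KSat U v)
    ks? U v = Fₚ.any? λ v₁ → Fₚ.any? λ v₂ → Fₚ.any? λ v₃ → Fₚ.any? λ v₄ → Fₚ.any? λ v₅ → Fₚ.any? λ p → Fₚ.any? λ q →
      isKS? U v v₁ v₂ v₃ v₄ v₅ p q

  -- Together with degree one, where `demBy` consults it, this says that the component of `v` is K₂.
  K2at : VSet → V → Set
  K2at U v = Any.Any (λ u → All (_≡ v) (nb U u)) (nb U v)

  abstract
    k2? : ∀ U v → Dec (K2at U v)
    k2? U v = any? (λ u → all? (_≟ᵥ v) (nb U u)) (nb U v)

  -- Demands are measures of colours out of 2520, and 2520 / 860 = 126 / 43. On C₅ no more than 1008 = 2520 · 2 / 5 is possible.
  demBy : ℕ → Bool → Bool → Bool → ℕ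
  demBy 0 _ _ _ = 2520
  demBy 1 k2 _ _ = if k2 then 1260 else 1475
  demBy 2 _ c5 ks = if c5 then 1008 else (if ks then 1030 else 1045)
  demBy (suc (suc (suc _))) _ _ _ = 860

  dem : VSet → V → ℕ
  dem U v = demBy (deg U v) (does (k2? U v)) (does (c5? U v)) (does (ks? U v))

  -- A leaf needs to be given only 1260: boost replaces its set by the complement of the set of its neighbour.
  wdem : VSet → V → ℕ
  wdem U v = demBy (deg U v) true (does (c5? U v)) (does (ks? U v))

  size : VSet → ℕ
  size U = length (filter (λ v → U v Boolₚ.≟ true) (allFin (n G)))

  all : List V
  all = allFin (n G)

  -- Fractional colourings of induced subgraphs

  record Fam (M : ℕ) : Set where
    constructor fam
    field
      S     : V → PSet M
      valid : ∀ u w → u ~ w → Disj (S u) (S w)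

  open Fam

  record ColK (U : VSet) (K : ℕ) : Set where
    constructor colK
    field
      M   : ℕ
      M≡  : M ≡ K * 2520
      F   : Fam M
      dm  : ∀ v → U v ≡ true → K * dem U v ≤ cnt (S F v)

  -- The multiplier `K` is left open, which makes this a statement about fractional colourings:
  -- scaling and averaging enlarge `K`.
  Col : VSet → Set
  Col U = Σ ℕ λ K → 0 < K × ColK U K

  mix : ∀ {I : Set} {M} (F : I → Fam M) (xs : List I) →
        Σ (Fam (length xs * M)) λ H → ∀ w → cnt (S H w) ≡ ΣL (λ i → cnt (S (F i) w)) xs
  mix F [] = fam (λ _ ()) (λ _ _ _ ()) , λ _ → refl
  mix {M = M} F (x ∷ xs) with mix F xs
  ... | H , e
    = fam (λ w → join (S (F x) w) (S H w)) (λ u w a i → go u w a i)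
    , λ w → trans (cnt-join (S (F x) w) (S H w)) (cong (_ +_) (e w))
    where

    go : ∀ u w → u ~ w → Disj (join (S (F x) u) (S H u)) (join (S (F x) w) (S H w))
    go u w a i with splitAt M i
    ... | inj₁ j = valid (F x) u w a j
    ... | inj₂ j = valid H u w a j

  scale : ∀ {U K} c → ColK U K → ColK U (c * K)
  scale {U} {K} c (colK M refl F dm) with H , e ← mix {I = ℕ} (λ _ → F) (replicate c 0)
    = colK _ (trans (cong (_* (K * 2520)) (length-replicate c)) (sym (*-assoc c K 2520))) H
        λ v Uv → ≤-trans (≤-reflexive (*-assoc c K (dem U v)))
          (≤-trans (*-monoʳ-≤ c (dm v Uv)) (≤-reflexive (sym (trans (e v) (go c (cnt (S F v)))))))
    where
    go : ∀ c m → ΣL {I = ℕ} (λ _ → m) (replicate c 0) ≡ c * m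
    go zero m = refl
    go (suc c) m = cong (m +_) (go c m)

  -- The induction hypothesis gives a different `K` for every `x`, while `mix` needs palettes of one
  -- size; a product of all of them serves every `x`.
  common : (R : V → VSet) → (∀ x → Col (R x)) → ∀ xs → Σ ℕ λ K → 0 < K × (∀ x → x ∈ xs → ColK (R x) K)
  common R f [] = 1 , s≤s z≤n , λ _ ()
  common R f (x ∷ xs) with f x | common R f xs
  ... | suc k , _ , C | suc k′ , _ , h = suc k * suc k′ , s≤s z≤n , λ where
    .x (here refl) → subst (ColK (R x)) (*-comm (suc k′) (suc k)) (scale (suc k′) C)
    y (there m) → scale (suc k) (h y m)

  -- What `v` is sure to have, out of 2520, when `x` is the random vertex.
  valAt : (V → VSet) → V → V → ℕ
  valAt R x v = if does (v ≟ᵥ x) then 2520 else (if R x v then dem (R x) v else 0)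

  cnt-full : ∀ {M} → cnt {M} (λ _ → true) ≡ M
  cnt-full {zero} = refl
  cnt-full {suc M} = cong suc cnt-full

  pick : ∀ {M} (R : V → VSet) → (∀ x w → R x w ≡ true → x ~ w → ⊥) → V → Fam M → Fam M
  pick {M} R hR x F = fam T val
    where
    T : V → PSet M
    T w = if does (w ≟ᵥ x) then (λ _ → true) else (if R x w then S F w else ∅)
    val : ∀ u w → u ~ w → Disj (T u) (T w)
    val u w a with u ≟ᵥ x | w ≟ᵥ x
    ... | yes refl | yes refl = ⊥-elim (~-irr a)
    ... | yes refl | no _ with R x w in eq
    ...   | true = ⊥-elim (hR x w eq a)
    ...   | false = λ _ _ ()
    val u w a | no _ | yes refl with R x u in eq
    ...   | true = ⊥-elim (hR x u eq (~-sym a))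
    ...   | false = λ _ ()
    val u w a | no _ | no _ with R x u | R x w
    ... | true | true = valid F u w a
    ... | true | false = λ _ _ ()
    ... | false | _ = λ _ ()

  record Weak (U : VSet) : Set where
    constructor weak
    field
      K    : ℕ
      K>0  : 0 < K
      F    : Fam (K * 2520)
      dm   : ∀ v → U v ≡ true → K * wdem U v ≤ cnt (S F v)

  -- The random vertex becomes a list in which `x` stands `p x` times, and the colourings of its
  -- entries are put side by side on disjoint palettes. The last hypothesis says that the mean at
  -- `v` reaches its demand.
  average : ∀ U (R : V → VSet) (p : V → ℕ) → (∀ x → Col (R x)) → (∀ x w → R x w ≡ true → x ~ w → ⊥) →
            0 < ΣL p all → (∀ v → U v ≡ true → ΣL p all * wdem U v ≤ ΣL (λ x → p x * valAt R x v) all) → Weak U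
  average U R p f hR pos h with K , K>0 , C ← common R f all
    = weak (ΣL p all * K) (*-mono-< {0} {_} {0} pos K>0) F dm
    where
    open ≤-Reasoning
    F′ : V → Fam (K * 2520)
    F′ x = pick R hR x (subst Fam (ColK.M≡ c) (ColK.F c))
      where c = C x (∈-allFin x)
    H = mix F′ (layers p all)
    len : length (layers p all) * (K * 2520) ≡ ΣL p all * K * 2520
    len = trans (cong (_* (K * 2520)) (trans (length-ΣL (layers p all)) (trans (ΣL-layers p (λ _ → 1) all)
            (ΣL-cong all λ x _ → *-identityʳ (p x))))) (sym (*-assoc (ΣL p all) K 2520))
    F : Fam (ΣL p all * K * 2520)
    F = subst Fam len (proj₁ H)
    cnt-subst : ∀ {M M′} (e : M ≡ M′) (Q : Fam M) v → cnt (S (subst Fam e Q) v) ≡ cnt (S Q v)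
    cnt-subst refl Q v = refl
    one : ∀ x v → K * valAt R x v ≤ cnt (S (F′ x) v)
    one x v with v ≟ᵥ x
    ... | yes _ = ≤-reflexive (sym cnt-full)
    ... | no _ with R x v in eq
    ...   | true = ≤-trans (ColK.dm c v eq) (≤-reflexive (sym (cnt-subst (ColK.M≡ c) (ColK.F c) v)))
      where c = C x (∈-allFin x)
    ...   | false = ≤-trans (≤-reflexive (*-zeroʳ K)) z≤n
    dm : ∀ v → U v ≡ true → ΣL p all * K * wdem U v ≤ cnt (S F v)
    dm v Uv = begin
      ΣL p all * K * wdem U v ≡⟨ *-swapʳ (ΣL p all) K (wdem U v) ⟩
      ΣL p all * wdem U v * K ≤⟨ *-monoˡ-≤ K (h v Uv) ⟩
      ΣL (λ x → p x * valAt R x v) all * K ≡⟨ sym (ΣL-* (λ x → p x * valAt R x v) K all) ⟩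
      ΣL (λ x → p x * valAt R x v * K) all ≤⟨ ΣL-mono all (λ x _ → ≤-trans (≤-reflexive (*-shift (p x) (valAt R x v) K)) (*-monoʳ-≤ (p x) (one x v))) ⟩
      ΣL (λ x → p x * cnt (S (F′ x) v)) all ≡⟨ sym (ΣL-layers p (λ x → cnt (S (F′ x) v)) all) ⟩
      ΣL (λ x → cnt (S (F′ x) v)) (layers p all) ≡⟨ sym (proj₂ H v) ⟩
      cnt (S (proj₁ H) v) ≡⟨ sym (cnt-subst len (proj₁ H) v) ⟩
      cnt (S F v) ∎

  demBy-weak : ∀ d k c s → demBy d true c s ≤ demBy d k c s
  demBy-weak 0 k c s = ≤-refl
  demBy-weak 1 true c s = ≤-refl
  demBy-weak 1 false c s = ≤ᵇ⇒≤ 1260 1475 _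
  demBy-weak 2 k c s = ≤-refl
  demBy-weak (suc (suc (suc d))) k c s = ≤-refl

  wdem≤dem : ∀ U v → wdem U v ≤ dem U v
  wdem≤dem U v = demBy-weak (deg U v) _ _ _

  demBy-1045 : ∀ d c s → 2 ≤ d → demBy d true c s ≤ 1045
  demBy-1045 1 c s (s≤s ())
  demBy-1045 2 true s _ = ≤ᵇ⇒≤ 1008 1045 _
  demBy-1045 2 false true _ = ≤ᵇ⇒≤ 1030 1045 _
  demBy-1045 2 false false _ = ≤-refl
  demBy-1045 (suc (suc (suc d))) c s _ = ≤ᵇ⇒≤ 860 1045 _

  -- All sets are first cut down to exactly `wdem`. The neighbour of a leaf outside K₂ has degree at
  -- least two, hence at most 1045, and the complement of its set has at least 1475. No two leaves
  -- changed in this way are adjacent, since such a pair would be a K₂.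
  boost : ∀ U → Weak U → Col U
  boost U (weak K K>0 F dm) = K , K>0 , colK _ refl (fam S′ val) dm′
    where
    T′ : ∀ v → Σ (PSet (K * 2520)) λ Y → Y ⊑ S F v × (U v ≡ true → cnt Y ≡ K * wdem U v)
    T′ v with U v in eq
    ... | false = ∅ , (λ _ ()) , λ ()
    ... | true with Y , p , q ← sub (S F v) (K * wdem U v) (dm v eq) = Y , p , λ _ → q
    T : V → PSet (K * 2520)
    T v = proj₁ (T′ v)
    S₀ : V → List V → Bool → PSet (K * 2520)
    S₀ v [] _ = λ _ → true
    S₀ v (u ∷ []) false = ∁ (T u)
    S₀ v (u ∷ []) true = T v
    S₀ v (_ ∷ _ ∷ _) _ = T v
    S′ : V → PSet (K * 2520)
    S′ v = if U v then S₀ v (nb U v) (does (k2? U v)) else ∅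
    dT : ∀ u w → u ~ w → Disj (T u) (T w)
    dT u w a = Disj-⊑ {f = S F u} {T u} {S F w} {T w} (proj₁ (proj₂ (T′ u))) (proj₁ (proj₂ (T′ w))) (valid F u w a)
    K2-nb : ∀ {u w} → nb U u ≡ w ∷ [] → nb U w ≡ u ∷ [] → K2at U u
    K2-nb {u} {w} e e′ = subst (Any _) (sym e) (here (subst (All (_≡ u)) (sym e′) (refl All.∷ All.[])))
    val : ∀ u w → u ~ w → Disj (S′ u) (S′ w)
    val u w a with U u in eu | U w in ew
    ... | false | _ = λ _ ()
    ... | true | false = λ _ _ ()
    ... | true | true with nb⁺ {U} {u} {w} ew a | nb⁺ {U} {w} {u} eu (~-sym a)
    ...   | mw | mu with nb U u in e₁ | nb U w in e₂ | mw | mu | k2? U u | k2? U w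
    ...     | w ∷ [] | u ∷ [] | here refl | here refl | yes _ | yes _ = dT u w a
    ...     | w ∷ [] | u ∷ [] | here refl | here refl | no k | _ = ⊥-elim (k (here (subst (All (_≡ u)) (sym e₂) (refl All.∷ All.[]))))
    ...     | w ∷ [] | u ∷ [] | here refl | here refl | yes _ | no k = ⊥-elim (k (here (subst (All (_≡ w)) (sym e₁) (refl All.∷ All.[]))))
    ...     | w ∷ [] | _ ∷ _ ∷ _ | here refl | _ | yes _ | _ = dT u w a
    ...     | w ∷ [] | _ ∷ _ ∷ _ | here refl | _ | no _ | _ = λ i p → not-true p
    ...     | _ ∷ _ ∷ _ | u ∷ [] | _ | here refl | _ | yes _ = dT u w a
    ...     | _ ∷ _ ∷ _ | u ∷ [] | _ | here refl | _ | no _ = λ i p q → not-true q p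
    ...     | _ ∷ _ ∷ _ | _ ∷ _ ∷ _ | _ | _ | _ | _ = dT u w a
    cntT : ∀ v → U v ≡ true → cnt (T v) ≡ K * wdem U v
    cntT v = proj₂ (proj₂ (T′ v))
    deg≡ : ∀ {v l} → nb U v ≡ l → deg U v ≡ length l
    deg≡ = cong length
    dm′ : ∀ v → U v ≡ true → K * dem U v ≤ cnt (S′ v)
    dm′ v Uv rewrite Uv = go (nb U v) refl (k2? U v) refl
      where
      go : ∀ l → nb U v ≡ l → (k : Dec (K2at U v)) → k2? U v ≡ k →
           K * demBy (length l) (does k) (does (c5? U v)) (does (ks? U v)) ≤ cnt (S₀ v l (does k))
      go [] e k _ = ≤-reflexive (sym cnt-full)
      go (u ∷ []) e (yes k) _ = ≤-reflexive (sym (trans (cntT v Uv) (cong (λ l → K * demBy l true (does (c5? U v)) (does (ks? U v))) (deg≡ e))))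
      go (u ∷ []) e (no k) _ = cnt-∁-≥ (T u) (≤-trans (+-monoˡ-≤ (K * 1475)
        (≤-trans (≤-reflexive (cntT u (nb-U m))) (mul-mono K (demBy-1045 (deg U u) _ _ (2≤ (nb U u) refl)))))
        (≤-trans (≤-reflexive (sym (*-distribˡ-+ K 1045 1475))) ≤-refl))
        where
        m : u ∈ nb U v
        m = subst (u ∈_) (sym e) (here refl)
        2≤ : ∀ l → nb U u ≡ l → 2 ≤ length l
        2≤ [] e′ with () ← subst (v ∈_) e′ (nb-sym Uv m)
        2≤ (w ∷ []) e′ with subst (v ∈_) e′ (nb-sym Uv m)
        ... | here refl = ⊥-elim (k (K2-nb e e′))
        2≤ (_ ∷ _ ∷ _) e′ = s≤s (s≤s z≤n)
      go (a ∷ b ∷ l) e k _ = ≤-trans (≤-reflexive (eqd l k)) (≤-reflexive (sym (trans (cntT v Uv) (cong (λ l → K * demBy l true (does (c5? U v)) (does (ks? U v))) (deg≡ e)))))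
        where
        eqd : ∀ (l : List V) (k : Dec (K2at U v)) → K * demBy (2 + length l) (does k) (does (c5? U v)) (does (ks? U v)) ≡ K * demBy (2 + length l) true (does (c5? U v)) (does (ks? U v))
        eqd [] k = refl
        eqd (x ∷ l) k = refl

  -- Deleting vertices and extending a colouring back

  record Start (U′ : VSet) (t : V → ℕ) : Set where
    field
      K    : ℕ
      K>0  : 0 < K
      F    : Fam (K * 2520)
      supp : ∀ w i → S F w i ≡ true → U′ w ≡ true
      size≡ : ∀ w → U′ w ≡ true → cnt (S F w) ≡ K * t w

  start : ∀ U′ t → Col U′ → (∀ w → U′ w ≡ true → t w ≤ dem U′ w) → Start U′ t
  start U′ t (K , K>0 , colK _ refl F dm) h = record
    { K = K ; K>0 = K>0 ; F = fam (λ v → proj₁ (T v)) val ; supp = λ w i p → proj₁ (proj₂ (T w)) i p .proj₂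
    ; size≡ = λ w → proj₂ (proj₂ (T w)) }
    where
    T : ∀ v → Σ (PSet (K * 2520)) λ Y → (∀ i → Y i ≡ true → S F v i ≡ true × U′ v ≡ true) × (U′ v ≡ true → cnt Y ≡ K * t v)
    T v with U′ v in eq
    ... | false = ∅ , (λ _ ()) , λ ()
    ... | true with Y , p , q ← sub (S F v) (K * t v) (≤-trans (mul-mono K (h v eq)) (dm v eq)) = Y , (λ i y → p i y , refl) , λ _ → q
    val : ∀ u w → u ~ w → Disj (proj₁ (T u)) (proj₁ (T w))
    val u w a i p q = valid F u w a i (proj₁ (proj₂ (T u)) i p .proj₁) (proj₁ (proj₂ (T w)) i q .proj₁)

  abstract
    minus : VSet → List V → VSet
    minus U xs w = U w ∧ not (does (w ∈? xs))

    minus⁺ : ∀ {U xs w} → U w ≡ true → w ∉ xs → minus U xs w ≡ true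
    minus⁺ {U} {xs} {w} e h with w ∈? xs
    ... | yes m = ⊥-elim (h m)
    ... | no _ = ∧-intro e refl

    minus⁻ : ∀ {U xs w} → minus U xs w ≡ true → U w ≡ true × w ∉ xs
    minus⁻ {U} {xs} {w} e with w ∈? xs
    ... | yes m with () ← proj₂ (∧-elim {U w} e)
    ... | no h = proj₁ (∧-elim e) , h

  nbm⁺ : ∀ {U xs z w} → w ∈ nb U z → w ∉ xs → w ∈ nb (minus U xs) z
  nbm⁺ {U} {xs} m h = nb⁺ (minus⁺ {U} {xs} (nb-U m) h) (nb-~ m)

  nbm⁻ : ∀ {U xs z w} → w ∈ nb (minus U xs) z → w ∈ nb U z × w ∉ xs
  nbm⁻ {U} {xs} m = nb⁺ (proj₁ (minus⁻ {U} {xs} (nb-U m))) (nb-~ m) , proj₂ (minus⁻ {U} {xs} (nb-U m))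

  private
    filter-≤ : ∀ {P Q : V → Set} (P? : Decidable P) (Q? : Decidable Q) → (∀ x → P x → Q x) → ∀ xs →
               length (filter P? xs) ≤ length (filter Q? xs)
    filter-≤ P? Q? h [] = z≤n
    filter-≤ P? Q? h (x ∷ xs) with P? x | Q? x
    ... | yes p | yes q = s≤s (filter-≤ P? Q? h xs)
    ... | yes p | no q = ⊥-elim (q (h x p))
    ... | no p | yes q = m≤n⇒m≤1+n (filter-≤ P? Q? h xs)
    ... | no p | no q = filter-≤ P? Q? h xs

    filter-< : ∀ {P Q : V → Set} (P? : Decidable P) (Q? : Decidable Q) → (∀ x → P x → Q x) → ∀ xs {y} →
               y ∈ xs → Q y → ¬ P y → length (filter P? xs) < length (filter Q? xs)
    filter-< P? Q? h (x ∷ xs) (here refl) qy py with P? x | Q? x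
    ... | yes p | _ = ⊥-elim (py p)
    ... | no _ | no q = ⊥-elim (q qy)
    ... | no _ | yes _ = s≤s (filter-≤ P? Q? h xs)
    filter-< P? Q? h (x ∷ xs) (there m) qy py with P? x | Q? x
    ... | yes p | yes q = s≤s (filter-< P? Q? h xs m qy py)
    ... | yes p | no q = ⊥-elim (q (h x p))
    ... | no p | yes q = m≤n⇒m≤1+n (filter-< P? Q? h xs m qy py)
    ... | no p | no q = filter-< P? Q? h xs m qy py

  size-< : ∀ {U′ U : VSet} {v} → (∀ x → U′ x ≡ true → U x ≡ true) → U v ≡ true → (U′ v ≡ true → ⊥) → size U′ < size U
  size-< {U′} {U} {v} h a b = filter-< (λ w → U′ w Boolₚ.≟ true) (λ w → U w Boolₚ.≟ true) h all (∈-allFin v) a b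

  size-minus : ∀ {U xs v} → U v ≡ true → v ∈ xs → size (minus U xs) < size U
  size-minus {U} {xs} {v} a m = size-< {minus U xs} {U} {v} (λ x e → proj₁ (minus⁻ {U} {xs} e)) a (λ e → proj₂ (minus⁻ {U} {xs} e) m)

  deg-mono : ∀ {U′ U : VSet} → (∀ x → U′ x ≡ true → U x ≡ true) → ∀ v → deg U′ v ≤ deg U v
  deg-mono {U′} {U} h v rewrite nb-def U′ v | nb-def U v =
    filter-≤ (nb? U′ v) (nb? U v) (λ x e → ∧-intro (h x (proj₁ (∧-elim e))) (proj₂ (∧-elim {U′ x} e))) all

  deg-< : ∀ {U xs z e} → e ∈ nb U z → e ∈ xs → deg (minus U xs) z < deg U z
  deg-< {U} {xs} {z} {e} m k = subst₂ (λ l l′ → length l < length l′) (sym (nb-def (minus U xs) z)) (sym (nb-def U z)) (filter-< (nb? (minus U xs) z) (nb? U z) (λ x h → ∧-intro (proj₁ (minus⁻ {U} {xs} (proj₁ (∧-elim h)))) (proj₂ (∧-elim {minus U xs x} h))) all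
      (∈-allFin e) (∧-intro (nb-U m) (nb-~ m)) (λ h → proj₂ (minus⁻ {U} {xs} (proj₁ (∧-elim h))) k))

  ~≢ : ∀ {u w} → u ~ w → u ≢ w
  ~≢ a refl = ~-irr a

  2≤ : ∀ {l : List V} {a b} → a ∈ l → b ∈ l → a ≢ b → 2 ≤ length l
  2≤ (here refl) (here refl) h = ⊥-elim (h refl)
  2≤ {_ ∷ _ ∷ _} (here _) (there _) h = s≤s (s≤s z≤n)
  2≤ {_ ∷ _ ∷ _} (there _) _ h = s≤s (s≤s z≤n)

  3≤ : ∀ {l : List V} {a b c} → a ∈ l → b ∈ l → c ∈ l → a ≢ b → a ≢ c → b ≢ c → 3 ≤ length l
  3≤ (here refl) (here refl) _ h _ _ = ⊥-elim (h refl)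
  3≤ (here refl) _ (here refl) _ h _ = ⊥-elim (h refl)
  3≤ _ (here refl) (here refl) _ _ h = ⊥-elim (h refl)
  3≤ (here refl) (there q) (there r) _ _ h = s≤s (2≤ q r h)
  3≤ (there p) (here refl) (there r) _ h _ = s≤s (2≤ p r h)
  3≤ (there p) (there q) _ h _ _ = s≤s (2≤ p q h)

  4≤ : ∀ {l : List V} {a b c d} → a ∈ l → b ∈ l → c ∈ l → d ∈ l →
       a ≢ b → a ≢ c → b ≢ c → a ≢ d → b ≢ d → c ≢ d → 4 ≤ length l
  4≤ (here refl) (here refl) _ _ h _ _ _ _ _ = ⊥-elim (h refl)
  4≤ (here refl) _ (here refl) _ _ h _ _ _ _ = ⊥-elim (h refl)
  4≤ (here refl) _ _ (here refl) _ _ _ h _ _ = ⊥-elim (h refl)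
  4≤ _ (here refl) (here refl) _ _ _ h _ _ _ = ⊥-elim (h refl)
  4≤ _ (here refl) _ (here refl) _ _ _ _ h _ = ⊥-elim (h refl)
  4≤ _ _ (here refl) (here refl) _ _ _ _ _ h = ⊥-elim (h refl)
  4≤ (here refl) (there q) (there r) (there s) _ _ h3 _ h5 h6 = s≤s (3≤ q r s h3 h5 h6)
  4≤ (there p) (here refl) (there r) (there s) _ h2 _ h4 _ h6 = s≤s (3≤ p r s h2 h4 h6)
  4≤ (there p) (there q) (here refl) (there s) h1 _ _ h4 h5 _ = s≤s (3≤ p q s h1 h4 h5)
  4≤ (there p) (there q) (there r) _ h1 h2 h3 _ _ _ = s≤s (3≤ p q r h1 h2 h3)

  no4 : ∀ {U v a b c d} → a ∈ nb U v → b ∈ nb U v → c ∈ nb U v → d ∈ nb U v →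
        a ≢ b → a ≢ c → b ≢ c → a ≢ d → b ≢ d → c ≢ d → ⊥
  no4 {U} {v} p q r s h1 h2 h3 h4 h5 h6 = <⇒≱ (4≤ p q r s h1 h2 h3 h4 h5 h6) (deg≤3 U v)

  twoOf : ∀ {l : List V} → Unique l → 2 ≤ length l → ∃ λ a → ∃ λ b → a ∈ l × b ∈ l × a ≢ b
  twoOf {[]} _ ()
  twoOf {_ ∷ []} _ (s≤s ())
  twoOf {a ∷ b ∷ l} ((h ∷ _) ∷ _) _ = a , b , here refl , there (here refl) , h

  thirdOf : ∀ {l : List V} {a b} → Unique l → 3 ≤ length l → ∃ λ c → c ∈ l × c ≢ a × c ≢ b
  thirdOf {[]} _ ()
  thirdOf {x ∷ []} _ (s≤s ())
  thirdOf {x ∷ y ∷ []} _ (s≤s (s≤s ()))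
  thirdOf {x ∷ y ∷ z ∷ l} {a} {b} ((xy ∷ xz ∷ _) ∷ (yz ∷ _) ∷ _) _ with x ≟ᵥ a | x ≟ᵥ b
  ... | no p | no q = x , here refl , p , q
  ... | yes refl | _ with y ≟ᵥ b
  ...   | no q = y , there (here refl) , (λ e → xy (sym e)) , q
  ...   | yes refl = z , there (there (here refl)) , (λ e → xz (sym e)) , (λ e → yz (sym e))
  thirdOf {x ∷ y ∷ z ∷ l} {a} {b} ((xy ∷ xz ∷ _) ∷ (yz ∷ _) ∷ _) _ | no p | yes refl with y ≟ᵥ a
  ...   | no q = y , there (here refl) , q , (λ e → xy (sym e))
  ...   | yes refl = z , there (there (here refl)) , (λ e → yz (sym e)) , (λ e → xz (sym e))

  sub2-deg : ∀ {U v a b} → deg U v ≤ 2 → a ∈ nb U v → b ∈ nb U v → a ≢ b → Sub2 U v a b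
  sub2-deg {a = a} {b} h p q ne w m with w ≟ᵥ a | w ≟ᵥ b
  ... | yes e | _ = inj₁ e
  ... | no _ | yes e = inj₂ e
  ... | no e | no f = ⊥-elim (<⇒≱ (3≤ p q m ne (λ x → e (sym x)) (λ x → f (sym x))) h)

  Sub2-deg : ∀ {U v a b} → Sub2 U v a b → deg U v ≤ 2
  Sub2-deg {U} {v} {a} {b} S with 3 ≤? deg U v
  ... | no h = ≤-pred (≰⇒> h)
  ... | yes h with c , m , p , q ← thirdOf {a = a} {b} (nb-unique U v) h with S c m
  ...   | inj₁ e = ⊥-elim (p e)
  ...   | inj₂ e = ⊥-elim (q e)

  demBy-mono : ∀ {d d′ c c′ s s′} → d′ ≤ d → (c′ ≡ true → c ≡ true) → (s′ ≡ true → s ≡ true) → demBy d true c s ≤ demBy d′ true c′ s′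
  demBy-mono {d} {zero} {c} {c′} {s} {s′} _ _ _ = go d c s
    where
    go : ∀ d c s → demBy d true c s ≤ 2520
    go 0 c s = ≤-refl
    go 1 c s = ≤ᵇ⇒≤ 1260 2520 _
    go (suc (suc d)) c s = ≤-trans (demBy-1045 (suc (suc d)) c s (s≤s (s≤s z≤n))) (≤ᵇ⇒≤ 1045 2520 _)
  demBy-mono {1} {1} _ _ _ = ≤-refl
  demBy-mono {suc (suc d)} {1} {c} {s = s} _ _ _ = ≤-trans (demBy-1045 (suc (suc d)) c s (s≤s (s≤s z≤n))) (≤ᵇ⇒≤ 1045 1260 _)
  demBy-mono {1} {suc (suc _)} (s≤s ()) _ _
  demBy-mono {2} {2} {true} {true} _ _ _ = ≤-refl
  demBy-mono {2} {2} {false} {true} _ hc _ with () ← hc refl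
  demBy-mono {2} {2} {true} {false} {s′ = true} _ _ _ = ≤ᵇ⇒≤ 1008 1030 _
  demBy-mono {2} {2} {true} {false} {s′ = false} _ _ _ = ≤ᵇ⇒≤ 1008 1045 _
  demBy-mono {2} {2} {false} {false} {true} {true} _ _ _ = ≤-refl
  demBy-mono {2} {2} {false} {false} {false} {true} _ _ hs with () ← hs refl
  demBy-mono {2} {2} {false} {false} {true} {false} _ _ _ = ≤ᵇ⇒≤ 1030 1045 _
  demBy-mono {2} {2} {false} {false} {false} {false} _ _ _ = ≤-refl
  demBy-mono {suc (suc (suc d))} {2} {c′ = true} _ _ _ = ≤ᵇ⇒≤ 860 1008 _
  demBy-mono {suc (suc (suc d))} {2} {c′ = false} {s′ = true} _ _ _ = ≤ᵇ⇒≤ 860 1030 _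
  demBy-mono {suc (suc (suc d))} {2} {c′ = false} {s′ = false} _ _ _ = ≤ᵇ⇒≤ 860 1045 _
  demBy-mono {suc (suc (suc d))} {suc (suc (suc _))} _ _ _ = ≤-refl
  demBy-mono {2} {suc (suc (suc _))} (s≤s (s≤s ())) _ _

  does-mono : ∀ {P Q : Set} (p : Dec P) (q : Dec Q) → (P → Q) → does p ≡ true → does q ≡ true
  does-mono (yes p) (yes q) h _ = refl
  does-mono (yes p) (no q) h _ = ⊥-elim (q (h p))
  does-mono (no p) q h ()

  -- A smaller degree never lowers a demand, so only a new C₅ or eight-vertex component could. The
  -- left side is `wdem` because a leaf may also end up in a K₂, where `dem` falls from 1475 to
  -- 1260.
  dem-mono : ∀ {U′ U w} → (∀ x → U′ x ≡ true → U x ≡ true) → (C5at U′ w → C5at U w) → (KSat U′ w → KSat U w) → wdem U w ≤ dem U′ w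
  dem-mono {U′} {U} {w} h hc hk = ≤-trans
    (demBy-mono {deg U w} {deg U′ w} (deg-mono {U′} {U} h w) (does-mono (c5? U′ w) (c5? U w) hc) (does-mono (ks? U′ w) (ks? U w) hk))
    (wdem≤dem U′ w)

  wdem-1045 : ∀ {U w a b} → a ∈ nb U w → b ∈ nb U w → a ≢ b → wdem U w ≤ 1045
  wdem-1045 {U} {w} p q h = demBy-1045 (deg U w) _ _ (2≤ p q h)

  wdem-3 : ∀ {U w} → 3 ≤ deg U w → wdem U w ≡ 860
  wdem-3 {U} {w} h with deg U w
  wdem-3 {U} {w} (s≤s (s≤s (s≤s h))) | suc (suc (suc d)) = refl

  dem-leaf : ∀ {U w} → deg U w ≤ 1 → 1260 ≤ dem U w
  dem-leaf {U} {w} h with deg U w | does (k2? U w)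
  ... | 0 | _ = ≤ᵇ⇒≤ 1260 2520 _
  ... | 1 | true = ≤-refl
  ... | 1 | false = ≤ᵇ⇒≤ 1260 1475 _
  ... | suc (suc _) | _ with s≤s () ← h

  c5-rot : ∀ {U v a b c d} → IsPend U v a b c d → Sub2 U v a b → IsPend U a c v d b × Sub2 U a c v
  c5-rot {U} {v} {a} {b} {c} {d} P S = mkPend (nb-U va) ac (nb-sym Uv va) (λ e → tri (subst (_~ d) e (nb-~ cd)) (~-sym (nb-~ bd)) (nb-~ vb)) cd vb (nb-sym (nb-U vb) bd)
    (λ w m → Sc w m) (λ w m → S w m) (λ w m → swap (Sd w m)) Sb , λ w m → swap (Sa w m)
    where open IsPend P

  CycOf : VSet → V → V → V → V → V → V → Set
  CycOf U z v a b c d = z ≡ v ⊎ z ≡ a ⊎ z ≡ c ⊎ z ≡ d ⊎ z ≡ b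

  c5-all : ∀ {U v a b c d z} → IsPend U v a b c d → Sub2 U v a b → CycOf U z v a b c d → C5at U z
  c5-all P S (inj₁ refl) = _ , _ , _ , _ , P , S
  c5-all P S (inj₂ h) with P₁ , S₁ ← c5-rot P S with h
  ... | inj₁ refl = _ , _ , _ , _ , P₁ , S₁
  ... | inj₂ h with P₂ , S₂ ← c5-rot P₁ S₁ with h
  ...   | inj₁ refl = _ , _ , _ , _ , P₂ , S₂
  ...   | inj₂ h with P₃ , S₃ ← c5-rot P₂ S₂ with h
  ...     | inj₁ refl = _ , _ , _ , _ , P₃ , S₃
  ...     | inj₂ refl with P₄ , S₄ ← c5-rot P₃ S₃ = _ , _ , _ , _ , P₄ , S₄

  module _ {U : VSet} {xs : List V} where
    private U′ = minus U xs

    Untouched : V → Set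
    Untouched z = ∀ e → e ∈ xs → e ∈ nb U z → ⊥

    up : ∀ {z w} → w ∈ nb U′ z → w ∈ nb U z
    up m = proj₁ (nbm⁻ {U} {xs} m)

    upU : ∀ {z} → U′ z ≡ true → U z ≡ true
    upU e = proj₁ (minus⁻ {U} {xs} e)

    back : ∀ {z w} → Untouched z → w ∈ nb U z → w ∈ nb U′ z
    back {z} {w} t m = nbm⁺ m (λ k → t w k m)

    upS2 : ∀ {z a b} → Untouched z → Sub2 U′ z a b → Sub2 U z a b
    upS2 t S w m = S w (back t m)

    upS3 : ∀ {z a b c} → Untouched z → Sub3 U′ z a b c → Sub3 U z a b c
    upS3 t S w m = S w (back t m)

    c5-up : ∀ {v} → C5at U′ v → (∀ z → C5at U′ z → Untouched z) → C5at U v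
    c5-up {v} (a , b , c , d , P , S) h = a , b , c , d
      , mkPend (upU Uv) (up va) (up vb) a≢b (up ac) (up bd) (up cd)
         (upS2 (h a (c5-all P S (inj₂ (inj₁ refl)))) Sa) (upS2 (h b (c5-all P S (inj₂ (inj₂ (inj₂ (inj₂ refl)))))) Sb)
         (upS2 (h c (c5-all P S (inj₂ (inj₂ (inj₁ refl))))) Sc) (upS2 (h d (c5-all P S (inj₂ (inj₂ (inj₂ (inj₁ refl)))))) Sd)
      , upS2 (h v (c5-all P S (inj₁ refl))) S
      where open IsPend P

  keys : ∀ {M} → List (V × PSet M) → List V
  keys = map proj₁

  abstract
    over : ∀ {M} → List (V × PSet M) → (V → PSet M) → V → PSet M
    over [] S w = S w
    over ((x , X) ∷ ls) S w = if does (w ≟ᵥ x) then X else over ls S w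

    over-out : ∀ {M} (ls : List (V × PSet M)) {S w} → w ∉ keys ls → over ls S w ≡ S w
    over-out [] h = refl
    over-out ((x , X) ∷ ls) {S} {w} h with w ≟ᵥ x
    ... | yes e = ⊥-elim (h (here e))
    ... | no _ = over-out ls (λ m → h (there m))

    over-in : ∀ {M} (ls : List (V × PSet M)) {S x X} → Unique (keys ls) → (x , X) ∈ ls → over ls S x ≡ X
    over-in ((x , X) ∷ ls) u (here refl) with x ≟ᵥ x
    ... | yes _ = refl
    ... | no h = ⊥-elim (h refl)
    over-in {M} ((y , Y) ∷ ls) {S} {x} (h ∷ u) (there m) with x ≟ᵥ y
    ... | no _ = over-in ls u m
    ... | yes refl = ⊥-elim (go ls h m)
      where
      go : ∀ {x X} (ls : List (V × PSet M)) → All (x ≢_) (keys ls) → (x , X) ∈ ls → ⊥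
      go (_ ∷ ls) (h ∷ _) (here refl) = h refl
      go (_ ∷ ls) (_ ∷ hs) (there m) = go ls hs m

  in-keys : ∀ {M} {ls : List (V × PSet M)} {x} → x ∈ keys ls → ∃ λ X → (x , X) ∈ ls
  in-keys {ls = (y , Y) ∷ ls} (here refl) = Y , here refl
  in-keys {ls = (y , Y) ∷ ls} (there m) with X , m′ ← in-keys m = X , there m′

  Chk : ∀ {M} → VSet → (V → PSet M) → V × PSet M → Set
  Chk U S′ (x , X) = U x ≡ true × (∀ w → w ∈ nb U x → Disj X (S′ w))

  -- Besides the deleted vertices `xs`, the list `ls` may contain surviving ones, which are
  -- recoloured. Only the edges at listed vertices need a check, as all other vertices keep their
  -- sets.
  finish : ∀ {U xs t} (st : Start (minus U xs) t) (ls : List (V × PSet (Start.K st * 2520))) →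
           Unique (keys ls) → (∀ {x} → x ∈ xs → x ∈ keys ls) →
           All (Chk U (over ls (S (Start.F st)))) ls →
           All (λ (x , X) → Start.K st * wdem U x ≤ cnt X) ls →
           (∀ w → U w ≡ true → w ∉ keys ls → wdem U w ≤ t w) → Weak U
  finish {U} {xs} {t} st ls uq sub chk big small = weak K K>0 (fam T val) dm
    where
    open Start st
    T : V → PSet (K * 2520)
    T = over ls (S F)
    supp′ : ∀ w i → S F w i ≡ true → U w ≡ true
    supp′ w i p = upU {U} {xs} (supp w i p)
    inn : ∀ {x} → x ∈ keys ls → ∀ w → x ~ w → Disj (T x) (T w)
    inn {x} m w a i p q with in-keys m
    ... | X , k with proj₂ (All.lookup chk k) | U w in ew
    ...   | h | true = h w (nb⁺ ew a) i (subst (λ Y → Y i ≡ true) (over-in ls uq k) p) q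
    ...   | h | false with w ∈? keys ls
    ...     | no out with () ← trans (sym ew) (supp′ w i (subst (λ Y → Y i ≡ true) (over-out ls out) q))
    ...     | yes k′ with in-keys k′
    ...       | Y , k″ with () ← trans (sym ew) (proj₁ (All.lookup chk k″))
    val : ∀ u w → u ~ w → Disj (T u) (T w)
    val u w a with u ∈? keys ls | w ∈? keys ls
    ... | yes m | _ = inn m w a
    ... | no _ | yes m = Disj-sym {f = T w} {T u} (inn m u (~-sym a))
    ... | no m | no m′ rewrite over-out ls {S F} m | over-out ls {S F} m′ = valid F u w a
    dm : ∀ v → U v ≡ true → K * wdem U v ≤ cnt (T v)
    dm v Uv with v ∈? keys ls
    ... | no m rewrite over-out ls {S F} m = ≤-trans (mul-mono K (small v Uv m))
            (≤-reflexive (sym (size≡ v (minus⁺ {U} {xs} Uv (λ k → m (sub k))))))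
    ... | yes m with X , k ← in-keys m rewrite over-in ls {S F} uq k = All.lookup big k

  module _ {M} {U : VSet} {ls : List (V × PSet M)} {S : V → PSet M} {X : PSet M} where
    dOut : ∀ {w} → w ∉ keys ls → Disj X (S w) → Disj X (over ls S w)
    dOut m d = subst (Disj X) (sym (over-out ls m)) d

  Rec : VSet → Set
  Rec U = ∀ U′ → size U′ < size U → Col U′

  record Pend≢ (v a b c d : V) : Set where
    field
      v≢a : v ≢ a
      v≢b : v ≢ b
      v≢c : v ≢ c
      v≢d : v ≢ d
      a≢c : a ≢ c
      a≢d : a ≢ d
      b≢c : b ≢ c
      b≢d : b ≢ d
      c≢d : c ≢ d

  pend≢ : ∀ {U v a b c d} → IsPend U v a b c d → Pend≢ v a b c d
  pend≢ P = record
    { v≢a = ~≢ (nb-~ va) ; v≢b = ~≢ (nb-~ vb)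
    ; v≢c = λ { refl → tri (nb-~ cd) (~-sym (nb-~ bd)) (nb-~ vb) }
    ; v≢d = λ { refl → tri (~-sym (nb-~ cd)) (~-sym (nb-~ ac)) (nb-~ va) }
    ; a≢c = ~≢ (nb-~ ac)
    ; a≢d = λ { refl → tri (nb-~ va) (~-sym (nb-~ bd)) (nb-~ vb) }
    ; b≢c = λ { refl → tri (nb-~ va) (nb-~ ac) (nb-~ vb) }
    ; b≢d = ~≢ (nb-~ bd) ; c≢d = ~≢ (nb-~ cd) }
    where open IsPend P

  s≢ : ∀ {a b : V} → a ≢ b → b ≢ a
  s≢ h e = h (sym e)

  NoPend : VSet → Set
  NoPend U = ∀ v a b c d → IsPend U v a b c d → ⊥

  NoB : VSet → Set
  NoB U = ∀ v₀ v₁ v₂ v₃ v₄ v₅ → IsB U v₀ v₁ v₂ v₃ v₄ v₅ → ⊥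

  record B≢ (v₀ v₁ v₂ v₃ v₄ v₅ : V) : Set where
    field
      0≢4 : v₀ ≢ v₄
      0≢5 : v₀ ≢ v₅
      1≢4 : v₁ ≢ v₄
      1≢5 : v₁ ≢ v₅
      2≢3 : v₂ ≢ v₃

  b≢ : ∀ {U v₀ v₁ v₂ v₃ v₄ v₅} → IsB U v₀ v₁ v₂ v₃ v₄ v₅ → B≢ v₀ v₁ v₂ v₃ v₄ v₅
  b≢ {U} {v₀} {v₁} {v₂} {v₃} B = record
    { 0≢4 = λ { refl → z3 (nb-sym (nb-U m₁₃) m₃₄) } ; 0≢5 = λ { refl → z3 (nb-sym (nb-U m₁₃) m₃₅) }
    ; 1≢4 = λ { refl → z2 (nb-sym (nb-U m₀₂) m₂₄) } ; 1≢5 = λ { refl → z2 (nb-sym (nb-U m₀₂) m₂₅) }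
    ; 2≢3 = λ { refl → tri (nb-~ m₀₁) (nb-~ m₁₃) (nb-~ m₀₂) } }
    where
    open IsB B
    z3 : v₃ ∈ nb U v₀ → ⊥
    z3 m = tri (nb-~ m₀₁) (nb-~ m₁₃) (nb-~ m)
    z2 : v₂ ∈ nb U v₁ → ⊥
    z2 m = tri (nb-~ m₀₁) (nb-~ m) (nb-~ m₀₂)

  b-swap : ∀ {U v₀ v₁ v₂ v₃ v₄ v₅} → IsB U v₀ v₁ v₂ v₃ v₄ v₅ → IsB U v₁ v₀ v₃ v₂ v₄ v₅
  b-swap B = mkB (nb-U m₀₁) (nb-sym U₀ m₀₁) m₁₃ 0≢3 m₀₂ 1≢2 m₃₄ m₃₅ 4≢5 m₂₄ m₂₅ S₁ S₀ S₃ S₂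
    where open IsB B

  ks-swap : ∀ {U v₀ v₁ v₂ v₃ v₄ v₅ p q} → IsKS U v₀ v₁ v₂ v₃ v₄ v₅ p q → IsKS U v₁ v₀ v₃ v₂ v₄ v₅ p q
  ks-swap Q = mkKS (b-swap isB) m₄p m₅q mpq p≢3 p≢2 q≢3 q≢2 (λ w m → swap23 (S₄ w m)) (λ w m → swap23 (S₅ w m)) Sp Sq
    where
    open IsKS Q
    swap23 : ∀ {A B C : Set} → A ⊎ B ⊎ C → A ⊎ C ⊎ B
    swap23 = map₂ swap

  -- The symmetry that exchanges the two paths, and with them the two pairs of opposite vertices of
  -- the 4-cycle.
  ks-flip : ∀ {U v₀ v₁ v₂ v₃ v₄ v₅ p q} → IsKS U v₀ v₁ v₂ v₃ v₄ v₅ p q → IsKS U p q v₄ v₅ v₂ v₃ v₀ v₁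
  ks-flip Q = mkKS (mkB (nb-U m₄p) mpq (nb-sym (nb-U m₂₄) m₄p)
      (λ { refl → tri (nb-~ m₂₄) (~-sym (nb-~ m₅q)) (nb-~ m₂₅) }) (nb-sym (nb-U m₂₅) m₅q)
      (λ { refl → tri (nb-~ m₂₄) (nb-~ m₄p) (nb-~ m₂₅) })
      (nb-sym (nb-U m₀₂) m₂₄) (nb-sym (nb-U m₁₃) m₃₄) 2≢3 (nb-sym (nb-U m₀₂) m₂₅) (nb-sym (nb-U m₁₃) m₃₅) Sp Sq S₄ S₅)
    (nb-sym U₀ m₀₂) (nb-sym (nb-U m₀₁) m₁₃) m₀₁ 0≢4 0≢5 1≢4 1≢5 S₂ S₃ S₀ S₁
    where
    open IsKS Q
    open B≢ (b≢ isB)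

  ks-p≢0 : ∀ {U v₀ v₁ v₂ v₃ v₄ v₅ p q} → IsKS U v₀ v₁ v₂ v₃ v₄ v₅ p q → p ≢ v₀ × q ≢ v₀
  ks-p≢0 {U} {v₀} {v₁} {v₂} {v₃} {v₄} {v₅} {p} {q} Q = f , g
    where
    open IsKS Q
    open B≢ (b≢ isB)
    f : p ≢ v₀
    f refl with S₀ q mpq
    ... | inj₂ e = q≢2 e
    ... | inj₁ refl with S₁ v₅ (nb-sym (nb-U m₂₅) m₅q)
    ...   | inj₁ e = 0≢5 (sym e)
    ...   | inj₂ refl = ~-irr (nb-~ m₃₅)
    g : q ≢ v₀
    g refl with S₀ v₅ (nb-sym (nb-U m₂₅) m₅q)
    ... | inj₁ refl = tri (nb-~ m₀₁) (~-sym (nb-~ m₂₅)) (nb-~ m₀₂)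
    ... | inj₂ refl = ~-irr (nb-~ m₂₅)

  module _ {U : VSet} {xs : List V} where
    private
      U′ : VSet
      U′ = minus U xs

    -- `v₂` has three neighbours within the configuration, and a deleted one would be the fourth.
    -- Hence in `ks-up` only the vertices of degree two have to be watched.
    ks-3 : ∀ {v₀ v₁ v₂ v₃ v₄ v₅} → IsB U′ v₀ v₁ v₂ v₃ v₄ v₅ → Untouched {U} {xs} v₂
    ks-3 {v₀} {v₁} {v₂} B e k m = no4 (up {U} {xs} (nb-sym U₀ m₀₂)) (up {U} {xs} m₂₄) (up {U} {xs} m₂₅) m 0≢4 0≢5 4≢5
      (ne (nb-sym U₀ m₀₂)) (ne m₂₄) (ne m₂₅)
      where
      open IsB B
      open B≢ (b≢ B)
      ne : ∀ {w z} → w ∈ nb U′ z → w ≢ e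
      ne m refl = proj₂ (nbm⁻ {U} {xs} m) k

    b-up : ∀ {v₀ v₁ v₂ v₃ v₄ v₅} → IsB U′ v₀ v₁ v₂ v₃ v₄ v₅ → Untouched {U} {xs} v₀ → Untouched {U} {xs} v₁ → IsB U v₀ v₁ v₂ v₃ v₄ v₅
    b-up B t₀ t₁ = mkB (upU {U} {xs} U₀) (up {U} {xs} m₀₁) (up {U} {xs} m₀₂) 1≢2 (up {U} {xs} m₁₃) 0≢3 (up {U} {xs} m₂₄) (up {U} {xs} m₂₅) 4≢5
      (up {U} {xs} m₃₄) (up {U} {xs} m₃₅) (upS2 {U} {xs} t₀ S₀) (upS2 {U} {xs} t₁ S₁) (upS3 {U} {xs} (ks-3 B) S₂) (upS3 {U} {xs} (ks-3 (b-swap B)) S₃)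
      where open IsB B

    ks-up : ∀ {v} → KSat U′ v → (∀ z → KSat U′ z → Untouched {U} {xs} z) → KSat U v
    ks-up {v} (v₁ , v₂ , v₃ , v₄ , v₅ , p , q , Q) h = v₁ , v₂ , v₃ , v₄ , v₅ , p , q
      , mkKS (b-up isB (h v (_ , _ , _ , _ , _ , _ , _ , Q)) (h v₁ (_ , _ , _ , _ , _ , _ , _ , ks-swap Q)))
          (up {U} {xs} m₄p) (up {U} {xs} m₅q) (up {U} {xs} mpq) p≢2 p≢3 q≢2 q≢3
          (upS3 {U} {xs} (ks-3 (IsKS.isB (ks-flip Q))) S₄) (upS3 {U} {xs} (ks-3 (b-swap (IsKS.isB (ks-flip Q)))) S₅)
          (upS2 {U} {xs} (h p (_ , _ , _ , _ , _ , _ , _ , ks-flip Q)) Sp)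
          (upS2 {U} {xs} (h q (_ , _ , _ , _ , _ , _ , _ , ks-swap (ks-flip Q))) Sq)
      where open IsKS Q

    dem-up : (∀ z → C5at U′ z → Untouched {U} {xs} z) → (∀ z → KSat U′ z → Untouched {U} {xs} z) → ∀ w → wdem U w ≤ dem U′ w
    dem-up h k w = dem-mono (λ x e → upU {U} {xs} e) (λ c → c5-up c h) (λ c → ks-up c k)

  kk : ∀ K a b {c} → a + b ≤ c → K * a + K * b ≤ K * c
  kk K a b h = ≤-trans (≤-reflexive (sym (*-distribˡ-+ K a b))) (*-monoʳ-≤ K h)

  -- A C₅ component created next to `ℓ` would be a C₅ attached at one vertex of `U`. In an
  -- eight-vertex component created there, the path that `ℓ` does not touch would form `IsB` with
  -- the 4-cycle. Both are excluded beforehand. The neighbour needs at most 1260, so the complement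
  -- of its set suffices for `ℓ`.
  leaf : ∀ U ℓ → U ℓ ≡ true → deg U ℓ ≤ 1 → NoPend U → NoB U → Rec U → Weak U
  leaf U ℓ Uℓ dℓ noP noB rec = main (start U′ (wdem U) (rec U′ (size-minus {U} {xs} Uℓ (here refl))) (λ w _ → dem-up hc hk w))
    where
    xs : List V
    xs = ℓ ∷ []
    U′ : VSet
    U′ = minus U xs
    only : ∀ {z z′} → ℓ ∈ nb U z → ℓ ∈ nb U z′ → U z ≡ true → U z′ ≡ true → z ≡ z′
    only {z} {z′} m m′ Uz Uz′ with z ≟ᵥ z′
    ... | yes e = e
    ... | no ne = ⊥-elim (<⇒≱ (2≤ (nb-sym Uz m) (nb-sym Uz′ m′) ne) dℓ)
    hc : ∀ z → C5at U′ z → Untouched {U} {xs} z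
    hc z (a , b , c , d , P , S) .ℓ (here refl) m = noP z a b c d
      (mkPend (upU {U} {xs} Uv) (up {U} {xs} va) (up {U} {xs} vb) a≢b (up {U} {xs} ac) (up {U} {xs} bd) (up {U} {xs} cd)
        (upS2 {U} {xs} (un v≢a (nb-U va)) Sa) (upS2 {U} {xs} (un v≢b (nb-U vb)) Sb) (upS2 {U} {xs} (un v≢c (nb-U ac)) Sc) (upS2 {U} {xs} (un v≢d (nb-U bd)) Sd))
      where
      open IsPend P
      open Pend≢ (pend≢ P)
      un : ∀ {y} → z ≢ y → U′ y ≡ true → Untouched {U} {xs} y
      un ne Uy .ℓ (here refl) m′ = ne (only m m′ (upU {U} {xs} Uv) (upU {U} {xs} Uy))
    hk : ∀ z → KSat U′ z → Untouched {U} {xs} z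
    hk z (v₁ , v₂ , v₃ , v₄ , v₅ , p , q , Q) .ℓ (here refl) m = noB _ _ _ _ _ _
      (b-up (IsKS.isB (ks-flip Q)) (un (proj₁ (ks-p≢0 Q)) (nb-U m₄p)) (un (proj₂ (ks-p≢0 Q)) (nb-U m₅q)))
      where
      open IsKS Q
      un : ∀ {y} → y ≢ z → U′ y ≡ true → Untouched {U} {xs} y
      un ne Uy .ℓ (here refl) m′ = ne (only m′ m (upU {U} {xs} Uy) (upU {U} {xs} U₀))
    main : Start U′ (wdem U) → Weak U
    main st = go (nb U ℓ) refl
      where
      open Start st
      fin : (X : PSet (K * 2520)) → (∀ w → w ∈ nb U ℓ → Disj X (S F w)) → K * wdem U ℓ ≤ cnt X → Weak U
      fin X d b = finish {U} {xs} {wdem U} st ((ℓ , X) ∷ []) ([] ∷ []) (λ { (here refl) → here refl })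
        ((Uℓ , λ w m → dOut {U = U} {ls = (ℓ , X) ∷ []} {S F} (λ { (here e) → ~≢ (nb-~ m) (sym e) }) (d w m)) ∷ []) (b ∷ []) (λ w _ _ → ≤-refl)
      wd : ∀ l → nb U ℓ ≡ l → wdem U ℓ ≡ demBy (length l) true (does (c5? U ℓ)) (does (ks? U ℓ))
      wd l e = cong (λ l → demBy (length l) true (does (c5? U ℓ)) (does (ks? U ℓ))) e
      go : ∀ l → nb U ℓ ≡ l → Weak U
      go [] e = fin (λ _ → true) (λ w m → ⊥-elim (noel (subst (w ∈_) e m))) (≤-reflexive (trans (cong (K *_) (wd [] e)) (sym cnt-full)))
        where
        noel : ∀ {w : V} → w ∉ []
        noel ()
      go (u ∷ []) e = fin (∁ (S F u)) dd (≤-trans (≤-reflexive (cong (K *_) (wd (u ∷ []) e)))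
          (cnt-∁-≥ (S F u) (≤-trans (+-monoˡ-≤ (K * 1260) (≤-reflexive (size≡ u Uu)))
            (kk K (wdem U u) 1260 (+-monoˡ-≤ 1260 (≤1260 (nb U u) refl))))))
        where
        um : u ∈ nb U ℓ
        um = subst (u ∈_) (sym e) (here refl)
        Uu : U′ u ≡ true
        Uu = minus⁺ {U} {xs} (nb-U um) (λ { (here e) → ~≢ (nb-~ um) (sym e) })
        dd : ∀ w → w ∈ nb U ℓ → Disj (∁ (S F u)) (S F w)
        dd w m with subst (w ∈_) e m
        ... | here refl = λ i → not-true
        ≤1260 : ∀ l → nb U u ≡ l → wdem U u ≤ 1260
        ≤1260 [] e′ with () ← subst (ℓ ∈_) e′ (nb-sym Uℓ um)
        ≤1260 (_ ∷ []) e′ rewrite e′ = ≤-refl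
        ≤1260 (_ ∷ _ ∷ l) e′ rewrite e′ = ≤-trans (demBy-1045 (2 + length l) _ _ (s≤s (s≤s z≤n))) (≤ᵇ⇒≤ 1045 1260 _)
      go (_ ∷ _ ∷ _) e with s≤s () ← subst (λ l → length l ≤ 1) e dℓ

  wdem-c5 : ∀ {U v} → C5at U v → wdem U v ≤ 1008
  wdem-c5 {U} {v} C@(a , b , c , d , P , S) with c5? U v | deg U v | 2≤ (IsPend.va P) (IsPend.vb P) (IsPend.a≢b P) | Sub2-deg S
  ... | no h | _ | _ | _ = ⊥-elim (h C)
  ... | yes _ | 2 | _ | _ = ≤-refl
  ... | yes _ | 0 | () | _
  ... | yes _ | 1 | s≤s () | _
  ... | yes _ | suc (suc (suc _)) | _ | s≤s (s≤s ())

  dIn′ : ∀ {M} (ls : List (V × PSet M)) {S : V → PSet M} {X : PSet M} → Unique (keys ls) → ∀ {w w′ Y} → w′ ≡ w → (w , Y) ∈ ls → Disj X Y → Disj X (over ls S w′)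
  dIn′ ls {S} {X} uq refl m d = subst (Disj X) (sym (over-in ls uq m)) d

  dOut′ : ∀ {M} (ls : List (V × PSet M)) {S : V → PSet M} {X : PSet M} → ∀ {w w′} → w′ ≡ w → w ∉ keys ls → Disj X (S w) → Disj X (over ls S w′)
  dOut′ ls {S} {X} refl m d = subst (Disj X) (sym (over-out ls m)) d

  -- Reducible configurations

  -- With the other four vertices gone, `v` has degree at most one and is owed at least 1260. Its
  -- set is cut down to `α`, and `pent` completes the 5-cycle.
  module T1 (U : VSet) (v a b c d : V) (P : IsPend U v a b c d) (rec : Rec U) where
    open IsPend P
    open Pend≢ (pend≢ P)
    private
      xs : List V
      xs = a ∷ b ∷ c ∷ d ∷ []
      U′ : VSet
      U′ = minus U xs
      v∉ : v ∉ xs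
      v∉ (here e) = v≢a e
      v∉ (there (here e)) = v≢b e
      v∉ (there (there (here e))) = v≢c e
      v∉ (there (there (there (here e)))) = v≢d e
      touched : ∀ {z e} → U′ z ≡ true → e ∈ xs → e ∈ nb U z → z ≡ v
      touched {z} Uz m k with minus⁻ {U} {xs} Uz
      touched {z} Uz (here refl) k | Uz′ , h with Sa z (nb-sym Uz′ k)
      ... | inj₁ e = e
      ... | inj₂ e = ⊥-elim (h (there (there (here e))))
      touched {z} Uz (there (here refl)) k | Uz′ , h with Sb z (nb-sym Uz′ k)
      ... | inj₁ e = e
      ... | inj₂ e = ⊥-elim (h (there (there (there (here e)))))
      touched {z} Uz (there (there (here refl))) k | Uz′ , h with Sc z (nb-sym Uz′ k)
      ... | inj₁ e = ⊥-elim (h (here e))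
      ... | inj₂ e = ⊥-elim (h (there (there (there (here e)))))
      touched {z} Uz (there (there (there (here refl)))) k | Uz′ , h with Sd z (nb-sym Uz′ k)
      ... | inj₁ e = ⊥-elim (h (there (here e)))
      ... | inj₂ e = ⊥-elim (h (there (there (here e))))
      two : ∀ {x y} → x ∈ nb U′ v → y ∈ nb U′ v → x ≢ y → ⊥
      two m k ne with nbm⁻ {U} {xs} m | nbm⁻ {U} {xs} k
      ... | m′ , h | k′ , h′ = no4 va vb m′ k′ a≢b (λ e → h (here (sym e))) (λ e → h (there (here (sym e))))
                                 (λ e → h′ (here (sym e))) (λ e → h′ (there (here (sym e)))) ne
      hc : ∀ z → C5at U′ z → Untouched {U} {xs} z
      hc z (_ , _ , _ , _ , Q , _) e m k with touched (IsPend.Uv Q) m k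
      ... | refl = two (IsPend.va Q) (IsPend.vb Q) (IsPend.a≢b Q)
      hk : ∀ z → KSat U′ z → Untouched {U} {xs} z
      hk z (_ , _ , _ , _ , _ , _ , _ , Q) e m k with touched (IsKS.U₀ Q) m k
      ... | refl = two (IsKS.m₀₁ Q) (IsKS.m₀₂ Q) (IsKS.1≢2 Q)
      deg1 : deg U′ v ≤ 1
      deg1 with 2 ≤? deg U′ v
      ... | no h = ≤-pred (≰⇒> h)
      ... | yes h with _ , _ , m , k , ne ← twoOf (nb-unique U′ v) h = ⊥-elim (two m k ne)

    body : ∀ α s → α ≤ 1260 → α + s ≤ 2520 → 2520 ≤ α + (s + s) → 4 * s + α ≤ 5040 → wdem U v ≤ α →
           wdem U a ≤ s → wdem U b ≤ s → wdem U c ≤ s → wdem U d ≤ s → Weak U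
    body α s h₁ h₂ h₃ h₄ hv ha hb hc′ hd = main (start U′ t (rec U′ (size-minus {U} {xs} (nb-U va) (here refl))) t≤)
      where
      t : V → ℕ
      t w = if does (w ≟ᵥ v) then α else wdem U w
      t≤ : ∀ w → U′ w ≡ true → t w ≤ dem U′ w
      t≤ w _ with w ≟ᵥ v
      ... | yes refl = ≤-trans h₁ (dem-leaf deg1)
      ... | no _ = dem-up hc hk w
      wt : ∀ w → wdem U w ≤ t w
      wt w with w ≟ᵥ v
      ... | yes refl = hv
      ... | no _ = ≤-refl
      tv : t v ≡ α
      tv with v ≟ᵥ v
      ... | yes _ = refl
      ... | no h = ⊥-elim (h refl)
      main : Start U′ t → Weak U
      main st = fin (pent A (K * s)
          (≤-trans (+-monoˡ-≤ _ (≤-reflexive cA)) (kk K α s h₂))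
          (≤-trans (*-monoʳ-≤ K h₃) (≤-reflexive (trans (*-distribˡ-+ K α (s + s)) (cong₂ _+_ (sym cA) (*-distribˡ-+ K s s)))))
          (≤-trans (+-monoʳ-≤ _ (≤-reflexive cA)) (pent-ar K s α h₄)))
        where
        open Start st
        A : PSet (K * 2520)
        A = S F v
        cA : cnt A ≡ K * α
        cA = trans (size≡ v (minus⁺ {U} {xs} Uv v∉)) (cong (K *_) tv)
        fin : Pent A (K * s) → Weak U
        fin pt = finish {U} {xs} {t} st ls uq sb chk big (λ w _ _ → wt w)
          where
          open Pent pt
          ls : List (V × PSet (K * 2520))
          ls = (a , c₁) ∷ (b , c₄) ∷ (c , c₂) ∷ (d , c₃) ∷ []
          uq : Unique (keys ls)
          uq = (a≢b ∷ a≢c ∷ a≢d ∷ []) ∷ (b≢c ∷ b≢d ∷ []) ∷ (c≢d ∷ []) ∷ [] ∷ []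
          sb : ∀ {x} → x ∈ xs → x ∈ keys ls
          sb m = m
          chk : All (Chk U (over ls (S F))) ls
          chk = (nb-U va , λ w m → [ (λ e → dOut′ ls e v∉ (Disj-sym {f = A} dA₁)) , (λ e → dIn′ ls uq e (there (there (here refl))) d₁₂) ]′ (Sa w m))
              ∷ (nb-U vb , λ w m → [ (λ e → dOut′ ls e v∉ (Disj-sym {f = A} dA₄)) , (λ e → dIn′ ls uq e (there (there (there (here refl)))) (Disj-sym {f = c₃} d₃₄)) ]′ (Sb w m))
              ∷ (nb-U ac , λ w m → [ (λ e → dIn′ ls uq e (here refl) (Disj-sym {f = c₁} d₁₂)) , (λ e → dIn′ ls uq e (there (there (there (here refl)))) d₂₃) ]′ (Sc w m))
              ∷ (nb-U bd , λ w m → [ (λ e → dIn′ ls uq e (there (here refl)) d₃₄) , (λ e → dIn′ ls uq e (there (there (here refl))) (Disj-sym {f = c₂} d₂₃)) ]′ (Sd w m))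
              ∷ []
          big : All (λ (x , X) → K * wdem U x ≤ cnt X) ls
          big = ≤-trans (mul-mono K ha) n₁ ∷ ≤-trans (mul-mono K hb) n₄ ∷ ≤-trans (mul-mono K hc′) n₂ ∷ ≤-trans (mul-mono K hd) n₃ ∷ []

    t1 : Weak U
    -- If `v` has degree two, the component is C₅ and all demands are at most 1008; otherwise they
    -- are 860 at `v` and at most 1045 at the others. Both cases are tight for `pent`: 4 · 1008 +
    -- 1008 = 4 · 1045 + 860 = 5040.
    t1 with 3 ≤? deg U v
    ... | no h = body 1008 1008 (≤ᵇ⇒≤ 1008 1260 _) (≤ᵇ⇒≤ 2016 2520 _) (≤ᵇ⇒≤ 2520 3024 _) (≤ᵇ⇒≤ 5040 5040 _)
        (g (inj₁ refl)) (g (inj₂ (inj₁ refl))) (g (inj₂ (inj₂ (inj₂ (inj₂ refl))))) (g (inj₂ (inj₂ (inj₁ refl)))) (g (inj₂ (inj₂ (inj₂ (inj₁ refl)))))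
      where
      g : ∀ {z} → CycOf U z v a b c d → wdem U z ≤ 1008
      g h′ = wdem-c5 (c5-all P (sub2-deg (≤-pred (≰⇒> h)) va vb a≢b) h′)
    ... | yes h = body 860 1045 (≤ᵇ⇒≤ 860 1260 _) (≤ᵇ⇒≤ 1905 2520 _) (≤ᵇ⇒≤ 2520 2950 _) (≤ᵇ⇒≤ 5040 5040 _)
        (≤-reflexive (wdem-3 h)) (wdem-1045 (nb-sym Uv va) ac v≢c) (wdem-1045 (nb-sym Uv vb) bd v≢d)
        (wdem-1045 (nb-sym (nb-U va) ac) cd a≢d) (wdem-1045 (nb-sym (nb-U vb) bd) (nb-sym (nb-U ac) cd) b≢c)

  -- Neighbourhoods are filtered from one enumeration of the vertices, so the same neighbours give
  -- the same list; see `nb-ext`.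
  record IsTwin (U : VSet) (w w′ : V) : Set where
    constructor mkTwin
    field
      Uw  : U w ≡ true
      Uw′ : U w′ ≡ true
      w≢  : w ≢ w′
      d3  : 3 ≤ deg U w
      eq  : nb U w ≡ nb U w′

  -- `w′` is deleted and later receives the set of `w`. A neighbour of `w′` is adjacent to `w`,
  -- which keeps degree three, so it is not in a new C₅. In a new eight-vertex component, `w` would
  -- be the `v₂`, and its neighbour `v₄` would have `w′` as a fourth neighbour.
  twin : ∀ U w w′ → IsTwin U w w′ → Rec U → Weak U
  twin U w w′ T rec = main (start U′ (wdem U) (rec U′ (size-minus {U} {xs} Uw′ (here refl))) (λ x _ → dem-up hc hk x))
    where
    open IsTwin T
    xs : List V
    xs = w′ ∷ []
    U′ : VSet
    U′ = minus U xs
    w∈U′ : U′ w ≡ true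
    w∈U′ = minus⁺ {U} {xs} Uw (λ { (here e) → w≢ e })
    w′∉ : w′ ∉ nb U w
    w′∉ m = ~-irr (nb-~ (subst (w′ ∈_) eq m))
    keep : ∀ {x} → x ∈ nb U w → x ∈ nb U′ w
    keep m = nbm⁺ m (λ { (here refl) → w′∉ m })
    no2 : ∀ {x y} → Sub2 U′ w x y → ⊥
    no2 S = <⇒≱ d3 (Sub2-deg {U} {w} (λ z m → S z (keep m)))
    nbw : ∀ {z} → U′ z ≡ true → w′ ∈ nb U z → w ∈ nb U′ z
    nbw Uz m = nb-sym w∈U′ (keep (subst (_ ∈_) (sym eq) (nb-sym (upU {U} {xs} Uz) m)))
    hc : ∀ z → C5at U′ z → Untouched {U} {xs} z
    hc z (a , b , c , d , P , S) .w′ (here refl) m with S w (nbw (IsPend.Uv P) m)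
    ... | inj₁ refl = no2 (IsPend.Sa P)
    ... | inj₂ refl = no2 (IsPend.Sb P)
    hk : ∀ z → KSat U′ z → Untouched {U} {xs} z
    hk z (v₁ , v₂ , v₃ , v₄ , v₅ , p , q , Q) .w′ (here refl) m with IsKS.S₀ Q w (nbw (IsKS.U₀ Q) m)
    ... | inj₁ refl = no2 (IsKS.S₁ Q)
    ... | inj₂ refl = ks-3 (IsKS.isB (ks-flip Q)) w′ (here refl)
                        (nb-sym Uw′ (subst (v₄ ∈_) eq (up {U} {xs} (IsKS.m₂₄ Q))))
    main : Start U′ (wdem U) → Weak U
    main st = finish {U} {xs} {wdem U} st ls ([] ∷ []) (λ m → m)
        ((Uw′ , λ x m → dOut′ ls {S F} {S F w} {x} refl (λ { (here refl) → ~-irr (nb-~ m) }) (valid F w x (nb-~ (subst (x ∈_) (sym eq) m)))) ∷ [])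
        (≤-trans (mul-mono K (≤-reflexive (trans (wdem-3 (subst (λ l → 3 ≤ length l) eq d3)) (sym (wdem-3 d3))))) (≤-reflexive (sym (size≡ w w∈U′))) ∷ [])
        (λ _ _ _ → ≤-refl)
      where
      open Start st
      ls : List (V × PSet (K * 2520))
      ls = (w′ , S F w) ∷ []

  -- The 5-cycle a v₁ v₂ v₃ b in which v₁, v₂, v₃ have degree two.
  record IsT2 (U : VSet) (a b v₁ v₂ v₃ : V) : Set where
    constructor mkT2
    field
      Ua  : U a ≡ true
      ab  : b ∈ nb U a
      a1  : v₁ ∈ nb U a
      b3  : v₃ ∈ nb U b
      m12 : v₂ ∈ nb U v₁
      m23 : v₃ ∈ nb U v₂
      S1  : Sub2 U v₁ a v₂
      S2  : Sub2 U v₂ v₁ v₃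
      S3  : Sub2 U v₃ v₂ b

  t2-mirror : ∀ {U a b v₁ v₂ v₃} → IsT2 U a b v₁ v₂ v₃ → IsT2 U b a v₃ v₂ v₁
  t2-mirror T = mkT2 (nb-U ab) (nb-sym Ua ab) b3 a1 (nb-sym (nb-U m12) m23) (nb-sym (nb-U a1) m12)
      (λ w m → swap (S3 w m)) (λ w m → swap (S2 w m)) (λ w m → swap (S1 w m))
    where open IsT2 T

  record Cyc≢ (a b v₁ v₂ v₃ : V) : Set where
    field
      a≢1 : a ≢ v₁
      a≢2 : a ≢ v₂
      a≢3 : a ≢ v₃
      b≢1 : b ≢ v₁
      b≢2 : b ≢ v₂
      b≢3 : b ≢ v₃
      1≢2 : v₁ ≢ v₂
      1≢3 : v₁ ≢ v₃
      2≢3 : v₂ ≢ v₃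

  cyc≢ : ∀ {a b v₁ v₂ v₃} → a ~ b → a ~ v₁ → v₁ ~ v₂ → v₂ ~ v₃ → v₃ ~ b → Cyc≢ a b v₁ v₂ v₃
  cyc≢ e₀ e₁ e₂ e₃ e₄ = record
    { a≢1 = ~≢ e₁ ; a≢2 = λ { refl → tri e₃ e₄ e₀ } ; a≢3 = λ { refl → tri e₁ e₂ (~-sym e₃) }
    ; b≢1 = λ { refl → tri e₂ e₃ (~-sym e₄) } ; b≢2 = λ { refl → tri e₁ e₂ e₀ } ; b≢3 = λ e → ~≢ e₄ (sym e)
    ; 1≢2 = ~≢ e₂ ; 1≢3 = λ { refl → tri e₁ e₄ e₀ } ; 2≢3 = ~≢ e₃ }

  pend-mirror : ∀ {U v a b c d} → IsPend U v a b c d → IsPend U v b a d c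
  pend-mirror P = mkPend Uv vb va (s≢ a≢b) bd ac (nb-sym (nb-U ac) cd) Sb Sa (λ w m → Sd w m) (λ w m → Sc w m)
    where open IsPend P

  runChk : ∀ {M U a b v₁ v₂ v₃ s} (T : IsT2 U a b v₁ v₂ v₃) (S : V → PSet M) (R : Run (S a) (S b) s) (ls : List (V × PSet M)) → Unique (keys ls) →
           a ∉ keys ls → b ∉ keys ls → (v₁ , Run.c₁ R) ∈ ls → (v₂ , Run.c₂ R) ∈ ls → (v₃ , Run.c₃ R) ∈ ls →
           Chk U (over ls S) (v₁ , Run.c₁ R) × Chk U (over ls S) (v₂ , Run.c₂ R) × Chk U (over ls S) (v₃ , Run.c₃ R)
  runChk {a = a} {b} T S R ls uq a∉ b∉ i₁ i₂ i₃ =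
      (nb-U a1 , λ w m → [ (λ e → dOut′ ls e a∉ (Disj-sym {f = S a} dA)) , (λ e → dIn′ ls uq e i₂ d₁₂) ]′ (S1 w m))
    , (nb-U m12 , λ w m → [ (λ e → dIn′ ls uq e i₁ (Disj-sym {f = c₁} d₁₂)) , (λ e → dIn′ ls uq e i₃ d₂₃) ]′ (S2 w m))
    , (nb-U b3 , λ w m → [ (λ e → dIn′ ls uq e i₂ (Disj-sym {f = c₂} d₂₃)) , (λ e → dOut′ ls e b∉ (Disj-sym {f = S b} dB)) ]′ (S3 w m))
    where
    open IsT2 T
    open Run R

  -- Two sets of size 860 leave at least 2520 - 2 · 860 = 800 colours free of both, and 3 · 1045 ≤
  -- 2520 + 800.
  runOf : ∀ K (A B : PSet (K * 2520)) → cnt A ≡ K * 860 → cnt B ≡ K * 860 → Run A B (K * 1045)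
  runOf K A B eA eB = run A B (K * 800) (K * 1045)
    (≤-trans (+-monoˡ-≤ _ (≤-reflexive eA)) (kk K 860 1045 (≤ᵇ⇒≤ 1905 2520 _)))
    (≤-trans (+-monoˡ-≤ _ (≤-reflexive eB)) (kk K 860 1045 (≤ᵇ⇒≤ 1905 2520 _)))
    (≤-trans (+-monoˡ-≤ _ (≤-trans (+-mono-≤ (≤-reflexive eA) (≤-reflexive eB)) (kk K 860 860 (≤-refl {1720})))) (kk K 1720 800 (≤-refl {2520})))
    (*-monoʳ-≤ K (≤ᵇ⇒≤ 800 1045 _)) (run-ar K)

  -- If `a` had degree two, the 5-cycle would be attached at `b` alone, as in `IsPend`.
  t2-deg3 : ∀ {U a b v₁ v₂ v₃} → NoPend U → IsT2 U a b v₁ v₂ v₃ → 3 ≤ deg U a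
  t2-deg3 {U} {a} {b} {v₁} {v₂} {v₃} noP T with 3 ≤? deg U a
  ... | yes h = h
  ... | no h = ⊥-elim (noP b v₃ a v₂ v₁ (mkPend (nb-U ab) b3 (nb-sym Ua ab) (λ { refl → tri (nb-~ a1) (nb-~ m12) (~-sym (nb-~ m23)) })
      (nb-sym (nb-U m12) m23) a1 (nb-sym (nb-U a1) m12) (λ w m → swap (S3 w m))
      (sub2-deg {U} {a} (≤-pred (≰⇒> h)) ab a1 (λ { refl → tri (nb-~ m12) (nb-~ m23) (nb-~ b3) }))
      (λ w m → swap (S2 w m)) S1))
    where open IsT2 T

  -- `a` and `b` have degree three, hence sets of size exactly 860, and `run` fills in the path. The
  -- one real obstruction is a C₅ component through `a` and `b` after the deletion, where the other
  -- vertices are owed less than before; `theta` deals with it.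
  module T2 (U : VSet) (a b v₁ v₂ v₃ : V) (T : IsT2 U a b v₁ v₂ v₃) (noP : NoPend U) (noB : NoB U) (rec : Rec U) where
    open IsT2 T
    open Cyc≢ (cyc≢ (nb-~ ab) (nb-~ a1) (nb-~ m12) (nb-~ m23) (~-sym (nb-~ b3)))
    private
      xs : List V
      xs = v₁ ∷ v₂ ∷ v₃ ∷ []
      U′ : VSet
      U′ = minus U xs
      Ub : U b ≡ true
      Ub = nb-U ab
      a∉ : a ∉ xs
      a∉ (here e) = a≢1 e
      a∉ (there (here e)) = a≢2 e
      a∉ (there (there (here e))) = a≢3 e
      b∉ : b ∉ xs
      b∉ (here e) = b≢1 e
      b∉ (there (here e)) = b≢2 e
      b∉ (there (there (here e))) = b≢3 e
      ba : a ∈ nb U b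
      ba = nb-sym Ua ab

      wa : wdem U a ≡ 860
      wa = wdem-3 (t2-deg3 noP T)
      wb : wdem U b ≡ 860
      wb = wdem-3 (t2-deg3 noP (t2-mirror T))

      touched : ∀ {z e} → U z ≡ true → z ∉ xs → e ∈ xs → e ∈ nb U z → z ≡ a ⊎ z ≡ b
      touched Uz h (here refl) k with S1 _ (nb-sym Uz k)
      ... | inj₁ e = inj₁ e
      ... | inj₂ e = ⊥-elim (h (there (here e)))
      touched Uz h (there (here refl)) k with S2 _ (nb-sym Uz k)
      ... | inj₁ e = ⊥-elim (h (here e))
      ... | inj₂ e = ⊥-elim (h (there (there (here e))))
      touched Uz h (there (there (here refl))) k with S3 _ (nb-sym Uz k)
      ... | inj₁ e = ⊥-elim (h (there (here e)))
      ... | inj₂ e = inj₂ e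

      -- If `z` has degree two in an eight-vertex component, the component contains its neighbour
      -- `z′`. If `z′` has degree three there, the deleted vertex would be its fourth neighbour.
      -- Otherwise `z` and `z′` form one of the two paths, and the other path gives `IsB` in `U`.
      hkz : ∀ {z z′} → (∀ y → y ≡ a ⊎ y ≡ b → y ≡ z ⊎ y ≡ z′) → z′ ∈ nb U′ z → (∃ λ e → e ∈ xs × e ∈ nb U z′) → KSat U′ z → ⊥
      hkz {z} {z′} h zz′ (e , m , k) (v₁ , v₂ , v₃ , v₄ , v₅ , p , q , Q) with IsKS.S₀ Q z′ zz′
      ... | inj₂ refl = ks-3 (IsKS.isB Q) e m k
      ... | inj₁ refl = noB _ _ _ _ _ _ (b-up (IsKS.isB (ks-flip Q))
          (un (nb-U (IsKS.m₄p Q)) (proj₁ (ks-p≢0 Q)) (proj₁ (ks-p≢0 (ks-swap Q))))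
          (un (nb-U (IsKS.m₅q Q)) (proj₂ (ks-p≢0 Q)) (proj₂ (ks-p≢0 (ks-swap Q)))))
        where
        un : ∀ {y} → U′ y ≡ true → y ≢ z → y ≢ z′ → Untouched {U} {xs} y
        un Uy n₁ n₂ e m k with minus⁻ {U} {xs} Uy
        ... | Uy′ , h′ with h _ (touched Uy′ h′ m k)
        ...   | inj₁ e₁ = n₁ e₁
        ...   | inj₂ e₂ = n₂ e₂

      hk : ∀ z → KSat U′ z → Untouched {U} {xs} z
      hk z Q@(_ , _ , _ , _ , _ , _ , _ , Q′) e m k with minus⁻ {U} {xs} (IsKS.U₀ Q′)
      ... | Uz , h with touched Uz h m k
      ...   | inj₁ refl = hkz (λ _ e → e) (nbm⁺ ab b∉) (v₃ , there (there (here refl)) , b3) Q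
      ...   | inj₂ refl = hkz (λ _ e → swap e) (nbm⁺ ba a∉) (v₁ , here refl , a1) Q

    simple : ¬ C5at U′ a → Weak U
    simple nc = main (start U′ (wdem U) (rec U′ (size-minus {U} {xs} (nb-U a1) (here refl))) (λ x _ → dem-up hc hk x))
      where
      hc : ∀ z → C5at U′ z → Untouched {U} {xs} z
      hc z C@(_ , _ , _ , _ , P , S) e m k with minus⁻ {U} {xs} (IsPend.Uv P)
      ... | Uz , h with touched Uz h m k
      ...   | inj₁ refl = nc C
      ...   | inj₂ refl with S a (nbm⁺ ba a∉)
      ...     | inj₁ refl = nc (c5-all P S (inj₂ (inj₁ refl)))
      ...     | inj₂ refl = nc (c5-all P S (inj₂ (inj₂ (inj₂ (inj₂ refl)))))
      main : Start U′ (wdem U) → Weak U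
      main st = fin (runOf K (S F a) (S F b) (trans (size≡ a (minus⁺ {U} {xs} Ua a∉)) (cong (K *_) wa)) (trans (size≡ b (minus⁺ {U} {xs} Ub b∉)) (cong (K *_) wb)))
        where
        open Start st
        fin : Run (S F a) (S F b) (K * 1045) → Weak U
        fin R with C₁ , C₂ , C₃ ← runChk T (S F) R ((v₁ , Run.c₁ R) ∷ (v₂ , Run.c₂ R) ∷ (v₃ , Run.c₃ R) ∷ []) ((1≢2 ∷ 1≢3 ∷ []) ∷ (2≢3 ∷ []) ∷ [] ∷ [])
                                    a∉ b∉ (here refl) (there (here refl)) (there (there (here refl)))
          = finish {U} {xs} {wdem U} st ((v₁ , Run.c₁ R) ∷ (v₂ , Run.c₂ R) ∷ (v₃ , Run.c₃ R) ∷ []) ((1≢2 ∷ 1≢3 ∷ []) ∷ (2≢3 ∷ []) ∷ [] ∷ [])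
              (λ m → m) (C₁ ∷ C₂ ∷ C₃ ∷ [])
              (≤-trans (mul-mono K (wdem-1045 (nb-sym Ua a1) m12 a≢2)) n₁ ∷ ≤-trans (mul-mono K (wdem-1045 (nb-sym (nb-U a1) m12) m23 1≢3)) n₂
               ∷ ≤-trans (mul-mono K (wdem-1045 (nb-sym Ub b3) (nb-sym (nb-U m12) m23) b≢2)) n₃ ∷ [])
              (λ _ _ _ → ≤-refl)
          where open Run R

    -- Here `a` and `b` are joined by an edge and by two paths with three inner vertices of degree
    -- two. Both paths are deleted; no edge joins them, so the same three sets serve both.
    theta : ∀ {w₁ w₂ w₃} → IsPend U′ a w₁ b w₂ w₃ → Weak U
    theta {w₁} {w₂} {w₃} P = main (start U₂ (wdem U) (rec U₂ (size-minus {U} {ys} (nb-U a1) (here refl))) (λ x _ → dem-up hc hk₂ x))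
      where
      open IsPend P using (Sa; Sc; Sd; va; vb; ac; bd; cd) renaming (a≢b to w₁≢b)
      module W = Pend≢ (pend≢ P)
      ys : List V
      ys = v₁ ∷ v₂ ∷ v₃ ∷ w₁ ∷ w₂ ∷ w₃ ∷ []
      U₂ : VSet
      U₂ = minus U ys
      un : ∀ {y} → U′ y ≡ true → y ≢ a → y ≢ b → Untouched {U} {xs} y
      un Uy n₁ n₂ e m k with minus⁻ {U} {xs} Uy
      ... | Uy′ , h with touched Uy′ h m k
      ...   | inj₁ e₁ = n₁ e₁
      ...   | inj₂ e₂ = n₂ e₂
      T′ : IsT2 U a b w₁ w₂ w₃
      T′ = mkT2 Ua ab (up {U} {xs} va) (up {U} {xs} bd) (up {U} {xs} ac) (up {U} {xs} cd)
        (upS2 {U} {xs} (un (nb-U va) (s≢ W.v≢a) w₁≢b) Sa)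
        (upS2 {U} {xs} (un (nb-U ac) (s≢ W.v≢c) (s≢ W.b≢c)) Sc)
        (λ w m → swap (upS2 {U} {xs} (un (nb-U cd) (s≢ W.v≢d) (s≢ W.b≢d)) Sd w m))
      out : ∀ {y} → U′ y ≡ true → y ∉ xs
      out Uy = proj₂ (minus⁻ {U} {xs} Uy)
      ne1 : ∀ {y} → U′ y ≡ true → v₁ ≢ y
      ne1 Uy e = out Uy (here (sym e))
      ne2 : ∀ {y} → U′ y ≡ true → v₂ ≢ y
      ne2 Uy e = out Uy (there (here (sym e)))
      ne3 : ∀ {y} → U′ y ≡ true → v₃ ≢ y
      ne3 Uy e = out Uy (there (there (here (sym e))))
      touched₂ : ∀ {z e} → U z ≡ true → z ∉ ys → e ∈ ys → e ∈ nb U z → z ≡ a ⊎ z ≡ b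
      touched₂ Uz h (here refl) k = touched Uz (λ { (here e) → h (here e) ; (there (here e)) → h (there (here e)) ; (there (there (here e))) → h (there (there (here e))) }) (here refl) k
      touched₂ Uz h (there (here refl)) k = touched Uz (λ { (here e) → h (here e) ; (there (here e)) → h (there (here e)) ; (there (there (here e))) → h (there (there (here e))) }) (there (here refl)) k
      touched₂ Uz h (there (there (here refl))) k = touched Uz (λ { (here e) → h (here e) ; (there (here e)) → h (there (here e)) ; (there (there (here e))) → h (there (there (here e))) }) (there (there (here refl))) k
      touched₂ Uz h (there (there (there (here refl)))) k with IsT2.S1 T′ _ (nb-sym Uz k)
      ... | inj₁ e = inj₁ e
      ... | inj₂ e = ⊥-elim (h (there (there (there (there (here e))))))
      touched₂ Uz h (there (there (there (there (here refl))))) k with IsT2.S2 T′ _ (nb-sym Uz k)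
      ... | inj₁ e = ⊥-elim (h (there (there (there (here e)))))
      ... | inj₂ e = ⊥-elim (h (there (there (there (there (there (here e)))))))
      touched₂ Uz h (there (there (there (there (there (here refl)))))) k with IsT2.S3 T′ _ (nb-sym Uz k)
      ... | inj₁ e = ⊥-elim (h (there (there (there (there (here e))))))
      ... | inj₂ e = inj₂ e
      two : ∀ {z x y} → z ≡ a ⊎ z ≡ b → x ∈ nb U₂ z → y ∈ nb U₂ z → x ≢ y → ⊥
      two (inj₁ refl) m k ne with nbm⁻ {U} {ys} m | nbm⁻ {U} {ys} k
      ... | m′ , h | k′ , h′ = no4 a1 (up {U} {xs} va) m′ k′ (ne1 (nb-U va)) (λ { refl → h (here refl) }) (λ { refl → h (there (there (there (here refl)))) })
                                 (λ { refl → h′ (here refl) }) (λ { refl → h′ (there (there (there (here refl)))) }) ne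
      two (inj₂ refl) m k ne with nbm⁻ {U} {ys} m | nbm⁻ {U} {ys} k
      ... | m′ , h | k′ , h′ = no4 b3 (up {U} {xs} bd) m′ k′ (ne3 (nb-U cd)) (λ { refl → h (there (there (here refl))) }) (λ { refl → h (there (there (there (there (there (here refl)))))) })
                                 (λ { refl → h′ (there (there (here refl))) }) (λ { refl → h′ (there (there (there (there (there (here refl)))))) }) ne
      hc : ∀ z → C5at U₂ z → Untouched {U} {ys} z
      hc z (_ , _ , _ , _ , Q , _) e m k with minus⁻ {U} {ys} (IsPend.Uv Q)
      ... | Uz , h = two (touched₂ Uz h m k) (IsPend.va Q) (IsPend.vb Q) (IsPend.a≢b Q)
      hk₂ : ∀ z → KSat U₂ z → Untouched {U} {ys} z
      hk₂ z (_ , _ , _ , _ , _ , _ , _ , Q) e m k with minus⁻ {U} {ys} (IsKS.U₀ Q)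
      ... | Uz , h = two (touched₂ Uz h m k) (IsKS.m₀₁ Q) (IsKS.m₀₂ Q) (IsKS.1≢2 Q)
      a∉y : a ∉ ys
      a∉y (here e) = a≢1 e
      a∉y (there (here e)) = a≢2 e
      a∉y (there (there (here e))) = a≢3 e
      a∉y (there (there (there (here e)))) = W.v≢a e
      a∉y (there (there (there (there (here e))))) = W.v≢c e
      a∉y (there (there (there (there (there (here e)))))) = W.v≢d e
      b∉y : b ∉ ys
      b∉y (here e) = b≢1 e
      b∉y (there (here e)) = b≢2 e
      b∉y (there (there (here e))) = b≢3 e
      b∉y (there (there (there (here e)))) = w₁≢b (sym e)
      b∉y (there (there (there (there (here e))))) = W.b≢c e
      b∉y (there (there (there (there (there (here e)))))) = W.b≢d e
      main : Start U₂ (wdem U) → Weak U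
      main st = fin R₀ R₀
        where
        open Start st
        R₀ : Run (S F a) (S F b) (K * 1045)
        R₀ = runOf K (S F a) (S F b) (trans (size≡ a (minus⁺ {U} {ys} Ua a∉y)) (cong (K *_) wa)) (trans (size≡ b (minus⁺ {U} {ys} Ub b∉y)) (cong (K *_) wb))
        fin : Run (S F a) (S F b) (K * 1045) → Run (S F a) (S F b) (K * 1045) → Weak U
        fin R Q = finish {U} {ys} {wdem U} st ls uq (λ m → m) (proj₁ C ∷ proj₁ (proj₂ C) ∷ proj₂ (proj₂ C) ∷ proj₁ D ∷ proj₁ (proj₂ D) ∷ proj₂ (proj₂ D) ∷ [])
            (≤-trans (mul-mono K (wdem-1045 (nb-sym Ua a1) m12 a≢2)) (Run.n₁ R) ∷ ≤-trans (mul-mono K (wdem-1045 (nb-sym (nb-U a1) m12) m23 1≢3)) (Run.n₂ R)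
             ∷ ≤-trans (mul-mono K (wdem-1045 (nb-sym Ub b3) (nb-sym (nb-U m12) m23) b≢2)) (Run.n₃ R)
             ∷ ≤-trans (mul-mono K (wdem-1045 (nb-sym Ua (IsT2.a1 T′)) (IsT2.m12 T′) W.v≢c)) (Run.n₁ Q) ∷ ≤-trans (mul-mono K (wdem-1045 (nb-sym (nb-U (IsT2.a1 T′)) (IsT2.m12 T′)) (IsT2.m23 T′) W.a≢d)) (Run.n₂ Q)
             ∷ ≤-trans (mul-mono K (wdem-1045 (nb-sym Ub (IsT2.b3 T′)) (nb-sym (nb-U (IsT2.m12 T′)) (IsT2.m23 T′)) W.b≢c)) (Run.n₃ Q) ∷ [])
            (λ _ _ _ → ≤-refl)
          where
          ls : List (V × PSet (K * 2520))
          ls = (v₁ , Run.c₁ R) ∷ (v₂ , Run.c₂ R) ∷ (v₃ , Run.c₃ R) ∷ (w₁ , Run.c₁ Q) ∷ (w₂ , Run.c₂ Q) ∷ (w₃ , Run.c₃ Q) ∷ []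
          uq : Unique (keys ls)
          uq = (1≢2 ∷ 1≢3 ∷ ne1 (nb-U va) ∷ ne1 (nb-U ac) ∷ ne1 (nb-U cd) ∷ []) ∷ (2≢3 ∷ ne2 (nb-U va) ∷ ne2 (nb-U ac) ∷ ne2 (nb-U cd) ∷ [])
             ∷ (ne3 (nb-U va) ∷ ne3 (nb-U ac) ∷ ne3 (nb-U cd) ∷ []) ∷ (W.a≢c ∷ W.a≢d ∷ []) ∷ (W.c≢d ∷ []) ∷ [] ∷ []
          C = runChk T (S F) R ls uq a∉y b∉y (here refl) (there (here refl)) (there (there (here refl)))
          D = runChk T′ (S F) Q ls uq a∉y b∉y (there (there (there (here refl)))) (there (there (there (there (here refl))))) (there (there (there (there (there (here refl))))))

    t2 : Weak U
    t2 with c5? U′ a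
    ... | no nc = simple nc
    ... | yes (x , y , c , d , P , S) with S b (nbm⁺ ab b∉)
    ...   | inj₁ refl = theta (pend-mirror P)
    ...   | inj₂ refl = theta P

  dem-1008 : ∀ {U w} → deg U w ≤ 2 → 1008 ≤ dem U w
  dem-1008 {U} {w} h with deg U w | does (k2? U w) | does (c5? U w) | does (ks? U w)
  ... | 0 | _ | _ | _ = ≤ᵇ⇒≤ 1008 2520 _
  ... | 1 | true | _ | _ = ≤ᵇ⇒≤ 1008 1260 _
  ... | 1 | false | _ | _ = ≤ᵇ⇒≤ 1008 1475 _
  ... | 2 | _ | true | _ = ≤-refl
  ... | 2 | _ | false | true = ≤ᵇ⇒≤ 1008 1030 _
  ... | 2 | _ | false | false = ≤ᵇ⇒≤ 1008 1045 _
  ... | suc (suc (suc _)) | _ | _ | _ with s≤s (s≤s ()) ← h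

  wdem-ks : ∀ {U v} → KSat U v → wdem U v ≤ 1030
  wdem-ks {U} {v} C@(v₁ , v₂ , v₃ , v₄ , v₅ , p , q , Q) with ks? U v | does (c5? U v) | deg U v | 2≤ (IsKS.m₀₁ Q) (IsKS.m₀₂ Q) (IsKS.1≢2 Q) | Sub2-deg (IsKS.S₀ Q)
  ... | no h | _ | _ | _ | _ = ⊥-elim (h C)
  ... | yes _ | true | 2 | _ | _ = ≤ᵇ⇒≤ 1008 1030 _
  ... | yes _ | false | 2 | _ | _ = ≤-refl
  ... | yes _ | _ | 0 | () | _
  ... | yes _ | _ | 1 | s≤s () | _
  ... | yes _ | _ | suc (suc (suc _)) | _ | s≤s (s≤s ())

  -- Sizes of the sets of v₄ and v₅ (true means degree three): τ after the deletion of v₀, v₁, v₂, ε in the end; ι is the prescribed overlap.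
  τ ε : Bool → ℕ
  τ true = 1008
  τ false = 1260
  ε true = 860
  ε false = 1045

  ι : Bool → Bool → ℕ
  ι true true = 504
  ι false false = 1008
  ι _ _ = 756

  ι-τ : ∀ x y → ι x y + 1512 ≤ τ x + τ y
  ι-τ true true = ≤-refl
  ι-τ true false = ≤-refl
  ι-τ false true = ≤-refl
  ι-τ false false = ≤-refl

  ι-ε : ∀ x y → ι x y ≤ ε x × ι x y ≤ ε y
  ι-ε true true = ≤ᵇ⇒≤ 504 860 _ , ≤ᵇ⇒≤ 504 860 _
  ι-ε true false = ≤ᵇ⇒≤ 756 860 _ , ≤ᵇ⇒≤ 756 1045 _
  ι-ε false true = ≤ᵇ⇒≤ 756 1045 _ , ≤ᵇ⇒≤ 756 860 _
  ι-ε false false = ≤ᵇ⇒≤ 1008 1045 _ , ≤ᵇ⇒≤ 1008 1045 _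

  ε-τ : ∀ x → ε x ≤ τ x
  ε-τ true = ≤ᵇ⇒≤ 860 1008 _
  ε-τ false = ≤ᵇ⇒≤ 1045 1260 _

  ε-room : ∀ x y → ε x + ε y + 1290 ≤ 2520 + ι x y
  ε-room true true = ≤ᵇ⇒≤ 3010 3024 _
  ε-room true false = ≤ᵇ⇒≤ 3195 3276 _
  ε-room false true = ≤ᵇ⇒≤ 3195 3276 _
  ε-room false false = ≤ᵇ⇒≤ 3380 3528 _

  abstract
    deg3? : ∀ U y → Dec (3 ≤ deg U y)
    deg3? U y = 3 ≤? deg U y

  -- `v₃` is kept although it is recoloured in the end: the sets of `v₄` and `v₅` avoid its 1008
  -- colours, so they lie in the remaining 1512 and are forced to overlap. After they are cut down,
  -- 1290 colours are left for `v₂` and `v₃`. Two sets of size 860 in there need to share only 430,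
  -- and 430 + 2 · 1045 = 2520 is just what `pair` allows.
  module RB (U : VSet) (v₀ v₁ v₂ v₃ v₄ v₅ : V) (B : IsB U v₀ v₁ v₂ v₃ v₄ v₅) (noKS : ¬ KSat U v₀) (rec : Rec U) where
    open IsB B
    open B≢ (b≢ B)
    private
      xs : List V
      xs = v₀ ∷ v₁ ∷ v₂ ∷ []
      U′ : VSet
      U′ = minus U xs
      Uu₁ = nb-U m₀₁
      Uu₂ = nb-U m₀₂
      Uu₃ = nb-U m₁₃
      Uu₄ = nb-U m₂₄
      Uu₅ = nb-U m₂₅
      3∉ : v₃ ∉ xs
      3∉ (here e) = 0≢3 (sym e)
      3∉ (there (here e)) = ~≢ (nb-~ m₁₃) (sym e)
      3∉ (there (there (here e))) = 2≢3 (sym e)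
      4∉ : v₄ ∉ xs
      4∉ (here e) = 0≢4 (sym e)
      4∉ (there (here e)) = 1≢4 (sym e)
      4∉ (there (there (here e))) = ~≢ (nb-~ m₂₄) (sym e)
      5∉ : v₅ ∉ xs
      5∉ (here e) = 0≢5 (sym e)
      5∉ (there (here e)) = 1≢5 (sym e)
      5∉ (there (there (here e))) = ~≢ (nb-~ m₂₅) (sym e)

      touched : ∀ {z e} → U z ≡ true → z ∉ xs → e ∈ xs → e ∈ nb U z → z ≡ v₃ ⊎ z ≡ v₄ ⊎ z ≡ v₅
      touched Uz h (here refl) k with S₀ _ (nb-sym Uz k)
      ... | inj₁ e = ⊥-elim (h (there (here e)))
      ... | inj₂ e = ⊥-elim (h (there (there (here e))))
      touched Uz h (there (here refl)) k with S₁ _ (nb-sym Uz k)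
      ... | inj₁ e = ⊥-elim (h (here e))
      ... | inj₂ e = inj₁ e
      touched Uz h (there (there (here refl))) k with S₂ _ (nb-sym Uz k)
      ... | inj₁ e = ⊥-elim (h (here e))
      ... | inj₂ e = inj₂ e

      n₃₄ : v₄ ∈ nb U′ v₃
      n₃₄ = nbm⁺ m₃₄ 4∉
      n₃₅ : v₅ ∈ nb U′ v₃
      n₃₅ = nbm⁺ m₃₅ 5∉
      n₄₃ : v₃ ∈ nb U′ v₄
      n₄₃ = nbm⁺ (nb-sym Uu₃ m₃₄) 3∉
      n₅₃ : v₃ ∈ nb U′ v₅
      n₅₃ = nbm⁺ (nb-sym Uu₃ m₃₅) 3∉
      k₃ : v₁ ∈ nb U v₃
      k₃ = nb-sym Uu₁ m₁₃
      k₄ : v₂ ∈ nb U v₄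
      k₄ = nb-sym Uu₂ m₂₄
      k₅ : v₂ ∈ nb U v₅
      k₅ = nb-sym Uu₂ m₂₅

      -- A C₅ through `v₄`, `v₃`, `v₅` supplies the second path, so `v₀` would lie in an
      -- eight-vertex component of `U`.
      fromC5 : ∀ {c d} → IsPend U′ v₃ v₄ v₅ c d → ⊥
      fromC5 {c} {d} P = noKS (v₁ , v₂ , v₃ , v₄ , v₅ , c , d
        , mkKS B (up {U} {xs} ac) (up {U} {xs} bd) (up {U} {xs} cd) (ne ac) (s≢ v≢c) (ne bd) (s≢ v≢d)
            (s4 m₂₄ (inj₁ refl) Sa) (s4 m₂₅ (inj₂ refl) Sb)
            (λ w m → swap (upS2 {U} {xs} (un (nb-U ac) (s≢ v≢c) (s≢ a≢c) (s≢ b≢c)) Sc w m))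
            (λ w m → swap (upS2 {U} {xs} (un (nb-U bd) (s≢ v≢d) (s≢ a≢d) (s≢ b≢d)) Sd w m)))
        where
        open IsPend P
        open Pend≢ (pend≢ P)
        ne : ∀ {w z} → w ∈ nb U′ z → w ≢ v₂
        ne m refl = proj₂ (nbm⁻ {U} {xs} m) (there (there (here refl)))
        un : ∀ {y} → U′ y ≡ true → y ≢ v₃ → y ≢ v₄ → y ≢ v₅ → Untouched {U} {xs} y
        un Uy h₃ h₄ h₅ e m k with minus⁻ {U} {xs} Uy
        ... | Uy′ , h with touched Uy′ h m k
        ...   | inj₁ e₁ = h₃ e₁
        ...   | inj₂ (inj₁ e₁) = h₄ e₁
        ...   | inj₂ (inj₂ e₁) = h₅ e₁
        s4 : ∀ {y c} → y ∈ nb U v₂ → y ≡ v₄ ⊎ y ≡ v₅ → Sub2 U′ y v₃ c → Sub3 U y c v₂ v₃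
        s4 {y} my y45 S w m with w ∈? xs
        ... | no h with S w (nbm⁺ m h)
        ...   | inj₁ e = inj₂ (inj₂ e)
        ...   | inj₂ e = inj₁ e
        s4 {y} my y45 S w m | yes (there (there (here e))) = inj₂ (inj₁ e)
        s4 {y} my y45 S w m | yes (here refl) with S₀ y (nb-sym (nb-U my) m) | y45
        ... | inj₁ e | inj₁ f = ⊥-elim (1≢4 (trans (sym e) f))
        ... | inj₁ e | inj₂ f = ⊥-elim (1≢5 (trans (sym e) f))
        ... | inj₂ refl | _ = ⊥-elim (~-irr (nb-~ my))
        s4 {y} my y45 S w m | yes (there (here refl)) with S₁ y (nb-sym (nb-U my) m) | y45
        ... | inj₁ e | inj₁ f = ⊥-elim (0≢4 (trans (sym e) f))
        ... | inj₁ e | inj₂ f = ⊥-elim (0≢5 (trans (sym e) f))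
        ... | inj₂ e | inj₁ f = ⊥-elim (~≢ (nb-~ m₃₄) (trans (sym e) f))
        ... | inj₂ e | inj₂ f = ⊥-elim (~≢ (nb-~ m₃₅) (trans (sym e) f))

      noC3 : C5at U′ v₃ → ⊥
      noC3 (a , b , c , d , P , S) with S v₄ n₃₄ | S v₅ n₃₅
      ... | inj₁ refl | inj₁ e = 4≢5 (sym e)
      ... | inj₁ refl | inj₂ refl = fromC5 P
      ... | inj₂ refl | inj₁ refl = fromC5 (pend-mirror P)
      ... | inj₂ refl | inj₂ e = 4≢5 (sym e)

      toC3 : ∀ {z} → v₃ ∈ nb U′ z → C5at U′ z → C5at U′ v₃
      toC3 m (a , b , c , d , P , S) with S v₃ m
      ... | inj₁ refl = c5-all P S (inj₂ (inj₁ refl))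
      ... | inj₂ refl = c5-all P S (inj₂ (inj₂ (inj₂ (inj₂ refl))))

      hc : ∀ z → C5at U′ z → Untouched {U} {xs} z
      hc z C@(_ , _ , _ , _ , P , _) e m k with minus⁻ {U} {xs} (IsPend.Uv P)
      ... | Uz , h with touched Uz h m k
      ...   | inj₁ refl = noC3 C
      ...   | inj₂ (inj₁ refl) = noC3 (toC3 n₄₃ C)
      ...   | inj₂ (inj₂ refl) = noC3 (toC3 n₅₃ C)

      hk45 : ∀ {y y′} → v₃ ∈ nb U′ y → y′ ∈ nb U′ v₃ → y ≢ y′ → v₂ ∈ nb U y′ → KSat U′ y → ⊥
      hk45 {y} {y′} m m′ ne k (w₁ , w₂ , w₃ , w₄ , w₅ , p , q , Q) with IsKS.S₀ Q v₃ m
      ... | inj₂ refl = ks-3 (IsKS.isB Q) v₁ (there (here refl)) k₃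
      ... | inj₁ refl with IsKS.S₁ Q y′ m′
      ...   | inj₁ e = ne (sym e)
      ...   | inj₂ refl = ks-3 (b-swap (IsKS.isB Q)) v₂ (there (there (here refl))) k

      hk : ∀ z → KSat U′ z → Untouched {U} {xs} z
      hk z C@(w₁ , w₂ , w₃ , w₄ , w₅ , p , q , Q) e m k with minus⁻ {U} {xs} (IsKS.U₀ Q)
      ... | Uz , h with touched Uz h m k
      ...   | inj₂ (inj₁ refl) = hk45 n₄₃ n₃₅ 4≢5 k₅ C
      ...   | inj₂ (inj₂ refl) = hk45 n₅₃ n₃₄ (s≢ 4≢5) k₄ C
      ...   | inj₁ refl with IsKS.S₀ Q v₄ n₃₄ | IsKS.S₀ Q v₅ n₃₅
      ...     | inj₂ refl | _ = ks-3 (IsKS.isB Q) v₂ (there (there (here refl))) k₄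
      ...     | inj₁ _ | inj₂ refl = ks-3 (IsKS.isB Q) v₂ (there (there (here refl))) k₅
      ...     | inj₁ e₁ | inj₁ e₂ = 4≢5 (trans e₁ (sym e₂))

      x₄ x₅ : Bool
      x₄ = does (deg3? U v₄)
      x₅ = does (deg3? U v₅)

      t : V → ℕ
      t w = if does (w ≟ᵥ v₃) then 1008 else (if does (w ≟ᵥ v₄) then τ x₄ else (if does (w ≟ᵥ v₅) then τ x₅ else wdem U w))

      τ≤ : ∀ {y} → v₂ ∈ nb U y → τ (does (deg3? U y)) ≤ dem U′ y
      τ≤ {y} m with deg3? U y
      ... | yes _ = dem-1008 (≤-pred (≤-trans (deg-< {U} {xs} m (there (there (here refl)))) (deg≤3 U y)))
      ... | no h = dem-leaf (≤-pred (≤-trans (deg-< {U} {xs} m (there (there (here refl)))) (≤-pred (≰⇒> h))))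

      wε : ∀ {y} → v₂ ∈ nb U y → v₃ ∈ nb U y → wdem U y ≤ ε (does (deg3? U y))
      wε {y} m m′ with deg3? U y
      ... | yes h = ≤-reflexive (wdem-3 h)
      ... | no h = wdem-1045 m m′ 2≢3

      t≤ : ∀ w → U′ w ≡ true → t w ≤ dem U′ w
      t≤ w _ with w ≟ᵥ v₃
      ... | yes refl = dem-1008 (≤-pred (≤-trans (deg-< {U} {xs} k₃ (there (here refl))) (deg≤3 U v₃)))
      ... | no _ with w ≟ᵥ v₄
      ...   | yes refl = τ≤ k₄
      ...   | no _ with w ≟ᵥ v₅
      ...     | yes refl = τ≤ k₅
      ...     | no _ = dem-up hc hk w

      t-else : ∀ {w} → w ≢ v₃ → w ≢ v₄ → w ≢ v₅ → wdem U w ≤ t w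
      t-else {w} h₃ h₄ h₅ with w ≟ᵥ v₃ | w ≟ᵥ v₄ | w ≟ᵥ v₅
      ... | yes e | _ | _ = ⊥-elim (h₃ e)
      ... | no _ | yes e | _ = ⊥-elim (h₄ e)
      ... | no _ | no _ | yes e = ⊥-elim (h₅ e)
      ... | no _ | no _ | no _ = ≤-refl

      t3 : t v₃ ≡ 1008
      t3 with v₃ ≟ᵥ v₃
      ... | yes _ = refl
      ... | no h = ⊥-elim (h refl)
      t4 : t v₄ ≡ τ x₄
      t4 with v₄ ≟ᵥ v₃ | v₄ ≟ᵥ v₄
      ... | yes e | _ = ⊥-elim (~≢ (nb-~ m₃₄) (sym e))
      ... | no _ | yes _ = refl
      ... | no _ | no h = ⊥-elim (h refl)
      t5 : t v₅ ≡ τ x₅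
      t5 with v₅ ≟ᵥ v₃ | v₅ ≟ᵥ v₄ | v₅ ≟ᵥ v₅
      ... | yes e | _ | _ = ⊥-elim (~≢ (nb-~ m₃₅) (sym e))
      ... | no _ | yes e | _ = ⊥-elim (4≢5 (sym e))
      ... | no _ | no _ | yes _ = refl
      ... | no _ | no _ | no h = ⊥-elim (h refl)

      wd3 : ∀ {y x} → x ∈ nb U y → v₄ ∈ nb U y → v₅ ∈ nb U y → x ≢ v₄ → x ≢ v₅ → wdem U y ≤ 860
      wd3 m m′ m″ h h′ = ≤-reflexive (wdem-3 (3≤ m m′ m″ h h′ 4≢5))

    rb : Weak U
    rb = main (start U′ t (rec U′ (size-minus {U} {xs} U₀ (here refl))) t≤)
      where
      main : Start U′ t → Weak U
      main st = step₁ (spread (S F v₄) (S F v₅) (K * ε x₄) (K * ε x₅) (K * ι x₄ x₅)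
          (overlap-ar K (cnt (S F v₄ ∪ S F v₅)) (cnt (S F v₄ ∩ S F v₅)) (τ x₄) (τ x₅) (ι x₄ x₅)
            (trans (cnt-∪∩ (S F v₄) (S F v₅)) (cong₂ _+_ c4 c5))
            (≤-trans (+-monoʳ-≤ (cnt (S F v₄ ∪ S F v₅)) (≤-reflexive (sym c3)))
               (≤-trans (+-monoˡ-≤ (cnt (S F v₃)) (cnt-mono {f = S F v₄ ∪ S F v₅} {∁ (S F v₃)}
                  (∪-⊑ {f = S F v₄} {S F v₅} {∁ (S F v₃)} (Disj⇒⊑∁ {f = S F v₄} (valid F v₄ v₃ (~-sym (nb-~ m₃₄)))) (Disj⇒⊑∁ {f = S F v₅} (valid F v₅ v₃ (~-sym (nb-~ m₃₅)))))))
                 (≤-reflexive (trans (+-comm (cnt (∁ (S F v₃))) _) (cnt-∁ (S F v₃))))))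
            (ι-τ x₄ x₅))
          (mul-mono K (proj₁ (ι-ε x₄ x₅))) (mul-mono K (proj₂ (ι-ε x₄ x₅)))
          (≤-trans (mul-mono K (ε-τ x₄)) (≤-reflexive (sym c4))) (≤-trans (mul-mono K (ε-τ x₅)) (≤-reflexive (sym c5))))
        where
        open Start st
        c3 : cnt (S F v₃) ≡ K * 1008
        c3 = trans (size≡ v₃ (minus⁺ {U} {xs} Uu₃ 3∉)) (cong (K *_) t3)
        c4 : cnt (S F v₄) ≡ K * τ x₄
        c4 = trans (size≡ v₄ (minus⁺ {U} {xs} Uu₄ 4∉)) (cong (K *_) t4)
        c5 : cnt (S F v₅) ≡ K * τ x₅
        c5 = trans (size≡ v₅ (minus⁺ {U} {xs} Uu₅ 5∉)) (cong (K *_) t5)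
        step₁ : (Σ (PSet (K * 2520)) λ T₄ → Σ (PSet (K * 2520)) λ T₅ → T₄ ⊑ S F v₄ × T₅ ⊑ S F v₅ × cnt T₄ ≡ K * ε x₄ × cnt T₅ ≡ K * ε x₅
                  × cnt (T₄ ∪ T₅) + K * ι x₄ x₅ ≤ K * ε x₄ + K * ε x₅) → Weak U
        step₁ (T₄ , T₅ , p₄ , p₅ , q₄ , q₅ , h) = step₂ (twoIn (∁ (T₄ ∪ T₅)) (K * 860) (K * 1290)
            (cnt-∁-≥ (T₄ ∪ T₅) (room-ar K (cnt (T₄ ∪ T₅)) (ε x₄) (ε x₅) (ι x₄ x₅) h (ε-room x₄ x₅)))
            (mul-mono K (≤ᵇ⇒≤ 860 1290 _)) (≤-trans (mul-mono K (≤ᵇ⇒≤ 1290 1720 _)) (≤-reflexive (*-distribˡ-+ K 860 860))))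
          where
          step₂ : (Σ (PSet (K * 2520)) λ A → Σ (PSet (K * 2520)) λ B′ → A ⊑ ∁ (T₄ ∪ T₅) × B′ ⊑ ∁ (T₄ ∪ T₅) × cnt A ≡ K * 860 × cnt B′ ≡ K * 860
                    × cnt (A ∩ B′) + K * 1290 ≤ K * 860 + K * 860) → Weak U
          step₂ (A , B′ , pA , pB , qA , qB , hAB) = step₃ (pair A B′ (K * 1045)
              (≤-trans (+-monoˡ-≤ _ (≤-reflexive qA)) (kk K 860 1045 (≤ᵇ⇒≤ 1905 2520 _)))
              (≤-trans (+-monoˡ-≤ _ (≤-reflexive qB)) (kk K 860 1045 (≤ᵇ⇒≤ 1905 2520 _)))
              (tight-ar K (cnt (A ∩ B′)) 1290 1045 hAB (≤ᵇ⇒≤ 3810 3810 _)))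
            where
            step₃ : Pair A B′ (K * 1045) → Weak U
            step₃ pr = finish {U} {xs} {t} st ls uq (λ { (here e) → here e ; (there (here e)) → there (here e) ; (there (there (here e))) → there (there (here e)) })
                (C₀ ∷ C₁ ∷ C₂ ∷ C₃ ∷ C₄ ∷ C₅ ∷ [])
                (≤-trans (mul-mono K (wdem-1045 m₀₁ m₀₂ 1≢2)) n₁ ∷ ≤-trans (mul-mono K (wdem-1045 (nb-sym U₀ m₀₁) m₁₃ 0≢3)) n₂
                 ∷ ≤-trans (mul-mono K (wd3 (nb-sym U₀ m₀₂) m₂₄ m₂₅ 0≢4 0≢5)) (≤-reflexive (sym qA))
                 ∷ ≤-trans (mul-mono K (wd3 k₃ m₃₄ m₃₅ 1≢4 1≢5)) (≤-reflexive (sym qB))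
                 ∷ ≤-trans (mul-mono K (wε k₄ (nb-sym Uu₃ m₃₄))) (≤-reflexive (sym q₄)) ∷ ≤-trans (mul-mono K (wε k₅ (nb-sym Uu₃ m₃₅))) (≤-reflexive (sym q₅)) ∷ [])
                (λ w _ h → t-else (λ e → h (there (there (there (here e))))) (λ e → h (there (there (there (there (here e)))))) (λ e → h (there (there (there (there (there (here e))))))))
              where
              open Pair pr
              ls : List (V × PSet (K * 2520))
              ls = (v₀ , c₁) ∷ (v₁ , c₂) ∷ (v₂ , A) ∷ (v₃ , B′) ∷ (v₄ , T₄) ∷ (v₅ , T₅) ∷ []
              uq : Unique (keys ls)
              uq = (~≢ (nb-~ m₀₁) ∷ ~≢ (nb-~ m₀₂) ∷ 0≢3 ∷ 0≢4 ∷ 0≢5 ∷ []) ∷ (1≢2 ∷ ~≢ (nb-~ m₁₃) ∷ 1≢4 ∷ 1≢5 ∷ [])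
                 ∷ (2≢3 ∷ ~≢ (nb-~ m₂₄) ∷ ~≢ (nb-~ m₂₅) ∷ []) ∷ (~≢ (nb-~ m₃₄) ∷ ~≢ (nb-~ m₃₅) ∷ []) ∷ (4≢5 ∷ []) ∷ [] ∷ []
              i₀ : (v₀ , c₁) ∈ ls
              i₀ = here refl
              i₁ : (v₁ , c₂) ∈ ls
              i₁ = there (here refl)
              i₂ : (v₂ , A) ∈ ls
              i₂ = there (there (here refl))
              i₃ : (v₃ , B′) ∈ ls
              i₃ = there (there (there (here refl)))
              i₄ : (v₄ , T₄) ∈ ls
              i₄ = there (there (there (there (here refl))))
              i₅ : (v₅ , T₅) ∈ ls
              i₅ = there (there (there (there (there (here refl)))))
              dA4 : Disj A T₄
              dA4 i a b = not-true (pA i a) (∨-introˡ b)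
              dA5 : Disj A T₅
              dA5 i a b = not-true (pA i a) (∨-introʳ {T₄ i} b)
              dB4 : Disj B′ T₄
              dB4 i a b = not-true (pB i a) (∨-introˡ b)
              dB5 : Disj B′ T₅
              dB5 i a b = not-true (pB i a) (∨-introʳ {T₄ i} b)
              C₀ : Chk U (over ls (S F)) (v₀ , c₁)
              C₀ = U₀ , λ w m → [ (λ e → dIn′ ls uq e i₁ d₁₂) , (λ e → dIn′ ls uq e i₂ (Disj-sym {f = A} dA)) ]′ (S₀ w m)
              C₁ : Chk U (over ls (S F)) (v₁ , c₂)
              C₁ = Uu₁ , λ w m → [ (λ e → dIn′ ls uq e i₀ (Disj-sym {f = c₁} d₁₂)) , (λ e → dIn′ ls uq e i₃ (Disj-sym {f = B′} dB)) ]′ (S₁ w m)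
              C₂ : Chk U (over ls (S F)) (v₂ , A)
              C₂ = Uu₂ , λ w m → [ (λ e → dIn′ ls uq e i₀ dA) , [ (λ e → dIn′ ls uq e i₄ dA4) , (λ e → dIn′ ls uq e i₅ dA5) ]′ ]′ (S₂ w m)
              C₃ : Chk U (over ls (S F)) (v₃ , B′)
              C₃ = Uu₃ , λ w m → [ (λ e → dIn′ ls uq e i₁ dB) , [ (λ e → dIn′ ls uq e i₄ dB4) , (λ e → dIn′ ls uq e i₅ dB5) ]′ ]′ (S₃ w m)
              chk45 : ∀ {y} (T : PSet (K * 2520)) → y ≡ v₄ ⊎ y ≡ v₅ → T ⊑ S F y → Disj A T → Disj B′ T →
                      ∀ w → w ∈ nb U y → Disj T (over ls (S F) w)
              chk45 {y} T y45 p dA′ dB″ w m with w ∈? keys ls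
              ... | no h = dOut′ ls refl h (λ i a b → valid F y w (nb-~ m) i (p i a) b)
              ... | yes (there (there (here e))) = dIn′ ls uq e i₂ (Disj-sym {f = A} dA′)
              ... | yes (there (there (there (here e)))) = dIn′ ls uq e i₃ (Disj-sym {f = B′} dB″)
              chk45 T (inj₁ refl) p dA′ dB″ w m | yes (here refl) with S₀ _ (nb-sym Uu₄ m)
              ... | inj₁ e = ⊥-elim (1≢4 (sym e))
              ... | inj₂ e = ⊥-elim (~≢ (nb-~ m₂₄) (sym e))
              chk45 T (inj₂ refl) p dA′ dB″ w m | yes (here refl) with S₀ _ (nb-sym Uu₅ m)
              ... | inj₁ e = ⊥-elim (1≢5 (sym e))
              ... | inj₂ e = ⊥-elim (~≢ (nb-~ m₂₅) (sym e))
              chk45 T (inj₁ refl) p dA′ dB″ w m | yes (there (here refl)) with S₁ _ (nb-sym Uu₄ m)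
              ... | inj₁ e = ⊥-elim (0≢4 (sym e))
              ... | inj₂ e = ⊥-elim (~≢ (nb-~ m₃₄) (sym e))
              chk45 T (inj₂ refl) p dA′ dB″ w m | yes (there (here refl)) with S₁ _ (nb-sym Uu₅ m)
              ... | inj₁ e = ⊥-elim (0≢5 (sym e))
              ... | inj₂ e = ⊥-elim (~≢ (nb-~ m₃₅) (sym e))
              chk45 T (inj₁ refl) p dA′ dB″ w m | yes (there (there (there (there (here refl))))) = ⊥-elim (~-irr (nb-~ m))
              chk45 T (inj₂ refl) p dA′ dB″ w m | yes (there (there (there (there (here refl))))) = ⊥-elim (tri (nb-~ m₃₅) (nb-~ m) (nb-~ m₃₄))
              chk45 T (inj₁ refl) p dA′ dB″ w m | yes (there (there (there (there (there (here refl)))))) = ⊥-elim (tri (nb-~ m₃₄) (nb-~ m) (nb-~ m₃₅))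
              chk45 T (inj₂ refl) p dA′ dB″ w m | yes (there (there (there (there (there (here refl)))))) = ⊥-elim (~-irr (nb-~ m))
              C₄ : Chk U (over ls (S F)) (v₄ , T₄)
              C₄ = Uu₄ , chk45 T₄ (inj₁ refl) p₄ dA4 dB4
              C₅ : Chk U (over ls (S F)) (v₅ , T₅)
              C₅ = Uu₅ , chk45 T₅ (inj₂ refl) p₅ dA5 dB5

  -- `v₂` and `v₃` take their sets from one half of the colours, `v₄` and `v₅` from the other. Two
  -- sets of size 860 within 1260 share 460, and 460 + 2 · 1030 = 2520 is just what `pair` allows.
  module RKS (U : VSet) (v₀ v₁ v₂ v₃ v₄ v₅ p q : V) (Q : IsKS U v₀ v₁ v₂ v₃ v₄ v₅ p q) (rec : Rec U) where
    open IsKS Q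
    open B≢ (b≢ isB)
    private
      Q′ = ks-flip Q
      module F′ = IsKS Q′
      xs : List V
      xs = v₀ ∷ v₁ ∷ v₂ ∷ v₃ ∷ v₄ ∷ v₅ ∷ p ∷ q ∷ []
      U′ : VSet
      U′ = minus U xs
      j₀ : v₀ ∈ xs
      j₀ = here refl
      j₁ : v₁ ∈ xs
      j₁ = there (here refl)
      j₂ : v₂ ∈ xs
      j₂ = there (there (here refl))
      j₃ : v₃ ∈ xs
      j₃ = there (there (there (here refl)))
      j₄ : v₄ ∈ xs
      j₄ = there (there (there (there (here refl))))
      j₅ : v₅ ∈ xs
      j₅ = there (there (there (there (there (here refl)))))
      jp : p ∈ xs
      jp = there (there (there (there (there (there (here refl))))))
      jq : q ∈ xs
      jq = there (there (there (there (there (there (there (here refl)))))))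
      sub2 : ∀ {a x y z} → Sub2 U a x y → x ∈ xs → y ∈ xs → z ∈ nb U a → z ∈ xs
      sub2 S mx my m with S _ m
      ... | inj₁ refl = mx
      ... | inj₂ refl = my
      sub3 : ∀ {a x y w z} → Sub3 U a x y w → x ∈ xs → y ∈ xs → w ∈ xs → z ∈ nb U a → z ∈ xs
      sub3 S mx my mw m with S _ m
      ... | inj₁ refl = mx
      ... | inj₂ (inj₁ refl) = my
      ... | inj₂ (inj₂ refl) = mw
      closed : ∀ {e z} → e ∈ xs → z ∈ nb U e → z ∈ xs
      closed (here refl) = sub2 S₀ j₁ j₂
      closed (there (here refl)) = sub2 S₁ j₀ j₃
      closed (there (there (here refl))) = sub3 S₂ j₀ j₄ j₅
      closed (there (there (there (here refl)))) = sub3 S₃ j₁ j₄ j₅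
      closed (there (there (there (there (here refl))))) = sub3 S₄ jp j₂ j₃
      closed (there (there (there (there (there (here refl)))))) = sub3 S₅ jq j₂ j₃
      closed (there (there (there (there (there (there (here refl))))))) = sub2 Sp jq j₄
      closed (there (there (there (there (there (there (there (here refl)))))))) = sub2 Sq jp j₅
      un : ∀ {z} → U′ z ≡ true → Untouched {U} {xs} z
      un Uz e m k with minus⁻ {U} {xs} Uz
      ... | Uz′ , h = h (closed m (nb-sym Uz′ k))
      wd : ∀ {y a b c} → a ∈ nb U y → b ∈ nb U y → c ∈ nb U y → a ≢ b → a ≢ c → b ≢ c → wdem U y ≤ 860
      wd m m′ m″ h h′ h″ = ≤-reflexive (wdem-3 (3≤ m m′ m″ h h′ h″))

    rks : Weak U
    rks = main (start U′ (wdem U) (rec U′ (size-minus {U} {xs} U₀ j₀))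
        (λ x _ → dem-up (λ z C → un (IsPend.Uv (proj₁ (proj₂ (proj₂ (proj₂ (proj₂ C))))))) (λ { z (_ , _ , _ , _ , _ , _ , _ , C) → un (IsKS.U₀ C) }) x))
      where
      main : Start U′ (wdem U) → Weak U
      main st = step₁ (sub (λ _ → true) (K * 1260) (≤-trans (mul-mono K (≤ᵇ⇒≤ 1260 2520 _)) (≤-reflexive (sym cnt-full))))
        where
        open Start st
        Two : PSet (K * 2520) → Set
        Two R = Σ (PSet (K * 2520)) λ A → Σ (PSet (K * 2520)) λ B → A ⊑ R × B ⊑ R × cnt A ≡ K * 860 × cnt B ≡ K * 860 × cnt (A ∩ B) + K * 1260 ≤ K * 860 + K * 860
        two : ∀ R → K * 1260 ≤ cnt R → Two R
        two R h = twoIn R (K * 860) (K * 1260) h (mul-mono K (≤ᵇ⇒≤ 860 1260 _)) (≤-trans (mul-mono K (≤ᵇ⇒≤ 1260 1720 _)) (≤-reflexive (*-distribˡ-+ K 860 860)))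
        pr : (A B : PSet (K * 2520)) → cnt A ≡ K * 860 → cnt B ≡ K * 860 → cnt (A ∩ B) + K * 1260 ≤ K * 860 + K * 860 → Pair A B (K * 1030)
        pr A B qA qB h = pair A B (K * 1030)
              (≤-trans (+-monoˡ-≤ _ (≤-reflexive qA)) (kk K 860 1030 (≤ᵇ⇒≤ 1890 2520 _)))
              (≤-trans (+-monoˡ-≤ _ (≤-reflexive qB)) (kk K 860 1030 (≤ᵇ⇒≤ 1890 2520 _)))
              (tight-ar K (cnt (A ∩ B)) 1260 1030 h (≤ᵇ⇒≤ 3780 3780 _))
        step₁ : (Σ (PSet (K * 2520)) λ H → H ⊑ (λ _ → true) × cnt H ≡ K * 1260) → Weak U
        step₁ (H , _ , qH) = step₂ (two H (≤-reflexive (sym qH))) (two (∁ H) (cnt-∁-≥ H (≤-trans (+-monoˡ-≤ _ (≤-reflexive qH)) (kk K 1260 1260 (≤-refl {2520})))))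
          where
          step₂ : Two H → Two (∁ H) → Weak U
          step₂ (A , B , pA , pB , qA , qB , hAB) (C , D , pC , pD , qC , qD , hCD) = step₃ (pr A B qA qB hAB) (pr C D qC qD hCD)
            where
            hh : ∀ {X Y : PSet (K * 2520)} → X ⊑ H → Y ⊑ ∁ H → Disj X Y
            hh pX pY i a b = not-true (pY i b) (pX i a)
            step₃ : Pair A B (K * 1030) → Pair C D (K * 1030) → Weak U
            step₃ P₁ P₂ = finish {U} {xs} {wdem U} st ls uq (λ m → m) chk big (λ _ _ _ → ≤-refl)
              where
              module P = Pair P₁
              module R = Pair P₂
              ls : List (V × PSet (K * 2520))
              ls = (v₀ , P.c₁) ∷ (v₁ , P.c₂) ∷ (v₂ , A) ∷ (v₃ , B) ∷ (v₄ , C) ∷ (v₅ , D) ∷ (p , R.c₁) ∷ (q , R.c₂) ∷ []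
              uq : Unique (keys ls)
              uq = (~≢ (nb-~ m₀₁) ∷ ~≢ (nb-~ m₀₂) ∷ 0≢3 ∷ 0≢4 ∷ 0≢5 ∷ s≢ (proj₁ (ks-p≢0 Q)) ∷ s≢ (proj₂ (ks-p≢0 Q)) ∷ [])
                 ∷ (1≢2 ∷ ~≢ (nb-~ m₁₃) ∷ 1≢4 ∷ 1≢5 ∷ s≢ (proj₁ (ks-p≢0 (ks-swap Q))) ∷ s≢ (proj₂ (ks-p≢0 (ks-swap Q))) ∷ [])
                 ∷ (2≢3 ∷ ~≢ (nb-~ m₂₄) ∷ ~≢ (nb-~ m₂₅) ∷ s≢ p≢2 ∷ s≢ q≢2 ∷ []) ∷ (~≢ (nb-~ m₃₄) ∷ ~≢ (nb-~ m₃₅) ∷ s≢ p≢3 ∷ s≢ q≢3 ∷ [])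
                 ∷ (4≢5 ∷ ~≢ (nb-~ m₄p) ∷ s≢ F′.1≢2 ∷ []) ∷ (s≢ F′.0≢3 ∷ ~≢ (nb-~ m₅q) ∷ []) ∷ (~≢ (nb-~ mpq) ∷ []) ∷ [] ∷ []
              i₀ : (v₀ , P.c₁) ∈ ls
              i₀ = here refl
              i₁ : (v₁ , P.c₂) ∈ ls
              i₁ = there (here refl)
              i₂ : (v₂ , A) ∈ ls
              i₂ = there (there (here refl))
              i₃ : (v₃ , B) ∈ ls
              i₃ = there (there (there (here refl)))
              i₄ : (v₄ , C) ∈ ls
              i₄ = there (there (there (there (here refl))))
              i₅ : (v₅ , D) ∈ ls
              i₅ = there (there (there (there (there (here refl)))))
              ip : (p , R.c₁) ∈ ls
              ip = there (there (there (there (there (there (here refl))))))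
              iq : (q , R.c₂) ∈ ls
              iq = there (there (there (there (there (there (there (here refl)))))))
              ck2 : ∀ {y X a b Y Z} → U y ≡ true → Sub2 U y a b → (a , Y) ∈ ls → (b , Z) ∈ ls → Disj X Y → Disj X Z → Chk U (over ls (S F)) (y , X)
              ck2 Uy S ia ib d d′ = Uy , λ w m → [ (λ e → dIn′ ls uq e ia d) , (λ e → dIn′ ls uq e ib d′) ]′ (S w m)
              ck3 : ∀ {y X a b c Y Z W} → U y ≡ true → Sub3 U y a b c → (a , Y) ∈ ls → (b , Z) ∈ ls → (c , W) ∈ ls → Disj X Y → Disj X Z → Disj X W → Chk U (over ls (S F)) (y , X)
              ck3 Uy S ia ib ic d d′ d″ = Uy , λ w m → [ (λ e → dIn′ ls uq e ia d) , [ (λ e → dIn′ ls uq e ib d′) , (λ e → dIn′ ls uq e ic d″) ]′ ]′ (S w m)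
              chk : All (Chk U (over ls (S F))) ls
              chk = ck2 {X = P.c₁} {Y = P.c₂} {Z = A} U₀ S₀ i₁ i₂ P.d₁₂ (Disj-sym {f = A} P.dA)
                  ∷ ck2 {X = P.c₂} {Y = P.c₁} {Z = B} (nb-U m₀₁) S₁ i₀ i₃ (Disj-sym {f = P.c₁} P.d₁₂) (Disj-sym {f = B} P.dB)
                  ∷ ck3 {X = A} {Y = P.c₁} {Z = C} {W = D} (nb-U m₀₂) S₂ i₀ i₄ i₅ P.dA (hh {A} {C} pA pC) (hh {A} {D} pA pD)
                  ∷ ck3 {X = B} {Y = P.c₂} {Z = C} {W = D} (nb-U m₁₃) S₃ i₁ i₄ i₅ P.dB (hh {B} {C} pB pC) (hh {B} {D} pB pD)
                  ∷ ck3 {X = C} {Y = R.c₁} {Z = A} {W = B} (nb-U m₂₄) S₄ ip i₂ i₃ R.dA (Disj-sym {f = A} (hh {A} {C} pA pC)) (Disj-sym {f = B} (hh {B} {C} pB pC))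
                  ∷ ck3 {X = D} {Y = R.c₂} {Z = A} {W = B} (nb-U m₂₅) S₅ iq i₂ i₃ R.dB (Disj-sym {f = A} (hh {A} {D} pA pD)) (Disj-sym {f = B} (hh {B} {D} pB pD))
                  ∷ ck2 {X = R.c₁} {Y = R.c₂} {Z = C} (nb-U m₄p) Sp iq i₄ R.d₁₂ (Disj-sym {f = C} R.dA)
                  ∷ ck2 {X = R.c₂} {Y = R.c₁} {Z = D} (nb-U m₅q) Sq ip i₅ (Disj-sym {f = R.c₁} R.d₁₂) (Disj-sym {f = D} R.dB)
                  ∷ []
              big : All (λ (x , X) → K * wdem U x ≤ cnt X) ls
              big = ≤-trans (mul-mono K (wdem-ks (_ , _ , _ , _ , _ , _ , _ , Q))) P.n₁
                  ∷ ≤-trans (mul-mono K (wdem-ks (_ , _ , _ , _ , _ , _ , _ , ks-swap Q))) P.n₂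
                  ∷ ≤-trans (mul-mono K (wd (nb-sym U₀ m₀₂) m₂₄ m₂₅ 0≢4 0≢5 4≢5)) (≤-reflexive (sym qA))
                  ∷ ≤-trans (mul-mono K (wd (nb-sym (nb-U m₀₁) m₁₃) m₃₄ m₃₅ 1≢4 1≢5 4≢5)) (≤-reflexive (sym qB))
                  ∷ ≤-trans (mul-mono K (wd m₄p (nb-sym (nb-U m₀₂) m₂₄) (nb-sym (nb-U m₁₃) m₃₄) p≢2 p≢3 2≢3)) (≤-reflexive (sym qC))
                  ∷ ≤-trans (mul-mono K (wd m₅q (nb-sym (nb-U m₀₂) m₂₅) (nb-sym (nb-U m₁₃) m₃₅) q≢2 q≢3 2≢3)) (≤-reflexive (sym qD))
                  ∷ ≤-trans (mul-mono K (wdem-ks (_ , _ , _ , _ , _ , _ , _ , Q′))) R.n₁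
                  ∷ ≤-trans (mul-mono K (wdem-ks (_ , _ , _ , _ , _ , _ , _ , ks-swap Q′))) R.n₂
                  ∷ []

  -- Neighbourhoods as lists

  filter-cong : ∀ {P Q : I → Set} (P? : Decidable P) (Q? : Decidable Q) → (∀ x → P x → Q x) → (∀ x → Q x → P x) → ∀ xs → filter P? xs ≡ filter Q? xs
  filter-cong P? Q? f g [] = refl
  filter-cong P? Q? f g (x ∷ xs) with P? x | Q? x
  ... | yes _ | yes _ = cong (x ∷_) (filter-cong P? Q? f g xs)
  ... | no _ | no _ = filter-cong P? Q? f g xs
  ... | yes p | no q = ⊥-elim (q (f x p))
  ... | no p | yes q = ⊥-elim (p (g x q))

  filter² : ∀ {P Q S : I → Set} (P? : Decidable P) (Q? : Decidable Q) (S? : Decidable S) → (∀ x → P x → Q x × S x) → (∀ x → Q x → S x → P x) →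
            ∀ xs → filter P? xs ≡ filter Q? (filter S? xs)
  filter² P? Q? S? f g [] = refl
  filter² P? Q? S? f g (x ∷ xs) with P? x | S? x
  ... | yes p | no s = ⊥-elim (s (proj₂ (f x p)))
  ... | no p | no s = filter² P? Q? S? f g xs
  ... | yes p | yes s with Q? x
  ...   | yes _ = cong (x ∷_) (filter² P? Q? S? f g xs)
  ...   | no q = ⊥-elim (q (proj₁ (f x p)))
  filter² P? Q? S? f g (x ∷ xs) | no p | yes s with Q? x
  ... | yes q = ⊥-elim (p (g x q s))
  ... | no _ = filter² P? Q? S? f g xs

  nb-ext : ∀ {U x y} → (∀ w → w ∈ nb U x → w ∈ nb U y) → (∀ w → w ∈ nb U y → w ∈ nb U x) → nb U x ≡ nb U y
  nb-ext {U} {x} {y} f g = trans (nb-def U x) (trans (filter-cong (nb? U x) (nb? U y) (λ w e → go f e) (λ w e → go g e) all) (sym (nb-def U y)))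
    where
    go : ∀ {x y w} → (∀ w → w ∈ nb U x → w ∈ nb U y) → U w ∧ adj G x w ≡ true → U w ∧ adj G y w ≡ true
    go {x} {y} {w} h e with m ← h w (nb⁺ (proj₁ (∧-elim e)) (proj₂ (∧-elim {U w} e))) = ∧-intro (nb-U m) (nb-~ m)

  deg-sub-< : ∀ {U′ U z e} → (∀ w → U′ w ≡ true → U w ≡ true) → e ∈ nb U z → ¬ (U′ e ≡ true) → deg U′ z < deg U z
  deg-sub-< {U′} {U} {z} {e} h m k = ≤-trans (s≤s (deg-mono {U′} {minus U (e ∷ [])} g z)) (deg-< {U} {e ∷ []} m (here refl))
    where
    g : ∀ w → U′ w ≡ true → minus U (e ∷ []) w ≡ true
    g w u = minus⁺ {U} {e ∷ []} (h w u) λ { (here refl) → k u }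

  -- The slots of u, seen from v, are its neighbours other than v.
  oth? : (U : VSet) (v u w : V) → Dec ((U w ∧ adj G u w) ∧ not (does (w ≟ᵥ v)) ≡ true)
  oth? U v u w = ((U w ∧ adj G u w) ∧ not (does (w ≟ᵥ v))) Boolₚ.≟ true

  private
    ≢-does : ∀ {w v} → not (does (w ≟ᵥ v)) ≡ true → w ≢ v
    ≢-does {w} {v} e with w ≟ᵥ v
    ... | no h = h
    does-≢ : ∀ {w v} → w ≢ v → not (does (w ≟ᵥ v)) ≡ true
    does-≢ {w} {v} h with w ≟ᵥ v
    ... | yes e = ⊥-elim (h e)
    ... | no _ = refl

  abstract
    oth : VSet → V → V → List V
    oth U v u = filter (oth? U v u) all

    oth-def : ∀ U v u → oth U v u ≡ filter (oth? U v u) all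
    oth-def U v u = refl

    oth-nb : ∀ U v u → oth U v u ≡ filter (λ w → ¬? (w ≟ᵥ v)) (nb U u)
    oth-nb U v u = trans (filter² (oth? U v u) (λ w → ¬? (w ≟ᵥ v)) (nb? U u)
      (λ w e → ≢-does (proj₂ (∧-elim {U w ∧ adj G u w} e)) , proj₁ (∧-elim e)) (λ w h e → ∧-intro e (does-≢ h)) all)
      (cong (filter (λ w → ¬? (w ≟ᵥ v))) (sym (nb-def U u)))

  oth⁺ : ∀ {U v u w} → w ∈ nb U u → w ≢ v → w ∈ oth U v u
  oth⁺ {U} {v} {u} {w} m h = subst (w ∈_) (sym (oth-nb U v u)) (∈-filter⁺ (λ w → ¬? (w ≟ᵥ v)) m h)

  oth⁻ : ∀ {U v u w} → w ∈ oth U v u → w ∈ nb U u × w ≢ v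
  oth⁻ {U} {v} {u} {w} m = ∈-filter⁻ (λ w → ¬? (w ≟ᵥ v)) {xs = nb U u} (subst (w ∈_) (oth-nb U v u) m)

  remove-sum : ∀ (f : V → ℕ) {v} l → Unique l → v ∈ l → ΣL f l ≡ f v + ΣL f (filter (λ w → ¬? (w ≟ᵥ v)) l)
  remove-sum f {v} (x ∷ l) (h ∷ u) (here refl) with x ≟ᵥ x
  ... | no n = ⊥-elim (n refl)
  ... | yes _ = cong (λ l → f x + ΣL f l) (sym (filter-all (λ w → ¬? (w ≟ᵥ x)) (All.tabulate λ m e → All.lookup h m (sym e))))
  remove-sum f {v} (x ∷ l) (h ∷ u) (there m) with x ≟ᵥ v
  ... | yes refl = ⊥-elim (All.lookup h m refl)
  ... | no _ = trans (cong (f x +_) (remove-sum f l u m)) (go (f x) (f v) _)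
    where
    go : ∀ a b c → a + (b + c) ≡ b + (a + c)
    go a b c = trans (sym (+-assoc a b c)) (trans (cong (_+ c) (+-comm a b)) (+-assoc b a c))

  oth-sum : ∀ (f : V → ℕ) {U v u} → v ∈ nb U u → ΣL f (nb U u) ≡ f v + ΣL f (oth U v u)
  oth-sum f {U} {v} {u} m = trans (remove-sum f (nb U u) (nb-unique U u) m) (cong (λ l → f v + ΣL f l) (sym (oth-nb U v u)))

  oth-len : ∀ {U v u} → v ∈ nb U u → deg U u ≡ suc (length (oth U v u))
  oth-len {U} {v} {u} m = trans (length-ΣL (nb U u)) (trans (oth-sum (λ _ → 1) m) (cong suc (sym (length-ΣL (oth U v u)))))

  record Shape3 (U : VSet) (v u : V) : Set where
    field
      e₁ e₂ : V
      oth≡  : oth U v u ≡ e₁ ∷ e₂ ∷ []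
      m₁    : e₁ ∈ nb U u
      m₂    : e₂ ∈ nb U u
      n₁    : e₁ ≢ v
      n₂    : e₂ ≢ v
      e₁≢e₂ : e₁ ≢ e₂
      cover : Sub3 U u v e₁ e₂

  shape3 : ∀ {U v u} → v ∈ nb U u → deg U u ≡ 3 → Shape3 U v u
  shape3 {U} {v} {u} m d with oth U v u in eq | oth-len {U} {v} {u} m
  ... | [] | e with () ← trans (sym d) e
  ... | _ ∷ [] | e with () ← trans (sym d) e
  ... | _ ∷ _ ∷ _ ∷ _ | e with () ← trans (sym d) e
  ... | e₁ ∷ e₂ ∷ [] | e = record { e₁ = e₁ ; e₂ = e₂ ; oth≡ = eq ; m₁ = proj₁ (oth⁻ k₁) ; m₂ = proj₁ (oth⁻ k₂)
      ; n₁ = proj₂ (oth⁻ k₁) ; n₂ = proj₂ (oth⁻ k₂)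
      ; e₁≢e₂ = ne ; cover = cov }
    where
    k₁ : e₁ ∈ oth U v u
    k₁ = subst (e₁ ∈_) (sym eq) (here refl)
    k₂ : e₂ ∈ oth U v u
    k₂ = subst (e₂ ∈_) (sym eq) (there (here refl))
    ne : e₁ ≢ e₂
    ne with subst Unique (trans (sym (oth-nb U v u)) eq) (Uₚ.filter⁺ (λ w → ¬? (w ≟ᵥ v)) (nb-unique U u))
    ... | (h ∷ _) ∷ _ = h
    cov : Sub3 U u v e₁ e₂
    cov w k with w ≟ᵥ v
    ... | yes e = inj₁ e
    ... | no h with subst (w ∈_) eq (oth⁺ k h)
    ...   | here e = inj₂ (inj₁ e)
    ...   | there (here e) = inj₂ (inj₂ e)

  record Shape2 (U : VSet) (v u : V) : Set where
    field
      e₁    : V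
      oth≡  : oth U v u ≡ e₁ ∷ []
      m₁    : e₁ ∈ nb U u
      n₁    : e₁ ≢ v
      cover : Sub2 U u v e₁

  shape2 : ∀ {U v u} → v ∈ nb U u → deg U u ≡ 2 → Shape2 U v u
  shape2 {U} {v} {u} m d with oth U v u in eq | oth-len {U} {v} {u} m
  ... | [] | e with () ← trans (sym d) e
  ... | _ ∷ _ ∷ _ | e with () ← trans (sym d) e
  ... | e₁ ∷ [] | e = record { e₁ = e₁ ; oth≡ = eq ; m₁ = proj₁ (oth⁻ k₁) ; n₁ = proj₂ (oth⁻ k₁) ; cover = cov }
    where
    k₁ : e₁ ∈ oth U v u
    k₁ = subst (e₁ ∈_) (sym eq) (here refl)
    cov : Sub2 U u v e₁
    cov w k with w ≟ᵥ v
    ... | yes e = inj₁ e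
    ... | no h with subst (w ∈_) eq (oth⁺ k h)
    ...   | here e = inj₂ e

  -- Averaging over a random vertex

  module Avg (U : VSet) (mindeg : ∀ v → U v ≡ true → 2 ≤ deg U v) where

    abstract
      -- The factor `U x` empties `R x` for `x` outside `U`, so that the induction hypothesis
      -- applies to every `x`; such `x` have weight zero.
      R : V → VSet
      R x w = U x ∧ (U w ∧ (not (does (w ≟ᵥ x)) ∧ not (adj G x w)))

      R⁺ : ∀ {x w} → U x ≡ true → U w ≡ true → w ≢ x → ¬ (x ~ w) → R x w ≡ true
      R⁺ a b c d = ∧-intro a (∧-intro b (∧-intro (does-≢ c) (true-not d)))

      R-U : ∀ {x w} → R x w ≡ true → U w ≡ true
      R-U {x} {w} e = proj₁ (∧-elim (proj₂ (∧-elim {U x} e)))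

      R-Ux : ∀ {x w} → R x w ≡ true → U x ≡ true
      R-Ux e = proj₁ (∧-elim e)

      R-≢ : ∀ {x w} → R x w ≡ true → w ≢ x
      R-≢ {x} {w} e = ≢-does (proj₁ (∧-elim (proj₂ (∧-elim {U w} (proj₂ (∧-elim {U x} e))))))

      R-~ : ∀ x w → R x w ≡ true → x ~ w → ⊥
      R-~ x w e = not-true (proj₂ (∧-elim {not (does (w ≟ᵥ x))} (proj₂ (∧-elim {U w} (proj₂ (∧-elim {U x} e))))))

    R-up : ∀ {x z w} → w ∈ nb (R x) z → w ∈ nb U z
    R-up {x} m = nb⁺ (R-U (nb-U m)) (nb-~ m)

    R-n~ : ∀ {x z w} → w ∈ nb (R x) z → x ~ w → ⊥
    R-n~ {x} {z} {w} m = R-~ x w (nb-U m)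

    R-nb⁺ : ∀ {x z w} → U x ≡ true → w ∈ nb U z → w ≢ x → ¬ (x ~ w) → w ∈ nb (R x) z
    R-nb⁺ a m h k = nb⁺ (R⁺ a (nb-U m) h k) (nb-~ m)

    R-lost : ∀ {x z w} → U x ≡ true → R x z ≡ true → w ∈ nb U z → ¬ (w ∈ nb (R x) z) → x ~ w
    R-lost {x} {z} {w} Ux Rz m h with adj G x w in eq
    ... | true = refl
    ... | false = ⊥-elim (h (R-nb⁺ Ux m (λ { refl → R-~ w z Rz (~-sym (nb-~ m)) }) (λ e → f (trans (sym eq) e))))
      where
      f : false ≡ true → ⊥
      f ()

    nbR : ∀ {x v} → U x ≡ true → ¬ (x ~ v) → nb (R x) v ≡ filter (λ w → adj G x w Boolₚ.≟ false) (nb U v)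
    nbR {x} {v} Ux h = trans (nb-def (R x) v) (trans (filter² (nb? (R x) v) (λ w → adj G x w Boolₚ.≟ false) (nb? U v)
        (λ w e → fls (R-~ x w (proj₁ (∧-elim e))) , ∧-intro (R-U (proj₁ (∧-elim e))) (proj₂ (∧-elim {R x w} e)))
        (λ w e e′ → ∧-intro (R⁺ Ux (proj₁ (∧-elim e′)) (λ { refl → h (~-sym (proj₂ (∧-elim {U w} e′))) }) (λ k → tr e k)) (proj₂ (∧-elim {U w} e′))) all)
        (cong (filter (λ w → adj G x w Boolₚ.≟ false)) (sym (nb-def U v))))
      where
      fls : ∀ {b} → (b ≡ true → ⊥) → b ≡ false
      fls {true} h = ⊥-elim (h refl)
      fls {false} h = refl
      tr : ∀ {b} → b ≡ false → b ≡ true → ⊥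
      tr refl ()

    t : V → ℕ
    t y = b2n (deg U y ≡ᵇ 2)

    t≤1 : ∀ y → t y ≤ 1
    t≤1 y with deg U y ≡ᵇ 2
    ... | true = ≤-refl
    ... | false = z≤n

    t-2 : ∀ {y} → deg U y ≡ 2 → t y ≡ 1
    t-2 e rewrite e = refl

    t-3 : ∀ {y} → deg U y ≡ 3 → t y ≡ 0
    t-3 e rewrite e = refl

    deg23 : ∀ {y} → U y ≡ true → deg U y ≡ 2 ⊎ deg U y ≡ 3
    deg23 {y} Uy with deg U y | mindeg y Uy | deg≤3 U y
    ... | 0 | () | _
    ... | 1 | s≤s () | _
    ... | 2 | _ | _ = inj₁ refl
    ... | 3 | _ | _ = inj₂ refl
    ... | suc (suc (suc (suc _))) | _ | s≤s (s≤s (s≤s ()))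

    Σt≤ : ∀ l → ΣL t l ≤ length l
    Σt≤ [] = z≤n
    Σt≤ (x ∷ l) = +-mono-≤ (t≤1 x) (Σt≤ l)

    Σt≤₁ : ∀ {l y} → y ∈ l → t y ≡ 0 → suc (ΣL t l) ≤ length l
    Σt≤₁ {x ∷ l} (here refl) e rewrite e = s≤s (Σt≤ l)
    Σt≤₁ {x ∷ l} (there m) e = ≤-trans (≤-reflexive (sym (+-suc (t x) _))) (+-mono-≤ (t≤1 x) (Σt≤₁ m e))

    Σt≤₂ : ∀ {l y z} → y ∈ l → z ∈ l → y ≢ z → t y ≡ 0 → t z ≡ 0 → suc (suc (ΣL t l)) ≤ length l
    Σt≤₂ (here refl) (here refl) h _ _ = ⊥-elim (h refl)
    Σt≤₂ {x ∷ l} (here refl) (there m) h e f rewrite e = s≤s (Σt≤₁ m f)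
    Σt≤₂ {x ∷ l} (there m) (here refl) h e f rewrite f = s≤s (Σt≤₁ m e)
    Σt≤₂ {x ∷ l} (there m) (there m′) h e f = ≤-trans (≤-reflexive (sym (trans (+-suc (t x) _) (cong suc (+-suc (t x) _))))) (+-mono-≤ (t≤1 x) (Σt≤₂ m m′ h e f))

    Σt≤₃ : ∀ {l y z w} → y ∈ l → z ∈ l → w ∈ l → y ≢ z → y ≢ w → z ≢ w → t y ≡ 0 → t z ≡ 0 → t w ≡ 0 → 3 + ΣL t l ≤ length l
    Σt≤₃ (here refl) (here refl) _ h _ _ _ _ _ = ⊥-elim (h refl)
    Σt≤₃ (here refl) _ (here refl) _ h _ _ _ _ = ⊥-elim (h refl)
    Σt≤₃ _ (here refl) (here refl) _ _ h _ _ _ = ⊥-elim (h refl)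
    Σt≤₃ {x ∷ l} (here refl) (there m) (there m′) _ _ h e f g rewrite e = s≤s (Σt≤₂ m m′ h f g)
    Σt≤₃ {x ∷ l} (there m) (here refl) (there m′) _ h _ e f g rewrite f = s≤s (Σt≤₂ m m′ h e g)
    Σt≤₃ {x ∷ l} (there m) (there m′) (here refl) h _ _ e f g rewrite g = s≤s (Σt≤₂ m m′ h e f)
    Σt≤₃ {x ∷ l} (there m) (there m′) (there m″) h h′ h″ e f g =
      ≤-trans (≤-reflexive (sym (trans (+-suc (t x) _) (cong suc (trans (+-suc (t x) _) (cong suc (+-suc (t x) _))))))) (+-mono-≤ (t≤1 x) (Σt≤₃ m m′ m″ h h′ h″ e f g))

    abstract
      -- The weights of the random vertex x; they solve the linear program given by the local configurations.
      p : V → ℕ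
      p x = if U x then (if deg U x ≡ᵇ 2 then 655 else 1000 ∸ ΣL t (nb U x) * 52) else 0

      p-0 : ∀ {x} → U x ≡ false → p x ≡ 0
      p-0 e rewrite e = refl

      p-2 : ∀ {x} → U x ≡ true → deg U x ≡ 2 → p x ≡ 655
      p-2 e f rewrite e | f = refl

      p-3 : ∀ {x} → U x ≡ true → deg U x ≡ 3 → p x + ΣL t (nb U x) * 52 ≡ 1000
      p-3 {x} e f with Σt≤ (nb U x)
      ... | h rewrite e | f = m∸n+n≡m (≤-trans (*-monoˡ-≤ 52 h) (≤ᵇ⇒≤ 156 1000 _))

    p≥ : ∀ {x} k → U x ≡ true → deg U x ≡ 3 → ΣL t (nb U x) ≤ k → ∀ {m} → m + k * 52 ≤ 1000 → m ≤ p x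
    p≥ {x} k e f h {m} h′ = +-cancelʳ-≤ (ΣL t (nb U x) * 52) m (p x) (≤-trans (+-monoʳ-≤ m (*-monoˡ-≤ 52 h)) (≤-trans h′ (≤-reflexive (sym (p-3 e f)))))

    p≥655 : ∀ {x} → U x ≡ true → 655 ≤ p x
    p≥655 {x} e with deg23 e
    ... | inj₁ d = ≤-reflexive (sym (p-2 e d))
    ... | inj₂ d = p≥ 3 e d (≤-trans (Σt≤ (nb U x)) (≤-reflexive d)) {655} (≤ᵇ⇒≤ 811 1000 _)

    p≤1000 : ∀ x → p x ≤ 1000
    p≤1000 x with U x in e
    ... | false = ≤-trans (≤-reflexive (p-0 e)) z≤n
    ... | true with deg23 e
    ...   | inj₁ d = ≤-trans (≤-reflexive (p-2 e d)) (≤ᵇ⇒≤ 655 1000 _)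
    ...   | inj₂ d = ≤-trans (m≤m+n _ _) (≤-reflexive (p-3 e d))

    ΣP : ℕ
    ΣP = ΣL p all

    -- X x bounds the surplus of v over d when x is chosen, and Y x the deficit.
    master : ∀ v d (X Y : V → ℕ) → (∀ x → U x ≡ true → X x + d ≤ valAt R x v + Y x) →
             ΣL (λ x → p x * Y x) all ≤ ΣL (λ x → p x * X x) all → ΣP * d ≤ ΣL (λ x → p x * valAt R x v) all
    master v d X Y h k = +-cancelʳ-≤ (ΣL (λ x → p x * X x) all) (ΣP * d) _ (begin
        ΣP * d + ΣL (λ x → p x * X x) all ≡⟨ cong (_+ ΣL (λ x → p x * X x) all) (sym (ΣL-* p d all)) ⟩
        ΣL (λ x → p x * d) all + ΣL (λ x → p x * X x) all ≡⟨ +-comm (ΣL (λ x → p x * d) all) _ ⟩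
        ΣL (λ x → p x * X x) all + ΣL (λ x → p x * d) all ≡⟨ sym (ΣL-+ (λ x → p x * X x) (λ x → p x * d) all) ⟩
        ΣL (λ x → p x * X x + p x * d) all ≤⟨ ΣL-mono all (λ x _ → pt x) ⟩
        ΣL (λ x → p x * valAt R x v + p x * Y x) all ≡⟨ ΣL-+ (λ x → p x * valAt R x v) (λ x → p x * Y x) all ⟩
        ΣL (λ x → p x * valAt R x v) all + ΣL (λ x → p x * Y x) all ≤⟨ +-monoʳ-≤ _ k ⟩
        ΣL (λ x → p x * valAt R x v) all + ΣL (λ x → p x * X x) all ∎)
      where
      open ≤-Reasoning
      pt : ∀ x → p x * X x + p x * d ≤ p x * valAt R x v + p x * Y x
      pt x with U x in e
      ... | false rewrite p-0 e = z≤n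
      ... | true = ≤-trans (≤-reflexive (sym (*-distribˡ-+ (p x) (X x) d))) (≤-trans (*-monoʳ-≤ (p x) (h x e)) (≤-reflexive (*-distribˡ-+ (p x) _ (Y x))))

    o : V → V → V → ℕ
    o v u x = b2n (does (oth? U v u x))

    o-1 : ∀ {v u x} → U x ≡ true → u ~ x → x ≢ v → o v u x ≡ 1
    o-1 {v} {u} {x} a b c with oth? U v u x
    ... | yes _ = refl
    ... | no h = ⊥-elim (h (∧-intro (∧-intro a b) (does-≢ c)))

    o-0 : ∀ {v u x} → ¬ (u ~ x) → o v u x ≡ 0
    o-0 {v} {u} {x} b with oth? U v u x
    ... | yes e = ⊥-elim (b (proj₂ (∧-elim {U x} (proj₁ (∧-elim {U x ∧ adj G u x} e)))))
    ... | no _ = refl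

    o-v : ∀ v u → o v u v ≡ 0
    o-v v u with oth? U v u v
    ... | yes e = ⊥-elim (≢-does {v} {v} (proj₂ (∧-elim {U v ∧ adj G u v} e)) refl)
    ... | no _ = refl

    Σo : ∀ v u (f : V → ℕ) → ΣL (λ x → p x * (o v u x * f x)) all ≡ ΣL (λ x → p x * f x) (oth U v u)
    Σo v u f = trans (ΣL-cong all (λ x _ → sym (*-shift (p x) (f x) (o v u x)))) (trans (ΣL-filter (λ x → p x * f x) (oth? U v u) all) (cong (ΣL _) (sym (oth-def U v u))))

    -- Double counting: a sum over the random vertex `x` becomes a sum over the paths `v u x`.
    Σslots : ∀ v (us : List V) (f : V → ℕ) → ΣL (λ x → p x * ΣL (λ u → o v u x * f x) us) all ≡ ΣL (λ u → ΣL (λ x → p x * f x) (oth U v u)) us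
    Σslots v us f = trans (ΣL-cong all (λ x _ → dist (p x) (λ u → o v u x * f x) us)) (trans (ΣL-swap (λ x u → p x * (o v u x * f x)) all us) (ΣL-cong us (λ u _ → Σo v u f)))
      where
      dist : ∀ a (g : V → ℕ) us → a * ΣL g us ≡ ΣL (λ u → a * g u) us
      dist a g [] = *-zeroʳ a
      dist a g (u ∷ us) = trans (*-distribˡ-+ a (g u) (ΣL g us)) (cong (a * g u +_) (dist a g us))

    nbi : V → V → ℕ
    nbi v x = b2n (does (nb? U v x))

    Σnb : ∀ v c → ΣL (λ x → p x * (nbi v x * c)) all ≡ ΣL (λ u → p u * c) (nb U v)
    Σnb v c = trans (ΣL-cong all (λ x _ → sym (*-shift (p x) c (nbi v x)))) (trans (ΣL-filter (λ x → p x * c) (nb? U v) all) (cong (ΣL _) (sym (nb-def U v))))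

    nbi-1 : ∀ {v x} → U x ≡ true → v ~ x → nbi v x ≡ 1
    nbi-1 {v} {x} a b with nb? U v x
    ... | yes _ = refl
    ... | no h = ⊥-elim (h (∧-intro a b))

    is : V → V → ℕ → ℕ
    is v x c = if does (x ≟ᵥ v) then c else 0

    Σis : ∀ v c → p v * c ≤ ΣL (λ x → p x * is v x c) all
    Σis v c = ≤-trans (≤-reflexive (cong (p v *_) (sym isv))) (ΣL-∈ (λ x → p x * is v x c) all (∈-allFin v))
      where
      isv : is v v c ≡ c
      isv with v ≟ᵥ v
      ... | yes _ = refl
      ... | no h = ⊥-elim (h refl)

    is-v : ∀ {v x c} → x ≡ v → is v x c ≡ c
    is-v {v} {x} e with x ≟ᵥ v
    ... | yes _ = refl
    ... | no h = ⊥-elim (h e)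

    is-n : ∀ {v x c} → x ≢ v → is v x c ≡ 0
    is-n {v} {x} h with x ≟ᵥ v
    ... | yes e = ⊥-elim (h e)
    ... | no _ = refl

    valAt-v : ∀ v → valAt R v v ≡ 2520
    valAt-v v with v ≟ᵥ v
    ... | yes _ = refl
    ... | no h = ⊥-elim (h refl)

    valAt-R : ∀ {v x} → x ≢ v → R x v ≡ true → valAt R x v ≡ dem (R x) v
    valAt-R {v} {x} h e with v ≟ᵥ x
    ... | yes k = ⊥-elim (h (sym k))
    ... | no _ rewrite e = refl

    o-adj : ∀ {v u x} → U x ≡ true → x ≢ v → o v u x ≡ b2n (adj G x u)
    o-adj {v} {u} {x} a b with adj G x u in e
    ... | true = o-1 a (~-sym e) b
    ... | false = o-0 (λ k → f (trans (sym e) (~-sym k)))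
      where
      f : false ≡ true → ⊥
      f ()

  -- Choices that leave a vertex of degree three in C₅

  _~?_ : (u w : V) → Dec (u ~ w)
  u ~? w = adj G u w Boolₚ.≟ true

  -- The aim is `noThree`. Since no 4-cycle passes through `v`, a bad `x` behind `i` takes only `i`
  -- away from `v`, and the C₅ runs through the other two neighbours. Every edge that leaves this
  -- cycle was cut by `x`, so it leads to a neighbour of `x`. The cycles of three bad vertices
  -- contradict each other or the degree bound.
  module NoThree (U : VSet) (mindeg : ∀ v → U v ≡ true → 2 ≤ deg U v) (v : V) (Uv : U v ≡ true) (d3 : deg U v ≡ 3)
    (noC4 : ∀ {s i j} → U s ≡ true → s ≢ v → i ∈ nb U v → j ∈ nb U v → i ≢ j → i ~ s → j ~ s → ⊥) where
    open Avg U mindeg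

    record BadAt (i x : V) : Set where
      constructor badAt
      field
        iv : i ∈ nb U v
        xi : x ∈ nb U i
        x≢v : x ≢ v
        c5 : C5at (R x) v

    -- The 5-cycle `v j f g k` left by `x`.
    record Fx (j k x : V) : Set where
      field
        f g : V
        fj  : f ∈ nb U j
        gk  : g ∈ nb U k
        fg  : f ~ g
        f≢v : f ≢ v
        g≢v : g ≢ v
        xf  : ¬ (x ~ f)
        xg  : ¬ (x ~ g)
        cj  : ∀ w → w ∈ nb U j → w ≡ v ⊎ w ≡ f ⊎ x ~ w
        ck  : ∀ w → w ∈ nb U k → w ≡ v ⊎ w ≡ g ⊎ x ~ w
        cf  : ∀ w → w ∈ nb U f → w ≡ j ⊎ w ≡ g ⊎ x ~ w
        cg  : ∀ w → w ∈ nb U g → w ≡ k ⊎ w ≡ f ⊎ x ~ w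

    private
      cl : ∀ {x z a b} → U x ≡ true → R x z ≡ true → Sub2 (R x) z a b → ∀ w → w ∈ nb U z → w ≡ a ⊎ w ≡ b ⊎ x ~ w
      cl {x} {z} Ux Rz S w m with w ∈? nb (R x) z
      ... | no h = inj₂ (inj₂ (R-lost Ux Rz m h))
      ... | yes k with S w k
      ...   | inj₁ e = inj₁ e
      ...   | inj₂ e = inj₂ (inj₁ e)

      mk : ∀ {x a b c d} → U x ≡ true → IsPend (R x) v a b c d → Fx a b x
      mk {x} Ux P = record { f = _ ; g = _ ; fj = R-up ac ; gk = R-up bd ; fg = nb-~ cd ; f≢v = s≢ v≢c ; g≢v = s≢ v≢d
        ; xf = R-n~ ac ; xg = R-n~ bd
        ; cj = cl Ux (nb-U va) Sa ; ck = cl Ux (nb-U vb) Sb ; cf = cl Ux (nb-U ac) Sc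
        ; cg = λ w m → cl Ux (nb-U bd) (λ w m → Sd w m) w m }
        where
        open IsPend P
        open Pend≢ (pend≢ P)

      v~ : ∀ {i} → i ∈ nb U v → v ~ i
      v~ = nb-~

      nadj : ∀ {i j} → i ∈ nb U v → j ∈ nb U v → i ~ j → ⊥
      nadj a b e = tri (v~ a) e (v~ b)

    fx : ∀ {i j k x} → BadAt i x → j ∈ nb U v → k ∈ nb U v → i ≢ j → i ≢ k → j ≢ k → Fx j k x
    fx {i} {j} {k} {x} (badAt iv xi x≢v (a , b , c , d , P , S)) jv kv ij ik jk
      with S j (r jv ij) | S k (r kv ik)
      where
      Ux : U x ≡ true
      Ux = nb-U xi
      r : ∀ {y} → y ∈ nb U v → i ≢ y → y ∈ nb (R x) v
      r {y} m ne = R-nb⁺ Ux m (λ { refl → nadj iv m (nb-~ xi) }) (λ e → noC4 Ux x≢v iv m ne (nb-~ xi) (~-sym e))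
    ... | inj₁ refl | inj₂ refl = mk (nb-U xi) P
    ... | inj₂ refl | inj₁ refl = mk (nb-U xi) (pend-mirror P)
    ... | inj₁ refl | inj₁ e = ⊥-elim (jk (sym e))
    ... | inj₂ refl | inj₂ e = ⊥-elim (jk (sym e))

    -- The bad vertices `x` behind `p` and `y` behind `q` are adjacent. Their cycles meet the third
    -- neighbour `r` of `v` in different vertices `f₃` and `g₃`, which fixes the neighbourhoods:
    -- `q`, `x`, `f₃` for `y` and `p`, `y`, `g₃` for `x`. This leaves no place for a third bad
    -- vertex.
    module Adj {p q r x y : V} (X : BadAt p x) (Y : BadAt q y) (rv : r ∈ nb U v) (pq : p ≢ q) (pr : p ≢ r) (qr : q ≢ r) (xy : x ~ y)
      (Fx₁ : Fx q r x) (Fx₂ : Fx p r y) where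
      private
        pv = BadAt.iv X
        qv = BadAt.iv Y
        xp = BadAt.xi X
        yq = BadAt.xi Y
        x≢v = BadAt.x≢v X
        y≢v = BadAt.x≢v Y
        module F = Fx Fx₁
        module H = Fx Fx₂
      f₂ = F.f
      f₃ = F.g
      g₁ = H.f
      g₃ = H.g
      sl : ∀ {i j s s′} → i ∈ nb U v → j ∈ nb U v → i ≢ j → s ∈ nb U i → s′ ∈ nb U j → s ≢ v → s ≢ s′
      sl iv jv ne m m′ sv refl = noC4 (nb-U m) sv iv jv ne (nb-~ m) (nb-~ m′)
      sn : ∀ {i j s} → i ∈ nb U v → j ∈ nb U v → s ∈ nb U i → s ≢ j
      sn iv jv m refl = nadj iv jv (nb-~ m)
      x≁g₁ : ¬ (x ~ g₁)
      x≁g₁ e = tri (nb-~ xp) e (nb-~ H.fj)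
      f₃≁g₁ : ¬ (f₃ ~ g₁)
      f₃≁g₁ e with F.cg g₁ (nb⁺ (nb-U H.fj) e)
      ... | inj₁ e′ = sn pv rv H.fj e′
      ... | inj₂ (inj₁ e′) = sl pv qv pq H.fj F.fj H.f≢v e′
      ... | inj₂ (inj₂ e′) = x≁g₁ e′
      g₃≢f₃ : g₃ ≢ f₃
      g₃≢f₃ e = f₃≁g₁ (subst (_~ g₁) e (~-sym H.fg))
      xg₃ : x ~ g₃
      xg₃ with F.ck g₃ H.gk
      ... | inj₁ e = ⊥-elim (H.g≢v e)
      ... | inj₂ (inj₁ e) = ⊥-elim (g₃≢f₃ e)
      ... | inj₂ (inj₂ e) = e
      yf₃ : y ~ f₃
      yf₃ with H.ck f₃ F.gk
      ... | inj₁ e = ⊥-elim (F.g≢v e)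
      ... | inj₂ (inj₁ e) = ⊥-elim (g₃≢f₃ (sym e))
      ... | inj₂ (inj₂ e) = e
      x≢g₁ : x ≢ g₁
      x≢g₁ e = H.xf (subst (y ~_) e (~-sym xy))
      nby : ∀ {w} → w ∈ nb U y → w ≡ q ⊎ w ≡ x ⊎ w ≡ f₃
      nby {w} m with w ≟ᵥ q | w ≟ᵥ x | w ≟ᵥ f₃
      ... | yes e | _ | _ = inj₁ e
      ... | no _ | yes e | _ = inj₂ (inj₁ e)
      ... | no _ | no _ | yes e = inj₂ (inj₂ e)
      ... | no h₁ | no h₂ | no h₃ = ⊥-elim (no4 (nb-sym (nb-U qv) yq) (nb⁺ (nb-U xp) (~-sym xy)) (nb⁺ (nb-U F.gk) yf₃) m
          (s≢ (sn pv qv xp)) (s≢ (sn rv qv F.gk)) (sl pv rv pr xp F.gk x≢v) (s≢ h₁) (s≢ h₂) (s≢ h₃))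

      third-r-f : ∀ {z} → BadAt r z → z ≡ f₃ → ⊥
      third-r-f {z} Z refl = f₃≁g₁ zg₁
        where
        module K = Fx (fx Z pv qv (s≢ pr) (s≢ qr) pq)
        x≡k : x ≡ K.f
        x≡k with K.cj x xp
        ... | inj₁ e = ⊥-elim (x≢v e)
        ... | inj₂ (inj₁ e) = e
        ... | inj₂ (inj₂ e) = ⊥-elim (F.xg (~-sym e))
        zg₁ : f₃ ~ g₁
        zg₁ with K.cj g₁ H.fj
        ... | inj₁ e = ⊥-elim (H.f≢v e)
        ... | inj₂ (inj₁ e) = ⊥-elim (x≢g₁ (trans x≡k (sym e)))
        ... | inj₂ (inj₂ e) = e

      third-p : ∀ {z} → BadAt p z → z ≢ x → ⊥
      third-p {z} Z z≢x with H.cj z (BadAt.xi Z)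
      ... | inj₁ e = BadAt.x≢v Z e
      ... | inj₂ (inj₂ yz) with nby (nb⁺ (nb-U (BadAt.xi Z)) yz)
      ...   | inj₁ e = sn pv qv (BadAt.xi Z) e
      ...   | inj₂ (inj₁ e) = z≢x e
      ...   | inj₂ (inj₂ e) = sl pv rv pr (BadAt.xi Z) F.gk (BadAt.x≢v Z) e
      third-p {z} Z z≢x | inj₂ (inj₁ refl) = bad
        where
        module K = Fx (fx Z qv rv pq pr qr)
        y≡k : y ≡ K.f
        y≡k with K.cj y yq
        ... | inj₁ e = ⊥-elim (y≢v e)
        ... | inj₂ (inj₁ e) = e
        ... | inj₂ (inj₂ e) = ⊥-elim (H.xf (~-sym e))
        k₃≡f₃ : K.g ≡ f₃
        k₃≡f₃ with nby (nb⁺ (nb-U K.gk) (subst (_~ K.g) (sym y≡k) K.fg))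
        ... | inj₁ e = ⊥-elim (sn rv qv K.gk e)
        ... | inj₂ (inj₁ e) = ⊥-elim (sl rv pv (s≢ pr) K.gk xp K.g≢v e)
        ... | inj₂ (inj₂ e) = e
        zf₂ : g₁ ~ f₂
        zf₂ with K.cg f₂ (subst (λ w → f₂ ∈ nb U w) (sym k₃≡f₃) (nb⁺ (nb-U F.fj) (~-sym F.fg)))
        ... | inj₁ e = ⊥-elim (sn qv rv F.fj e)
        ... | inj₂ (inj₁ e) = ⊥-elim (F.xf (subst (x ~_) (trans y≡k (sym e)) xy))
        ... | inj₂ (inj₂ e) = e
        bad : ⊥
        bad with F.cf g₁ (nb⁺ (nb-U H.fj) (~-sym zf₂))
        ... | inj₁ e = sn pv qv H.fj e
        ... | inj₂ (inj₁ e) = sl pv rv pr H.fj F.gk H.f≢v e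
        ... | inj₂ (inj₂ e) = x≁g₁ e

      third-r : (∀ {z} → BadAt r z → z ≡ g₃ → ⊥) → ∀ {z} → BadAt r z → ⊥
      third-r h {z} Z with F.ck z (BadAt.xi Z)
      ... | inj₁ e = BadAt.x≢v Z e
      ... | inj₂ (inj₁ e) = third-r-f Z e
      ... | inj₂ (inj₂ xz) with z ≟ᵥ g₃
      ...   | yes e = h Z e
      ...   | no ne = no4 (nb-sym (nb-U pv) xp) (nb⁺ (nb-U yq) xy) (nb⁺ (nb-U H.gk) xg₃) (nb⁺ (nb-U (BadAt.xi Z)) xz)
          (s≢ (sn qv pv yq)) (s≢ (sn rv pv H.gk)) (sl qv rv qr yq H.gk y≢v) (s≢ (sn rv pv (BadAt.xi Z)))
          (sl qv rv qr yq (BadAt.xi Z) y≢v) (s≢ ne)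

    -- A third bad vertex behind `r` could only be `f₃` or `g₃`, and these change places when `x`
    -- and `y` do.
    adj-r : ∀ {p q r x y z} → BadAt p x → BadAt q y → BadAt r z → p ≢ q → p ≢ r → q ≢ r → x ~ y → ⊥
    adj-r {p} {q} {r} {x} {y} X Y Z pq pr qr xy = A.third-r (λ Z′ e → B.third-r-f Z′ e) Z
      where
      F = fx X (BadAt.iv Y) (BadAt.iv Z) pq pr qr
      H = fx Y (BadAt.iv X) (BadAt.iv Z) (s≢ pq) qr pr
      module A = Adj X Y (BadAt.iv Z) pq pr qr xy F H
      module B = Adj Y X (BadAt.iv Z) (s≢ pq) qr pr (~-sym xy) H F

    twoSame : ∀ {p q x z y} → BadAt p x → BadAt p z → BadAt q y → p ≢ q → x ≢ z → ⊥
    twoSame {p} {q} {x} {z} {y} X Z Y pq xz with thirdOf {a = p} {q} (nb-unique U v) (≤-reflexive (sym d3))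
    ... | r , rv , rp , rq with x ~? y | z ~? y
    ...   | yes e | _ = Adj.third-p X Y rv pq (s≢ rp) (s≢ rq) e (fx X (BadAt.iv Y) rv pq (s≢ rp) (s≢ rq)) (fx Y (BadAt.iv X) rv (s≢ pq) (s≢ rq) (s≢ rp)) Z (s≢ xz)
    ...   | no _ | yes e = Adj.third-p Z Y rv pq (s≢ rp) (s≢ rq) e (fx Z (BadAt.iv Y) rv pq (s≢ rp) (s≢ rq)) (fx Y (BadAt.iv Z) rv (s≢ pq) (s≢ rq) (s≢ rp)) X xz
    -- If neither is adjacent to `y`, both are the one vertex `f` behind `p` on the cycle left by
    -- `y`.
    ...   | no h | no h′ with Fx.cj H x (BadAt.xi X) | Fx.cj H z (BadAt.xi Z)
      where
      H : Fx p r y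
      H = fx Y (BadAt.iv X) rv (s≢ pq) (s≢ rq) (s≢ rp)
    ...     | inj₁ e | _ = BadAt.x≢v X e
    ...     | inj₂ (inj₂ e) | _ = h (~-sym e)
    ...     | inj₂ (inj₁ _) | inj₁ e = BadAt.x≢v Z e
    ...     | inj₂ (inj₁ _) | inj₂ (inj₂ e) = h′ (~-sym e)
    ...     | inj₂ (inj₁ e) | inj₂ (inj₁ e′) = xz (trans e (sym e′))

    allDiff : ∀ {p q r x y z} → BadAt p x → BadAt q y → BadAt r z → p ≢ q → p ≢ r → q ≢ r → ⊥
    allDiff {x = x} {y} {z} X Y Z pq pr qr with x ~? y | x ~? z | y ~? z
    ... | yes e | _ | _ = adj-r X Y Z pq pr qr e
    ... | no _ | yes e | _ = adj-r X Z Y pr pq (s≢ qr) e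
    ... | no _ | no _ | yes e = adj-r Y Z X qr (s≢ pq) (s≢ pr) e
    -- Without adjacencies `y` and `z` are the vertices `f` and `g` of the cycle left by `x`, which
    -- are adjacent.
    ... | no h | no h′ | no h″ with fx X (BadAt.iv Y) (BadAt.iv Z) pq pr qr
    ...   | F with Fx.cj F y (BadAt.xi Y) | Fx.ck F z (BadAt.xi Z)
    ...     | inj₁ e | _ = BadAt.x≢v Y e
    ...     | inj₂ (inj₂ e) | _ = h e
    ...     | inj₂ (inj₁ _) | inj₁ e = BadAt.x≢v Z e
    ...     | inj₂ (inj₁ _) | inj₂ (inj₂ e) = h′ e
    ...     | inj₂ (inj₁ refl) | inj₂ (inj₁ refl) = h″ (Fx.fg F)

    noThree : ∀ {i j k x y z} → BadAt i x → BadAt j y → BadAt k z → x ≢ y → x ≢ z → y ≢ z → ⊥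
    noThree {i} {j} {k} X Y Z xy xz yz with i ≟ᵥ j | i ≟ᵥ k | j ≟ᵥ k
    ... | no a | no b | no c = allDiff X Y Z a b c
    ... | yes refl | no b | _ = twoSame X Y Z b xy
    ... | no a | yes refl | _ = twoSame X Z Y a xz
    ... | no a | no b | yes refl = twoSame Y Z X (s≢ a) yz
    ... | yes refl | yes refl | _ = no4 (nb-sym Uv (BadAt.iv X)) (BadAt.xi X) (BadAt.xi Y) (BadAt.xi Z)
          (s≢ (BadAt.x≢v X)) (s≢ (BadAt.x≢v Y)) xy (s≢ (BadAt.x≢v Z)) xz yz

  -- Vertices of degree three

  -- What becomes of `v` in `R x`. In the classes `k2` and `c4` at most one neighbour of `v`
  -- remains, so a slot `x` of such a class lies on a 4-cycle with `v`.
  data Cls : Set where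
    c5 ks ok k2 c4 : Cls

  clsBy : ℕ → Bool → Bool → Bool → Cls
  clsBy 0 _ _ _ = c4
  clsBy 1 true _ _ = k2
  clsBy 1 false _ _ = c4
  clsBy 2 _ true _ = c5
  clsBy 2 _ false true = ks
  clsBy _ _ _ _ = ok

  -- A vertex v of degree three that is left in class c gains at least wt c over 860 per neighbour deleted. The credit cr c
  -- is what a slot of class c contributes beyond its own cost; it vanishes for C₅, and the other slots have to collect 124352.
  wt cr : Cls → ℕ
  wt c5 = 148
  wt ks = 170
  wt ok = 185
  wt k2 = 200
  wt c4 = 307
  cr c5 = 0
  cr ks = 19712
  cr ok = 33152
  cr k2 = 43000
  cr c4 = 113000

  -- For a slot of degree two, with weight 655. Here 430000 is half of 860 · 1000, and 44720 = 52 ·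
  -- 860 accounts for the weight that a neighbour of `v` loses by such a slot. The allowance 297392
  -- is 430000 - 148 · 896.
  slot-2 : ∀ c → cr c + 430000 ≤ wt c * 655 + 1 * 44720 + 297392
  slot-2 c5 = ≤ᵇ⇒≤ 430000 439052 _
  slot-2 ks = ≤ᵇ⇒≤ 449712 453462 _
  slot-2 ok = ≤ᵇ⇒≤ 463152 463287 _
  slot-2 k2 = ≤ᵇ⇒≤ 473000 473112 _
  slot-2 c4 = ≤ᵇ⇒≤ 543000 543197 _

  -- A slot of degree three next to a neighbour of degree three has weight at least 896 = 1000 - 2 ·
  -- 52. Equality in the first three classes is what makes their credits `(wt c − 148) · 896`.
  slot-3 : ∀ c → cr c + 430000 ≤ wt c * 896 + 0 * 44720 + 297392
  slot-3 c5 = ≤-refl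
  slot-3 ks = ≤-refl
  slot-3 ok = ≤-refl
  slot-3 k2 = ≤ᵇ⇒≤ 473000 476592 _
  slot-3 c4 = ≤ᵇ⇒≤ 543000 572464 _

  -- A neighbour of degree two has one slot only, but its own weight 655 is so small that it can be
  -- credited with 33152 more, as if it had a second slot of class `ok`.
  lone : ∀ c → 655 * 860 + 1 * 86320 + (cr c + 33152) ≤ wt c * 655 + 594784
  lone c5 = ≤ᵇ⇒≤ 682772 691724 _
  lone ks = ≤ᵇ⇒≤ 702484 706134 _
  lone ok = ≤ᵇ⇒≤ 715924 715959 _
  lone k2 = ≤ᵇ⇒≤ 725772 725784 _
  lone c4 = ≤ᵇ⇒≤ 795772 795869 _

  wt≥ : ∀ c → 148 ≤ wt c
  wt≥ c5 = ≤-refl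
  wt≥ ks = ≤ᵇ⇒≤ 148 170 _
  wt≥ ok = ≤ᵇ⇒≤ 148 185 _
  wt≥ k2 = ≤ᵇ⇒≤ 148 200 _
  wt≥ c4 = ≤ᵇ⇒≤ 148 307 _

  left : Bool → Bool → Bool → ℕ
  left a b c = b2n (not a) + (b2n (not b) + (b2n (not c) + 0))

  -- One lost neighbour is worth 1008, 1030 or 1045 less 860. Two are worth 1260 - 860 = 2 · 200 in
  -- K₂ and 1475 - 860 ≥ 2 · 307 otherwise. Three are worth 2520 - 860 = 1660 ≥ 3 · 307.
  gain : ∀ a b c k x y → let d = left a b c ; w = wt (clsBy d k x y) in
         0 + (b2n a * w + (b2n b * w + (b2n c * w + 0))) + 860 ≤ demBy d k x y
  gain false false false k x y = ≤-refl
  gain true false false k true y = ≤-refl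
  gain true false false k false true = ≤-refl
  gain true false false k false false = ≤-refl
  gain false true false k true y = ≤-refl
  gain false true false k false true = ≤-refl
  gain false true false k false false = ≤-refl
  gain false false true k true y = ≤-refl
  gain false false true k false true = ≤-refl
  gain false false true k false false = ≤-refl
  gain true true false true x y = ≤-refl
  gain true true false false x y = ≤ᵇ⇒≤ 1474 1475 _
  gain true false true true x y = ≤-refl
  gain true false true false x y = ≤ᵇ⇒≤ 1474 1475 _
  gain false true true true x y = ≤-refl
  gain false true true false x y = ≤ᵇ⇒≤ 1474 1475 _
  gain true true true k x y = ≤ᵇ⇒≤ 1781 2520 _

  module Deg3 (U : VSet) (mindeg : ∀ v → U v ≡ true → 2 ≤ deg U v) (v : V) (Uv : U v ≡ true) (d3 : deg U v ≡ 3) where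
    open Avg U mindeg

    cls : V → Cls
    cls x = clsBy (deg (R x) v) (does (k2? (R x) v)) (does (c5? (R x) v)) (does (ks? (R x) v))

    W : V → ℕ
    W x = wt (cls x)

    VAL : V → ℕ
    VAL u = ΣL (λ x → p x * W x) (oth U v u)

    nadj : ∀ {i j} → i ∈ nb U v → j ∈ nb U v → i ~ j → ⊥
    nadj a b e = tri (nb-~ a) e (nb-~ b)

    dleft : ∀ {u₁ u₂ u₃ x} → nb U v ≡ u₁ ∷ u₂ ∷ u₃ ∷ [] → U x ≡ true → ¬ (x ~ v) →
            deg (R x) v ≡ left (adj G x u₁) (adj G x u₂) (adj G x u₃)
    dleft {u₁} {u₂} {u₃} {x} e Ux nk rewrite nbR Ux nk | e = lenF (u₁ ∷ u₂ ∷ u₃ ∷ [])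
      where
      lenF : ∀ l → length (filter (λ w → adj G x w Boolₚ.≟ false) l) ≡ ΣL (λ w → b2n (not (adj G x w))) l
      lenF [] = refl
      lenF (w ∷ l) with adj G x w
      ... | true = lenF l
      ... | false = cong suc (lenF l)

    point : ∀ {u₁ u₂ u₃} → nb U v ≡ u₁ ∷ u₂ ∷ u₃ ∷ [] → ∀ x → U x ≡ true →
            is v x 1660 + ΣL (λ u → o v u x * W x) (u₁ ∷ u₂ ∷ u₃ ∷ []) + 860 ≤ valAt R x v + nbi v x * 860
    point {u₁} {u₂} {u₃} e x Ux = go (x ≟ᵥ v) (v ~? x)
      where
      l : List V
      l = u₁ ∷ u₂ ∷ u₃ ∷ []
      Σ0 : (∀ u → u ∈ l → o v u x ≡ 0) → ΣL (λ u → o v u x * W x) l ≡ 0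
      Σ0 h = trans (ΣL-cong l (λ u m → cong (_* W x) (h u m))) (ΣL-0 l)
      go : Dec (x ≡ v) → Dec (v ~ x) → is v x 1660 + ΣL (λ u → o v u x * W x) l + 860 ≤ valAt R x v + nbi v x * 860
      go (yes h) _ = combine {i′ = 1660} {s′ = 0} {a′ = 2520} (is-v {v} h) (Σ0 (λ u _ → trans (cong (o v u) h) (o-v v u))) (trans (cong (λ x → valAt R x v) h) (valAt-v v)) ≤-refl
      go (no h) (yes k) = ≤-trans (+-monoˡ-≤ 860 (≤-reflexive (cong₂ _+_ (is-n {v} h) (Σ0 (λ u m → o-0 (λ g → tri (nb-~ (subst (u ∈_) (sym e) m)) g k))))))
          (≤-trans (≤-reflexive (sym (cong (_* 860) (nbi-1 Ux k)))) (m≤n+m _ _))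
      go (no h) (no k) = combine {i′ = 0} (is-n {v} h)
          (cong₂ _+_ (cong (_* W x) (o-adj {v} {u₁} Ux h)) (cong₂ _+_ (cong (_* W x) (o-adj {v} {u₂} Ux h)) (cong (_+ 0) (cong (_* W x) (o-adj {v} {u₃} Ux h)))))
          (valAt-R {v} h (R⁺ Ux Uv (s≢ h) (λ g → k (~-sym g))))
          (subst (λ d → 0 + (b2n (adj G x u₁) * wt (clsBy d kb cb sb) + (b2n (adj G x u₂) * wt (clsBy d kb cb sb) + (b2n (adj G x u₃) * wt (clsBy d kb cb sb) + 0))) + 860 ≤ demBy d kb cb sb)
            (sym (dleft e Ux (λ g → k (~-sym g)))) (gain (adj G x u₁) (adj G x u₂) (adj G x u₃) kb cb sb))
        where
        kb cb sb : Bool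
        kb = does (k2? (R x) v)
        cb = does (c5? (R x) v)
        sb = does (ks? (R x) v)

    -- The averaging condition at `v`, reduced to the vertices within distance two.
    LI : Set
    LI = ΣL (λ u → p u * 860) (nb U v) ≤ p v * 1660 + ΣL VAL (nb U v)

    conclude : LI → ΣP * 860 ≤ ΣL (λ x → p x * valAt R x v) all
    conclude li = go (nb U v) refl
      where
      go : ∀ l → nb U v ≡ l → ΣP * 860 ≤ ΣL (λ x → p x * valAt R x v) all
      go [] e with () ← trans (sym d3) (cong length e)
      go (_ ∷ []) e with () ← trans (sym d3) (cong length e)
      go (_ ∷ _ ∷ []) e with () ← trans (sym d3) (cong length e)
      go (_ ∷ _ ∷ _ ∷ _ ∷ _) e with () ← trans (sym d3) (cong length e)
      go l@(u₁ ∷ u₂ ∷ u₃ ∷ []) e = master v 860 (λ x → is v x 1660 + ΣL (λ u → o v u x * W x) l) (λ x → nbi v x * 860) (point e) (begin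
          ΣL (λ x → p x * (nbi v x * 860)) all ≡⟨ Σnb v 860 ⟩
          ΣL (λ u → p u * 860) (nb U v) ≤⟨ li ⟩
          p v * 1660 + ΣL VAL (nb U v) ≡⟨ cong (λ l → p v * 1660 + ΣL VAL l) e ⟩
          p v * 1660 + ΣL VAL l ≤⟨ +-monoˡ-≤ _ (Σis v 1660) ⟩
          ΣL (λ x → p x * is v x 1660) all + ΣL VAL l ≡⟨ cong (ΣL (λ x → p x * is v x 1660) all +_) (sym (Σslots v l W)) ⟩
          ΣL (λ x → p x * is v x 1660) all + ΣL (λ x → p x * ΣL (λ u → o v u x * W x) l) all
            ≡⟨ sym (ΣL-+ (λ x → p x * is v x 1660) (λ x → p x * ΣL (λ u → o v u x * W x) l) all) ⟩
          ΣL (λ x → p x * is v x 1660 + p x * ΣL (λ u → o v u x * W x) l) all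
            ≡⟨ ΣL-cong all (λ x _ → sym (*-distribˡ-+ (p x) (is v x 1660) _)) ⟩
          ΣL (λ x → p x * (is v x 1660 + ΣL (λ u → o v u x * W x) l)) all ∎)
        where open ≤-Reasoning

    -- Each neighbour draws 594784, and 3 · 594784 = 1660 · 1000 + 124352. The choice of `v` itself
    -- gains 1660 and pays the first part, except for 86320 = 52 · 1660 per neighbour of degree two,
    -- by which the weight of `v` is lowered. The 124352 must come from the credits.
    Credit : V → ℕ → Set
    Credit u c = p u * 860 + t u * 86320 + c ≤ VAL u + 594784

    sum3 : ∀ (f : V → ℕ) {a b c} → a ∈ nb U v → b ∈ nb U v → c ∈ nb U v → a ≢ b → a ≢ c → b ≢ c → ΣL f (nb U v) ≡ f a + (f b + f c)
    sum3 f {a} {b} {c} ma mb mc ab ac bc = trans (remove-sum f l (nb-unique U v) ma) (cong (f a +_) (trans (remove-sum f l₁ u₁ mb₁) (cong (f b +_) last)))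
      where
      l l₁ l₂ : List V
      l = nb U v
      l₁ = filter (λ w → ¬? (w ≟ᵥ a)) l
      l₂ = filter (λ w → ¬? (w ≟ᵥ b)) l₁
      u₁ : Unique l₁
      u₁ = Uₚ.filter⁺ (λ w → ¬? (w ≟ᵥ a)) (nb-unique U v)
      mb₁ : b ∈ l₁
      mb₁ = ∈-filter⁺ (λ w → ¬? (w ≟ᵥ a)) mb (s≢ ab)
      mc₂ : c ∈ l₂
      mc₂ = ∈-filter⁺ (λ w → ¬? (w ≟ᵥ b)) (∈-filter⁺ (λ w → ¬? (w ≟ᵥ a)) mc (s≢ ac)) (s≢ bc)
      len : length l ≡ suc (suc (length l₂))
      len = trans (length-ΣL l) (trans (remove-sum (λ _ → 1) l (nb-unique U v) ma) (cong suc (trans (remove-sum (λ _ → 1) l₁ u₁ mb₁) (cong suc (sym (length-ΣL l₂))))))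
      last : ΣL f l₂ ≡ f c
      last with l₂ | mc₂ | len
      ... | _ ∷ [] | here refl | _ = +-identityʳ (f c)
      ... | _ ∷ _ ∷ _ | _ | e with () ← trans (sym d3) e

    settle : ∀ {a b c ca cb cc} → a ∈ nb U v → b ∈ nb U v → c ∈ nb U v → a ≢ b → a ≢ c → b ≢ c →
             Credit a ca → Credit b cb → Credit c cc → 124352 ≤ ca + cb + cc → LI
    settle {a} {b} {c} {ca} {cb} {cc} ma mb mc ab ac bc Ca Cb Cc h
      = ≤-trans (≤-reflexive (sum3 (λ u → p u * 860) ma mb mc ab ac bc))
          (≤-trans (credit-ar {p a * 860} {p b * 860} {p c * 860} {X = (t a + (t b + t c)) * 86320} {C = ca + cb + cc} {V = VAL a + (VAL b + VAL c)} {E = 1660000} {D = 124352} {Q = p v * 1660}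
            (gather-ar {p a * 860} {p b * 860} {p c * 860} {86320} {t a} {t b} {t c} {ca} {cb} {cc} {VAL a} {VAL b} {VAL c} {594784} Ca Cb Cc) h
            (scale-ar 1660 52 {p v} {t a + (t b + t c)} {1000} (trans (cong (λ z → p v + z * 52) (sym (sum3 t ma mb mc ab ac bc))) (p-3 Uv d3))))
          (≤-reflexive (cong (p v * 1660 +_) (sym (sum3 VAL ma mb mc ab ac bc)))))

    weaken : ∀ {u c c′} → c′ ≤ c → Credit u c → Credit u c′
    weaken h C = ≤-trans (+-monoʳ-≤ _ h) C

    vu : ∀ {u} → u ∈ nb U v → v ∈ nb U u
    vu m = nb-sym Uv m

    pu3 : ∀ {u} (m : u ∈ nb U v) → deg U u ≡ 3 → (H : Shape3 U v u) → p u + (t (Shape3.e₁ H) + (t (Shape3.e₂ H) + 0)) * 52 ≡ 1000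
    pu3 {u} m d H = trans (cong (λ z → p u + z * 52) (sym (trans (oth-sum t (vu m)) (cong₂ _+_ (t-3 d3) (cong (ΣL t) (Shape3.oth≡ H)))))) (p-3 (nb-U m) d)

    pw : ∀ {e} m → m ≤ p e → W e * m ≤ p e * W e
    pw {e} m h = ≤-trans (*-monoʳ-≤ (W e) h) (≤-reflexive (*-comm (W e) (p e)))

    slot : ∀ {u e} → u ∈ nb U v → deg U u ≡ 3 → e ∈ nb U u → cr (cls e) + 430000 ≤ p e * W e + t e * 44720 + 297392
    slot {u} {e} m d k with deg23 (nb-U k)
    ... | inj₁ d2 = ≤-trans (slot-2 (cls e)) (+-monoˡ-≤ 297392 (+-mono-≤ (pw 655 (≤-reflexive (sym (p-2 (nb-U k) d2)))) (*-monoˡ-≤ 44720 (≤-reflexive (sym (t-2 d2))))))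
    ... | inj₂ d3′ = ≤-trans (slot-3 (cls e)) (+-monoˡ-≤ 297392 (+-mono-≤ (pw 896
          (p≥ 2 (nb-U k) d3′ (≤-pred (≤-trans (Σt≤₁ (nb-sym (nb-U m) k) (t-3 d)) (≤-reflexive d3′))) {896} (≤-refl {1000}))) z≤n))

    VAL2 : ∀ {u e} → oth U v u ≡ e ∷ [] → VAL u ≡ p e * W e
    VAL2 {u} {e} h = trans (cong (ΣL (λ x → p x * W x)) h) (+-identityʳ _)

    credit3 : ∀ {u} → (m : u ∈ nb U v) → deg U u ≡ 3 → (H : Shape3 U v u) → Credit u (cr (cls (Shape3.e₁ H)) + cr (cls (Shape3.e₂ H)))
    credit3 {u} m d H = ≤-trans (+-monoˡ-≤ _ (+-monoʳ-≤ (p u * 860) (*-monoˡ-≤ 86320 (≤-reflexive (t-3 d)))))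
        (≤-trans (two-slots-ar {Q = p u * 860} {44720} {t e₁} {t e₂} {w₁ = p e₁ * W e₁} {p e₂ * W e₂} {297392} {430000}
          (slot m d m₁) (slot m d m₂) (scale-ar 860 52 {p u} {t e₁ + (t e₂ + 0)} {1000} (pu3 m d H)))
        (+-monoˡ-≤ 594784 (≤-reflexive (sym (cong (ΣL (λ x → p x * W x)) oth≡)))))
      where open Shape3 H

    need2 : ∀ {u} → u ∈ nb U v → deg U u ≡ 2 → p u * 860 + t u * 86320 ≡ 649620
    need2 m d = cong₂ (λ a b → a * 860 + b * 86320) {_} {655} {_} {1} (p-2 (nb-U m) d) (t-2 d)

    credit2 : ∀ {u} → u ∈ nb U v → deg U u ≡ 2 → (H : Shape2 U v u) → Credit u (cr (cls (Shape2.e₁ H)) + 33152)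
    credit2 {u} m d H = ≤-trans (+-monoˡ-≤ _ (≤-reflexive (need2 m d))) (≤-trans (lone (cls e₁)) (+-monoˡ-≤ 594784
        (≤-trans (pw 655 (p≥655 (nb-U m₁))) (≤-reflexive (sym (VAL2 oth≡))))))
      where open Shape2 H

    -- Every class gains at least 148, and 655 · 148 + 594784 = 649620 + 42104.
    credit2′ : ∀ {u} → u ∈ nb U v → deg U u ≡ 2 → (H : Shape2 U v u) → Credit u 42104
    credit2′ {u} m d H = ≤-trans (+-monoˡ-≤ 42104 (≤-reflexive (need2 m d))) (+-monoˡ-≤ 594784
        (≤-trans (*-mono-≤ {655} {_} {148} (p≥655 (nb-U m₁)) (wt≥ (cls e₁))) (≤-reflexive (sym (VAL2 oth≡)))))
      where open Shape2 H

    CR : V → ℕ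
    CR u = ΣL (λ x → cr (cls x)) (oth U v u) + t u * 33152

    ph1 : ∀ {u} → deg U u ≡ 2 → t u * 33152 ≡ 33152
    ph1 {u} d = cong (_* 33152) {t u} {1} (t-2 d)

    ph0 : ∀ {u} → deg U u ≡ 3 → t u * 33152 ≡ 0
    ph0 {u} d = cong (_* 33152) {t u} {0} (t-3 d)

    creditΣ : ∀ {u} → u ∈ nb U v → Credit u (CR u)
    creditΣ {u} m with deg23 (nb-U m)
    ... | inj₁ d = subst (Credit u) e (credit2 m d H)
      where
      H = shape2 (vu m) d
      e : cr (cls (Shape2.e₁ H)) + 33152 ≡ CR u
      e = sym (cong₂ _+_ (trans (cong (ΣL (λ x → cr (cls x))) (Shape2.oth≡ H)) (+-identityʳ _)) (ph1 d))
    ... | inj₂ d = subst (Credit u) e (credit3 m d H)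
      where
      H = shape3 (vu m) d
      e : cr (cls (Shape3.e₁ H)) + cr (cls (Shape3.e₂ H)) ≡ CR u
      e = sym (trans (cong₂ _+_ (trans (cong (ΣL (λ x → cr (cls x))) (Shape3.oth≡ H)) (cong (cr (cls (Shape3.e₁ H)) +_) (+-identityʳ _))) (ph0 d)) (+-identityʳ _))

    creditHit : ∀ {u x} → u ∈ nb U v → x ∈ oth U v u → Credit u (cr (cls x))
    creditHit {u} {x} m k = weaken (≤-trans (ΣL-∈ (λ x → cr (cls x)) _ k) (m≤m+n _ _)) (creditΣ m)

    clsLow : ∀ {x} → deg (R x) v ≤ 1 → cls x ≡ c4 ⊎ (cls x ≡ k2 × K2at (R x) v)
    clsLow {x} h with deg (R x) v | k2? (R x) v
    ... | 0 | _ = inj₁ refl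
    ... | 1 | yes k = inj₂ (refl , k)
    ... | 1 | no _ = inj₁ refl
    ... | suc (suc _) | _ with s≤s () ← h

    clsHigh : ∀ {x} → deg (R x) v ≡ 2 → (cls x ≡ c5 × C5at (R x) v) ⊎ (cls x ≡ ks × KSat (R x) v) ⊎ cls x ≡ ok
    clsHigh {x} h with deg (R x) v | c5? (R x) v | ks? (R x) v
    clsHigh refl | 2 | yes c | _ = inj₁ (refl , c)
    clsHigh refl | 2 | no _ | yes k = inj₂ (inj₁ (refl , k))
    clsHigh refl | 2 | no _ | no _ = inj₂ (inj₂ refl)

    rest : ∀ {i j} → i ∈ nb U v → j ∈ nb U v → i ≢ j → ∃ λ k → k ∈ nb U v × k ≢ i × k ≢ j
    rest _ _ _ = thirdOf (nb-unique U v) (≤-reflexive (sym d3))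

    module Slot {i x : V} (iv : i ∈ nb U v) (mx : x ∈ oth U v i) where
      xi : x ∈ nb U i
      xi = proj₁ (oth⁻ mx)
      x≢v : x ≢ v
      x≢v = proj₂ (oth⁻ mx)
      Ux : U x ≡ true
      Ux = nb-U xi
      keep : ∀ {j} → j ∈ nb U v → ¬ (x ~ j) → j ∈ nb (R x) v
      keep m h = R-nb⁺ Ux m (λ { refl → nadj iv m (nb-~ xi) }) h
      deg<3 : deg (R x) v ≤ 2
      deg<3 = ≤-pred (≤-trans (deg-sub-< (λ w e → R-U e) iv (λ e → R-~ x i e (~-sym (nb-~ xi)))) (≤-reflexive d3))

    -- `x` is adjacent to a second neighbour `j` of `v`, so its credit counts twice, and 2 · 113000
    -- suffices. In the case of K₂ it is 2 · 43000, and 42104 comes from the partner `k` of `v`: it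
    -- has degree two, as otherwise its two other neighbours, `i` and `j` would give `x` degree
    -- four.
    low : ∀ {i x} → i ∈ nb U v → x ∈ oth U v i → deg (R x) v ≤ 1 → LI
    low {i} {x} iv mx h with thirdOf {a = i} {i} (nb-unique U v) (≤-reflexive (sym d3))
    ... | j₀ , j₀v , j₀≢i , _ with thirdOf {a = i} {j₀} (nb-unique U v) (≤-reflexive (sym d3))
    ...   | k₀ , k₀v , k₀≢i , k₀≢j₀ = pickj (x ~? j₀) (x ~? k₀)
      where
      open Slot iv mx
      hit : ∀ {j k} → j ∈ nb U v → k ∈ nb U v → j ≢ i → k ≢ i → k ≢ j → x ~ j → LI
      hit {j} {k} jv kv ji ki kj xj with clsLow h
      ... | inj₁ e = settle iv jv kv (s≢ ji) (s≢ ki) (s≢ kj)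
            (subst (λ c → Credit i (cr c)) e (creditHit iv mx)) (subst (λ c → Credit j (cr c)) e (creditHit jv (oth⁺ (nb⁺ Ux (~-sym xj)) x≢v)))
            (weaken z≤n (creditΣ kv)) (≤ᵇ⇒≤ 124352 226000 _)
      ... | inj₂ (e , K) = settle iv jv kv (s≢ ji) (s≢ ki) (s≢ kj)
            (subst (λ c → Credit i (cr c)) e (creditHit iv mx)) (subst (λ c → Credit j (cr c)) e (creditHit jv (oth⁺ (nb⁺ Ux (~-sym xj)) x≢v)))
            third (≤ᵇ⇒≤ 124352 128104 _)
        where
        Kk : ∀ w → w ∈ nb (R x) k → w ≡ v
        Kk w m with w′ , m′ , A ← find K with (w′ ≟ᵥ i) | (w′ ≟ᵥ j) | (w′ ≟ᵥ k)
        ... | yes refl | _ | _ = ⊥-elim (R-n~ m′ (~-sym (nb-~ xi)))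
        ... | no _ | yes refl | _ = ⊥-elim (R-n~ m′ xj)
        ... | no _ | no _ | yes refl = All.lookup A m
        ... | no a | no b | no c = ⊥-elim (no4 iv jv kv (R-up m′) (s≢ ji) (s≢ ki) (s≢ kj) (s≢ a) (s≢ b) (s≢ c))
        third : Credit k 42104
        third with deg23 (nb-U kv)
        ... | inj₁ d = credit2′ kv d (shape2 (vu kv) d)
        ... | inj₂ d = ⊥-elim (no4 (nb-sym (nb-U iv) xi) (nb⁺ (nb-U jv) xj) (nb⁺ (nb-U m₁) (ad m₁ n₁)) (nb⁺ (nb-U m₂) (ad m₂ n₂))
                (s≢ ji) (ne iv m₁) (ne jv m₁) (ne iv m₂) (ne jv m₂) e₁≢e₂)
          where
          open Shape3 (shape3 (vu kv) d)
          ne : ∀ {a b} → a ∈ nb U v → b ∈ nb U k → a ≢ b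
          ne a b refl = nadj kv a (nb-~ b)
          Rk : R x k ≡ true
          Rk with x ~? k
          ... | no g = nb-U (keep kv g)
          ... | yes g with w′ , m′ , A ← find K with (w′ ≟ᵥ i) | (w′ ≟ᵥ j) | (w′ ≟ᵥ k)
          ...   | yes refl | _ | _ = ⊥-elim (R-n~ m′ (~-sym (nb-~ xi)))
          ...   | no _ | yes refl | _ = ⊥-elim (R-n~ m′ xj)
          ...   | no _ | no _ | yes refl = ⊥-elim (R-n~ m′ g)
          ...   | no a | no b | no c = ⊥-elim (no4 iv jv kv (R-up m′) (s≢ ji) (s≢ ki) (s≢ kj) (s≢ a) (s≢ b) (s≢ c))
          ad : ∀ {w} → w ∈ nb U k → w ≢ v → x ~ w
          ad m n = R-lost Ux Rk m (λ m′ → n (Kk _ m′))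
      pickj : Dec (x ~ j₀) → Dec (x ~ k₀) → LI
      pickj (yes a) _ = hit j₀v k₀v j₀≢i k₀≢i k₀≢j₀ a
      pickj (no _) (yes b) = hit k₀v j₀v k₀≢i j₀≢i (s≢ k₀≢j₀) b
      pickj (no a) (no b) = ⊥-elim (<⇒≱ (2≤ (keep j₀v a) (keep k₀v b) (s≢ k₀≢j₀)) h)

  isC5 isKs : Cls → Bool
  isC5 c5 = true
  isC5 _ = false
  isKs ks = true
  isKs _ = false

  isC5-eq : ∀ {c} → isC5 c ≡ true → c ≡ c5
  isC5-eq {c5} _ = refl

  isKs-eq : ∀ {c} → isKs c ≡ true → c ≡ ks
  isKs-eq {ks} _ = refl

  cr-19 : ∀ c → 19712 ≤ cr c + b2n (isC5 c) * 19712
  cr-19 c5 = ≤-refl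
  cr-19 ks = ≤-refl
  cr-19 ok = ≤ᵇ⇒≤ 19712 33152 _
  cr-19 k2 = ≤ᵇ⇒≤ 19712 43000 _
  cr-19 c4 = ≤ᵇ⇒≤ 19712 113000 _

  cr-33 : ∀ c → c ≢ ks → 33152 ≤ cr c + b2n (isC5 c) * 33152
  cr-33 c5 _ = ≤-refl
  cr-33 ks h = ⊥-elim (h refl)
  cr-33 ok _ = ≤-refl
  cr-33 k2 _ = ≤ᵇ⇒≤ 33152 43000 _
  cr-33 c4 _ = ≤ᵇ⇒≤ 33152 113000 _

  -- Weight 948 = 1000 - 52 in place of 896 is worth at least 52 · 148 = 7696.
  slot-bonus : ∀ c → cr c + 7696 + 430000 ≤ wt c * 948 + 0 * 44720 + 297392
  slot-bonus c5 = ≤-refl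
  slot-bonus ks = ≤ᵇ⇒≤ 457408 458552 _
  slot-bonus ok = ≤ᵇ⇒≤ 470848 472772 _
  slot-bonus k2 = ≤ᵇ⇒≤ 480696 486992 _
  slot-bonus c4 = ≤ᵇ⇒≤ 550696 588428 _

  single : ∀ {l : List I} {e x} → l ≡ e ∷ [] → x ∈ l → l ≡ x ∷ []
  single refl (here refl) = refl

  cnt0 : ∀ (b : I → Bool) L → (∀ x → x ∈ L → b x ≡ true → ⊥) → ΣL (λ x → b2n (b x)) L ≤ 0
  cnt0 b [] h = z≤n
  cnt0 b (x ∷ L) h with b x in e
  ... | true = ⊥-elim (h x (here refl) e)
  ... | false = cnt0 b L λ y m → h y (there m)

  cnt1 : ∀ (b : I → Bool) L → Unique L → (∀ x y → x ∈ L → y ∈ L → b x ≡ true → b y ≡ true → x ≢ y → ⊥) → ΣL (λ x → b2n (b x)) L ≤ 1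
  cnt1 b [] _ h = z≤n
  cnt1 b (x ∷ L) (ne ∷ u) h with b x in e
  ... | true = s≤s (cnt0 b L λ y m k → h x y (here refl) (there m) e k (All.lookup ne m))
  ... | false = cnt1 b L u λ y z m k → h y z (there m) (there k)

  cnt2 : ∀ (b : I → Bool) L → Unique L → (∀ x y z → x ∈ L → y ∈ L → z ∈ L → b x ≡ true → b y ≡ true → b z ≡ true → x ≢ y → x ≢ z → y ≢ z → ⊥) →
         ΣL (λ x → b2n (b x)) L ≤ 2
  cnt2 b [] _ h = z≤n
  cnt2 b (x ∷ L) (ne ∷ u) h with b x in e
  ... | true = s≤s (cnt1 b L u λ y z m k f g → h x y z (here refl) (there m) (there k) e f g (All.lookup ne m) (All.lookup ne k))
  ... | false = cnt2 b L u λ y z w m k l → h y z w (there m) (there k) (there l)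

  module Deg3H (U : VSet) (mindeg : ∀ v → U v ≡ true → 2 ≤ deg U v) (v : V) (Uv : U v ≡ true) (d3 : deg U v ≡ 3) where
    open Avg U mindeg
    open Deg3 U mindeg v Uv d3

    module High (hi : ∀ {i x} → i ∈ nb U v → x ∈ oth U v i → ¬ (deg (R x) v ≤ 1)) where

      noC4 : ∀ {s i j} → U s ≡ true → s ≢ v → i ∈ nb U v → j ∈ nb U v → i ≢ j → i ~ s → j ~ s → ⊥
      noC4 {s} {i} {j} Us s≢v iv jv ij is js = hi iv (oth⁺ (nb⁺ Us is) s≢v) low1
        where
        low1 : deg (R s) v ≤ 1
        low1 with 2 ≤? deg (R s) v
        ... | no h = ≤-pred (≰⇒> h)
        ... | yes h with a , b , ma , mb , ne ← twoOf (nb-unique (R s) v) h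
          = ⊥-elim (no4 iv jv (R-up ma) (R-up mb) ij (nn is ma) (nn js ma) (nn is mb) (nn js mb) ne)
          where
          nn : ∀ {i a} → i ~ s → a ∈ nb (R s) v → i ≢ a
          nn e m refl = R-n~ m (~-sym e)

      open NoThree U mindeg v Uv d3 noC4 using (BadAt; badAt; noThree)

      deg2 : ∀ {i x} → i ∈ nb U v → x ∈ oth U v i → deg (R x) v ≡ 2
      deg2 iv mx = ≤-antisym (Slot.deg<3 iv mx) (≰⇒> (hi iv mx))

      b5 : V → Bool
      b5 x = isC5 (cls x)

      B5 : V → ℕ
      B5 u = ΣL (λ x → b2n (b5 x)) (oth U v u)

      toBad : ∀ {i x} → i ∈ nb U v → x ∈ oth U v i → b5 x ≡ true → BadAt i x
      toBad {i} {x} iv mx e with clsHigh (deg2 iv mx)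
      ... | inj₁ (_ , c) = badAt iv (Slot.xi iv mx) (Slot.x≢v iv mx) c
      ... | inj₂ (inj₁ (e′ , _)) with () ← trans (sym e′) (isC5-eq e)
      ... | inj₂ (inj₂ e′) with () ← trans (sym e′) (isC5-eq e)

      few : ∀ {a b c} → a ∈ nb U v → b ∈ nb U v → c ∈ nb U v → a ≢ b → a ≢ c → b ≢ c → B5 a + (B5 b + B5 c) ≤ 2
      few {a} {b} {c} av bv cv ab ac bc = ≤-trans (≤-reflexive (sym (trans (ΣL-++ f (oth U v a) _) (cong (B5 a +_) (ΣL-++ f (oth U v b) _)))))
          (cnt2 b5 L uq (λ x y z m k l e f g → bad3 (own m) (own k) (own l) e f g))
        where
        f : V → ℕ
        f x = b2n (b5 x)
        L : List V
        L = oth U v a ++ (oth U v b ++ oth U v c)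
        uo : ∀ u → Unique (oth U v u)
        uo u = subst Unique (sym (oth-nb U v u)) (Uₚ.filter⁺ (λ w → ¬? (w ≟ᵥ v)) (nb-unique U u))
        dj : ∀ {i j x} → i ∈ nb U v → j ∈ nb U v → i ≢ j → x ∈ oth U v i → x ∈ oth U v j → ⊥
        dj iv jv ij m k = noC4 (nb-U (proj₁ (oth⁻ m))) (proj₂ (oth⁻ m)) iv jv ij (nb-~ (proj₁ (oth⁻ m))) (nb-~ (proj₁ (oth⁻ k)))
        uq : Unique L
        uq = Uₚ.++⁺ (uo a) (Uₚ.++⁺ (uo b) (uo c) (λ (m , k) → dj bv cv bc m k)) λ (m , k) → [ dj av bv ab m , dj av cv ac m ]′ (∈-++⁻ (oth U v b) k)
        own : ∀ {x} → x ∈ L → ∃ λ i → i ∈ nb U v × x ∈ oth U v i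
        own m with ∈-++⁻ (oth U v a) m
        ... | inj₁ k = a , av , k
        ... | inj₂ k with ∈-++⁻ (oth U v b) k
        ...   | inj₁ l = b , bv , l
        ...   | inj₂ l = c , cv , l
        bad3 : ∀ {x y z} → (∃ λ i → i ∈ nb U v × x ∈ oth U v i) → (∃ λ i → i ∈ nb U v × y ∈ oth U v i) → (∃ λ i → i ∈ nb U v × z ∈ oth U v i) →
               b5 x ≡ true → b5 y ≡ true → b5 z ≡ true → x ≢ y → x ≢ z → y ≢ z → ⊥
        bad3 (_ , iv , m) (_ , jv , k) (_ , kv , l) e f g = noThree (toBad iv m e) (toBad jv k f) (toBad kv l g)

      -- The extra 33152 for degree two replaces the missing second slot, so every neighbour counts
      -- for two slots of value `m`, less those lost to C₅.
      lowU : ∀ m → m ≤ 33152 → ∀ {u} → u ∈ nb U v → (∀ e → e ∈ oth U v u → m ≤ cr (cls e) + b2n (b5 e) * m) → m + m ≤ CR u + B5 u * m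
      lowU m m≤ {u} uv h with deg23 (nb-U uv)
      ... | inj₁ d = ≤-trans (+-mono-≤ (h e₁ (subst (e₁ ∈_) (sym oth≡) (here refl))) m≤)
            (≤-reflexive (trans (+-swapʳ (cr (cls e₁)) _ 33152) (cong₂ (λ z w → z + w * m) (sym cr≡) (sym b≡))))
        where
        open Shape2 (shape2 (vu uv) d)
        cr≡ : CR u ≡ cr (cls e₁) + 33152
        cr≡ = cong₂ _+_ (trans (cong (ΣL (λ x → cr (cls x))) oth≡) (+-identityʳ _)) (ph1 d)
        b≡ : B5 u ≡ b2n (b5 e₁)
        b≡ = trans (cong (ΣL (λ x → b2n (b5 x))) oth≡) (+-identityʳ _)
      ... | inj₂ d = ≤-trans (+-mono-≤ (h e₁ (subst (e₁ ∈_) (sym oth≡) (here refl))) (h e₂ (subst (e₂ ∈_) (sym oth≡) (there (here refl)))))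
            (≤-reflexive (trans (two-ar (cr (cls e₁)) (cr (cls e₂)) (b2n (b5 e₁)) (b2n (b5 e₂)) m) (cong₂ (λ z w → z + w * m) (sym cr≡) (sym b≡))))
        where
        open Shape3 (shape3 (vu uv) d)
        cr≡ : CR u ≡ cr (cls e₁) + cr (cls e₂)
        cr≡ = trans (cong₂ _+_ (trans (cong (ΣL (λ x → cr (cls x))) oth≡) (cong (cr (cls e₁) +_) (+-identityʳ _))) (ph0 d)) (+-identityʳ _)
        b≡ : B5 u ≡ b2n (b5 e₁) + b2n (b5 e₂)
        b≡ = trans (cong (ΣL (λ x → b2n (b5 x))) oth≡) (cong (b2n (b5 e₁) +_) (+-identityʳ _))

      low19 : ∀ {u} → u ∈ nb U v → 19712 + 19712 ≤ CR u + B5 u * 19712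
      low19 uv = lowU 19712 (≤ᵇ⇒≤ 19712 33152 _) uv λ e _ → cr-19 (cls e)

      -- Of the six slots at most two are lost to C₅, and four times 33152 is 132608.
      noKS : (∀ {i x} → i ∈ nb U v → x ∈ oth U v i → cls x ≢ ks) → LI
      noKS h with twoOf (nb-unique U v) (≤-trans (≤ᵇ⇒≤ 2 3 _) (≤-reflexive (sym d3)))
      ... | a , b , av , bv , ab with rest av bv ab
      ...   | c , cv , ca , cb = settle av bv cv ab (s≢ ca) (s≢ cb) (creditΣ av) (creditΣ bv) (creditΣ cv)
            (≤-trans (≤ᵇ⇒≤ 124352 132608 _) (sum6-ar {33152} {CR a} {CR b} {CR c} {B5 a} {B5 b} {B5 c} (l av) (l bv) (l cv) (few av bv cv ab (s≢ ca) (s≢ cb))))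
        where
        l : ∀ {u} → u ∈ nb U v → 33152 + 33152 ≤ CR u + B5 u * 33152
        l uv = lowU 33152 ≤-refl uv λ e m → cr-33 (cls e) (h uv m)

      -- Four slots of value 19712 are too little, but the eight-vertex component raises some
      -- weights. The slot `w₃` is of class `ok`, worth 13440 more. `w₄` and `w₅` have two
      -- neighbours of degree three, which gives 2 · 7696. The weight of `w₃` gives 19240. The sum
      -- is 126920.
      module Special {i x w₁ w₂ w₃ w₄ w₅ p′ q′ : V} (iv : i ∈ nb U v) (mx : x ∈ oth U v i) (Q : IsKS (R x) v w₁ w₂ w₃ w₄ w₅ p′ q′) where
        open IsKS Q
        open B≢ (b≢ isB)
        module Fl = IsKS (ks-flip Q)
        v1 : w₁ ∈ nb U v
        v1 = R-up m₀₁
        v2 : w₂ ∈ nb U v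
        v2 = R-up m₀₂
        u3 : U w₃ ≡ true
        u3 = R-U (nb-U m₁₃)
        is3 : ∀ {y a b c} → a ∈ nb U y → b ∈ nb U y → c ∈ nb U y → a ≢ b → a ≢ c → b ≢ c → deg U y ≡ 3
        is3 {y} a b c h₁ h₂ h₃ = ≤-antisym (deg≤3 U y) (3≤ a b c h₁ h₂ h₃)
        d₂ : deg U w₂ ≡ 3
        d₂ = is3 (vu v2) (R-up m₂₄) (R-up m₂₅) 0≢4 0≢5 4≢5
        d₃ : deg U w₃ ≡ 3
        d₃ = is3 (nb-sym (nb-U v1) (R-up m₁₃)) (R-up m₃₄) (R-up m₃₅) 1≢4 1≢5 4≢5
        d₄ : deg U w₄ ≡ 3
        d₄ = is3 (R-up m₄p) (nb-sym (nb-U v2) (R-up m₂₄)) (nb-sym u3 (R-up m₃₄)) p≢2 p≢3 2≢3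
        d₅ : deg U w₅ ≡ 3
        d₅ = is3 (R-up m₅q) (nb-sym (nb-U v2) (R-up m₂₅)) (nb-sym u3 (R-up m₃₅)) q≢2 q≢3 2≢3
        nb2 : ∀ {e} → e ∈ nb U w₂ → e ≢ v → e ≡ w₄ ⊎ e ≡ w₅
        nb2 {e} m h with e ≟ᵥ w₄ | e ≟ᵥ w₅
        ... | yes k | _ = inj₁ k
        ... | no _ | yes k = inj₂ k
        ... | no a | no b = ⊥-elim (no4 (vu v2) (R-up m₂₄) (R-up m₂₅) m 0≢4 0≢5 4≢5 (s≢ h) (s≢ a) (s≢ b))
        w₃∈ : w₃ ∈ oth U v w₁
        w₃∈ = oth⁺ (R-up m₁₃) (s≢ 0≢3)
        1≢2′ : w₁ ≢ w₂
        1≢2′ = 1≢2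
        ~2 : ¬ (w₃ ~ w₂)
        ~2 e = noC4 u3 (s≢ 0≢3) v1 v2 1≢2′ (nb-~ m₁₃) (~-sym e)
        lost2 : ∀ {e} → e ∈ nb (R w₃) w₂ → e ≢ v → ⊥
        lost2 m h with nb2 (R-up m) h
        ... | inj₁ refl = R-n~ m (nb-~ m₃₄)
        ... | inj₂ refl = R-n~ m (nb-~ m₃₅)
        -- `w₄` and `w₅` are neighbours of `w₃`, so in `R w₃` the vertex `w₂` has no neighbour but
        -- `v`, which rules out both exceptional components.
        ok3 : cls w₃ ≡ ok
        ok3 with clsHigh (deg2 v1 w₃∈)
        ... | inj₂ (inj₂ e) = e
        ... | inj₁ (_ , (a , b , c , d , P , S)) with S w₂ (Slot.keep v1 w₃∈ v2 ~2)
        ...   | inj₁ refl = ⊥-elim (lost2 (IsPend.ac P) (s≢ (Pend≢.v≢c (pend≢ P))))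
        ...   | inj₂ refl = ⊥-elim (lost2 (IsPend.bd P) (s≢ (Pend≢.v≢d (pend≢ P))))
        ok3 | inj₂ (inj₁ (_ , (_ , _ , _ , _ , _ , _ , _ , Q′))) with IsKS.S₀ Q′ w₂ (Slot.keep v1 w₃∈ v2 ~2)
        ...   | inj₁ refl = ⊥-elim (lost2 (IsKS.m₁₃ Q′) (s≢ (IsKS.0≢3 Q′)))
        ...   | inj₂ refl = ⊥-elim (lost2 (IsKS.m₂₄ Q′) (s≢ (B≢.0≢4 (b≢ (IsKS.isB Q′)))))

        bonus : ∀ {e} → e ∈ nb U w₂ → e ≢ v → cr (cls e) + 7696 + 430000 ≤ p e * W e + t e * 44720 + 297392
        bonus {e} m h = ≤-trans (slot-bonus (cls e)) (+-monoˡ-≤ 297392 (+-mono-≤ (pw 948 (p≥ 1 (nb-U m) (proj₁ both) (≤-pred (≤-pred (≤-trans (proj₂ both) (≤-reflexive (proj₁ both))))) {948} (≤-refl {1000}))) z≤n))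
          where
          both : deg U e ≡ 3 × 2 + ΣL t (nb U e) ≤ deg U e
          both with nb2 m h
          ... | inj₁ refl = d₄ , Σt≤₂ (nb-sym (nb-U v2) (R-up m₂₄)) (nb-sym u3 (R-up m₃₄)) 2≢3 (t-3 d₂) (t-3 d₃)
          ... | inj₂ refl = d₅ , Σt≤₂ (nb-sym (nb-U v2) (R-up m₂₅)) (nb-sym u3 (R-up m₃₅)) 2≢3 (t-3 d₂) (t-3 d₃)

        credit₂ : Credit w₂ (CR w₂ + 15392)
        credit₂ = subst (Credit w₂) e (≤-trans (+-monoˡ-≤ _ (+-monoʳ-≤ (p w₂ * 860) (*-monoˡ-≤ 86320 (≤-reflexive (t-3 d₂)))))
            (≤-trans (two-slots-ar {p w₂ * 860} {44720} {t e₁} {t e₂} {w₁ = p e₁ * W e₁} {p e₂ * W e₂} {297392} {430000}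
              (bonus m₁ n₁) (bonus m₂ n₂) (scale-ar 860 52 {p w₂} {t e₁ + (t e₂ + 0)} {1000} (pu3 v2 d₂ H)))
            (+-monoˡ-≤ 594784 (≤-reflexive (sym (cong (ΣL (λ x → p x * W x)) oth≡))))))
          where
          H : Shape3 U v w₂
          H = shape3 (vu v2) d₂
          open Shape3 H
          e : cr (cls e₁) + 7696 + (cr (cls e₂) + 7696) ≡ CR w₂ + 15392
          e = trans (bonus-ar (cr (cls e₁)) (cr (cls e₂)) 7696) (cong (_+ 15392) {cr (cls e₁) + cr (cls e₂)} {CR w₂}
                (sym (trans (cong₂ _+_ (trans (cong (ΣL (λ x → cr (cls x))) oth≡) (cong (cr (cls e₁) +_) (+-identityʳ _))) (ph0 d₂)) (+-identityʳ _))))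

        t₄₅ : 2 + ΣL t (nb U w₃) ≤ deg U w₃
        t₄₅ = Σt≤₂ (R-up m₃₄) (R-up m₃₅) 4≢5 (t-3 d₄) (t-3 d₅)

        -- All neighbours of `w₃` have degree three, so its weight is 1000, and 1000 in place of 896
        -- is worth 104 · 185 = 19240.
        full : deg U w₁ ≡ 3 → cr (cls w₃) + 19240 + 430000 ≤ p w₃ * W w₃ + t w₃ * 44720 + 297392
        full d = ≤-trans (≤-reflexive (cong (λ c → cr c + 19240 + 430000) {cls w₃} {ok} ok3)) (≤-trans (≤-refl {482392}) (+-monoˡ-≤ 297392
            (≤-trans (≤-trans (*-monoˡ-≤ 185 {1000} {p w₃} p3) (≤-reflexive (cong (λ c → p w₃ * wt c) {ok} {cls w₃} (sym ok3)))) (m≤m+n _ _))))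
          where
          p3 : 1000 ≤ p w₃
          p3 = p≥ 0 u3 d₃ (≤-pred (≤-pred (≤-pred (≤-trans (Σt≤₃ (nb-sym (nb-U v1) (R-up m₁₃)) (R-up m₃₄) (R-up m₃₅) 1≢4 1≢5 4≢5 (t-3 d) (t-3 d₄) (t-3 d₅)) (≤-reflexive d₃))))) {1000} (≤-refl {1000})

        credit₁ : Credit w₁ (CR w₁ + 19240)
        credit₁ with deg23 (nb-U v1)
        ... | inj₁ d = ≤-trans (+-mono-≤ (≤-reflexive (need2 v1 d)) (≤-reflexive (cong (_+ 19240) {CR w₁} {66304} cr≡)))
              (≤-trans (≤ᵇ⇒≤ 735164 770164 _) (+-monoˡ-≤ 594784 (≤-trans (≤-trans (*-monoˡ-≤ 185 {948} {p w₃} p3) (≤-reflexive (cong (λ c → p w₃ * wt c) {ok} {cls w₃} (sym ok3)))) (≤-reflexive (sym (VAL2 o3))))))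
          where
          open Shape2 (shape2 (vu v1) d)
          o3 : oth U v w₁ ≡ w₃ ∷ []
          o3 = single oth≡ w₃∈
          p3 : 948 ≤ p w₃
          p3 = p≥ 1 u3 d₃ (≤-pred (≤-pred (≤-trans t₄₅ (≤-reflexive d₃)))) {948} (≤-refl {1000})
          cr≡ : CR w₁ ≡ 66304
          cr≡ = cong₂ _+_ {_} {33152} {_} {33152} (trans (cong (ΣL (λ x → cr (cls x))) o3) (trans (+-identityʳ (cr (cls w₃))) (cong cr ok3))) (ph1 d)
        ... | inj₂ d = subst (Credit w₁) e (≤-trans (+-monoˡ-≤ _ (+-monoʳ-≤ (p w₁ * 860) (*-monoˡ-≤ 86320 (≤-reflexive (t-3 d)))))
            (≤-trans body (+-monoˡ-≤ 594784 (≤-reflexive (sym (cong (ΣL (λ x → p x * W x)) oth≡))))))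
          where
          H : Shape3 U v w₁
          H = shape3 (vu v1) d
          open Shape3 H
          Full : V → Set
          Full y = cr (cls y) + 19240 + 430000 ≤ p y * W y + t y * 44720 + 297392
          body : p w₁ * 860 + 0 + (cr (cls e₁) + cr (cls e₂) + 19240) ≤ p e₁ * W e₁ + (p e₂ * W e₂ + 0) + 594784
          body with subst (w₃ ∈_) oth≡ w₃∈
          ... | here e₃ = ≤-trans (+-monoʳ-≤ (p w₁ * 860 + 0) (≤-reflexive (+-swapʳ (cr (cls e₁)) (cr (cls e₂)) 19240)))
                (two-slots-ar {p w₁ * 860} {44720} {t e₁} {t e₂} {cr (cls e₁) + 19240} {cr (cls e₂)} {p e₁ * W e₁} {p e₂ * W e₂} {297392} {430000}
                  (subst Full e₃ (full d)) (slot v1 d m₂) (scale-ar 860 52 {p w₁} {t e₁ + (t e₂ + 0)} {1000} (pu3 v1 d H)))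
          ... | there (here e₃) = ≤-trans (+-monoʳ-≤ (p w₁ * 860 + 0) (≤-reflexive (+-assoc (cr (cls e₁)) (cr (cls e₂)) 19240)))
                (two-slots-ar {p w₁ * 860} {44720} {t e₁} {t e₂} {cr (cls e₁)} {cr (cls e₂) + 19240} {p e₁ * W e₁} {p e₂ * W e₂} {297392} {430000}
                  (slot v1 d m₁) (subst Full e₃ (full d)) (scale-ar 860 52 {p w₁} {t e₁ + (t e₂ + 0)} {1000} (pu3 v1 d H)))
          e : cr (cls e₁) + cr (cls e₂) + 19240 ≡ CR w₁ + 19240
          e = cong (_+ 19240) {cr (cls e₁) + cr (cls e₂)} {CR w₁}
                (sym (trans (cong₂ _+_ (trans (cong (ΣL (λ x → cr (cls x))) oth≡) (cong (cr (cls e₁) +_) (+-identityʳ _))) (ph0 d)) (+-identityʳ _)))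

        low₁ : 19712 + 19712 + 13440 ≤ CR w₁ + B5 w₁ * 19712
        low₁ with deg23 (nb-U v1)
        ... | inj₁ d = ≤-trans (≤ᵇ⇒≤ 52864 66304 _) (≤-trans (≤-reflexive (sym cr≡)) (m≤m+n _ _))
          where
          open Shape2 (shape2 (vu v1) d)
          o3 : oth U v w₁ ≡ w₃ ∷ []
          o3 = single oth≡ w₃∈
          cr≡ : CR w₁ ≡ 66304
          cr≡ = cong₂ _+_ {_} {33152} {_} {33152} (trans (cong (ΣL (λ x → cr (cls x))) o3) (trans (+-identityʳ (cr (cls w₃))) (cong cr ok3))) (ph1 d)
        ... | inj₂ d = ≤-trans body (≤-reflexive (cong₂ (λ z w → z + w * 19712) {cr (cls e₁) + cr (cls e₂)} {CR w₁} {b2n (b5 e₁) + b2n (b5 e₂)} {B5 w₁} (sym cr≡) (sym b≡)))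
          where
          open Shape3 (shape3 (vu v1) d)
          cr≡ : CR w₁ ≡ cr (cls e₁) + cr (cls e₂)
          cr≡ = trans (cong₂ _+_ (trans (cong (ΣL (λ x → cr (cls x))) oth≡) (cong (cr (cls e₁) +_) (+-identityʳ _))) (ph0 d)) (+-identityʳ _)
          b≡ : B5 w₁ ≡ b2n (b5 e₁) + b2n (b5 e₂)
          b≡ = trans (cong (ΣL (λ x → b2n (b5 x))) oth≡) (cong (b2n (b5 e₁) +_) (+-identityʳ _))
          c33 : 33152 ≤ cr (cls w₃) + b2n (b5 w₃) * 19712
          c33 = ≤-reflexive (cong (λ c → cr c + b2n (isC5 c) * 19712) {ok} {cls w₃} (sym ok3))
          Low : V → Set
          Low y = 33152 ≤ cr (cls y) + b2n (b5 y) * 19712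
          body : 19712 + 19712 + 13440 ≤ cr (cls e₁) + cr (cls e₂) + (b2n (b5 e₁) + b2n (b5 e₂)) * 19712
          body with subst (w₃ ∈_) oth≡ w₃∈
          ... | here e₃ = low-ar {33152} {19712} {19712} {cr (cls e₁)} {cr (cls e₂)} {b2n (b5 e₁)} {b2n (b5 e₂)} (subst Low e₃ c33) (cr-19 (cls e₂))
          ... | there (here e₃) = low-ar {19712} {33152} {19712} {cr (cls e₁)} {cr (cls e₂)} {b2n (b5 e₁)} {b2n (b5 e₂)} (cr-19 (cls e₁)) (subst Low e₃ c33)

        special : LI
        special = settle iv v2 v1 (ne m₀₂) (ne m₀₁) (s≢ 1≢2) (creditΣ iv) credit₂ credit₁
            (≤-trans (≤ᵇ⇒≤ 124352 126920 _) (final-ar {CR i} {CR w₂} {CR w₁} {B5 i} {B5 w₂} {B5 w₁} (low19 iv) (low19 v2) low₁ (few iv v2 v1 (ne m₀₂) (ne m₀₁) (s≢ 1≢2))))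
          where
          ne : ∀ {w} → w ∈ nb (R x) v → i ≢ w
          ne m refl = R-n~ m (~-sym (nb-~ (Slot.xi iv mx)))

      high : LI
      high with Any.any? (λ u → Any.any? (λ x → isKs (cls x) Boolₚ.≟ true) (oth U v u)) (nb U v)
      ... | no h = noKS (λ {i} {x} iv mx e → h (lose iv (lose mx (cong isKs e))))
      ... | yes h with find h
      ...   | i , iv , h′ with find h′
      ...     | x , mx , e with clsHigh (deg2 iv mx)
      ...       | inj₂ (inj₁ (_ , (_ , _ , _ , _ , _ , _ , _ , Q))) = Special.special iv mx Q
      ...       | inj₁ (e′ , _) with () ← trans (sym e′) (isKs-eq e)
      ...       | inj₂ (inj₂ e′) with () ← trans (sym e′) (isKs-eq e)

    deg3 : ΣP * 860 ≤ ΣL (λ x → p x * valAt R x v) all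
    deg3 with Any.any? (λ u → Any.any? (λ x → deg (R x) v ≤? 1) (oth U v u)) (nb U v)
    ... | no h = conclude (High.high (λ {i} {x} iv mx e → h (lose iv (lose mx e))))
    ... | yes h with find h
    ...   | i , iv , h′ with find h′
    ...     | x , mx , e = conclude (low iv mx e)

  sub3-of : ∀ {U u x y z} → x ∈ nb U u → y ∈ nb U u → z ∈ nb U u → x ≢ y → x ≢ z → y ≢ z → Sub3 U u x y z
  sub3-of {x = x} {y} {z} mx my mz xy xz yz w m with w ≟ᵥ x | w ≟ᵥ y | w ≟ᵥ z
  ... | yes e | _ | _ = inj₁ e
  ... | no _ | yes e | _ = inj₂ (inj₁ e)
  ... | no _ | no _ | yes e = inj₂ (inj₂ e)
  ... | no a | no b | no c = ⊥-elim (no4 mx my mz m xy xz yz (s≢ a) (s≢ b) (s≢ c))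

  -- Vertices of degree two

  -- 430 = 1475 - 1045 and 215 = 1260 - 1045. If both neighbours are lost, the gain is 1475 ≥ 2 ·
  -- 430.
  w2By : ℕ → Bool → ℕ
  w2By 1 true = 215
  w2By _ _ = 430

  left2 : Bool → Bool → ℕ
  left2 a b = b2n (not a) + b2n (not b)

  gain2 : ∀ a b k c s ch → (left2 a b ≡ 2 → c ≡ true → 37 ≤ ch) → (left2 a b ≡ 2 → s ≡ true → 15 ≤ ch) →
          0 + (b2n a * w2By (left2 a b) k + b2n b * w2By (left2 a b) k) + 1045 ≤ demBy (left2 a b) k c s + (0 + ch)
  gain2 false false k true s ch h _ = +-monoʳ-≤ 1008 (h refl refl)
  gain2 false false k false true ch _ h = +-monoʳ-≤ 1030 (h refl refl)
  gain2 false false k false false ch _ _ = m≤m+n 1045 ch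
  gain2 true false true c s ch _ _ = m≤m+n 1260 ch
  gain2 true false false c s ch _ _ = m≤m+n 1475 ch
  gain2 false true true c s ch _ _ = m≤m+n 1260 ch
  gain2 false true false c s ch _ _ = m≤m+n 1475 ch
  gain2 true true k c s ch _ _ = ≤-trans (≤ᵇ⇒≤ 1905 2520 _) (m≤m+n 2520 ch)

  module Deg2 (U : VSet) (mindeg : ∀ v → U v ≡ true → 2 ≤ deg U v) (v : V) (Uv : U v ≡ true) (d2 : deg U v ≡ 2)
    (a b : V) (av : a ∈ nb U v) (bv : b ∈ nb U v) (a≢b : a ≢ b) where
    open Avg U mindeg

    sum2 : ∀ (f : V → ℕ) → ΣL f (nb U v) ≡ f a + f b
    sum2 f = trans (remove-sum f l (nb-unique U v) av) (cong (f a +_) last)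
      where
      l l₁ : List V
      l = nb U v
      l₁ = filter (λ w → ¬? (w ≟ᵥ a)) l
      mb₁ : b ∈ l₁
      mb₁ = ∈-filter⁺ (λ w → ¬? (w ≟ᵥ a)) bv (s≢ a≢b)
      len : length l ≡ suc (length l₁)
      len = trans (length-ΣL l) (trans (remove-sum (λ _ → 1) l (nb-unique U v) av) (cong suc (sym (length-ΣL l₁))))
      last : ΣL f l₁ ≡ f b
      last with l₁ | mb₁ | len
      ... | _ ∷ [] | here refl | _ = +-identityʳ (f b)
      ... | _ ∷ _ ∷ _ | _ | e with () ← trans (sym d2) e

    Sv : Sub2 U v a b
    Sv = sub2-deg (≤-reflexive d2) av bv a≢b

    nadj : ∀ {i j} → i ∈ nb U v → j ∈ nb U v → i ~ j → ⊥
    nadj p q e = tri (nb-~ p) e (nb-~ q)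

    W2 : V → ℕ
    W2 x = w2By (deg (R x) v) (does (k2? (R x) v))

    dleft : ∀ {x} → U x ≡ true → ¬ (x ~ v) → deg (R x) v ≡ left2 (adj G x a) (adj G x b)
    dleft {x} Ux nk = trans (cong length (nbR Ux nk)) (trans (lenF (nb U v)) (sum2 (λ w → b2n (not (adj G x w)))))
      where
      lenF : ∀ l → length (filter (λ w → adj G x w Boolₚ.≟ false) l) ≡ ΣL (λ w → b2n (not (adj G x w))) l
      lenF [] = refl
      lenF (w ∷ l) with adj G x w
      ... | true = lenF l
      ... | false = cong suc (lenF l)

    vu : ∀ {u} → u ∈ nb U v → v ∈ nb U u
    vu m = nb-sym Uv m

    lost1 : ∀ {x j} → j ∈ nb U v → x ~ j → deg (R x) v ≤ 1
    lost1 {x} {j} jv e = ≤-pred (≤-trans (deg-sub-< (λ w k → R-U k) jv (λ k → R-~ x j k e)) (≤-reflexive d2))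

    module Kap (κ : V → ℕ) where
      -- Leaving v in a C₅ or in the eight-vertex component costs 1045 − 1008 = 37 or 1045 − 1030 = 15.
      -- This is charged at the rate κ u to the paths v u e x.
      F : V → V → ℕ
      F u x = if deg (R x) v ≡ᵇ 2 then κ u else 0

      F-2 : ∀ {u x} → deg (R x) v ≡ 2 → F u x ≡ κ u
      F-2 e rewrite e = refl

      F-1 : ∀ {u x} → deg (R x) v ≤ 1 → F u x ≡ 0
      F-1 {u} {x} h with deg (R x) v
      ... | 0 = refl
      ... | 1 = refl
      F-1 (s≤s ()) | suc (suc _)

      F≤ : ∀ u x → F u x ≤ κ u
      F≤ u x with deg (R x) v ≡ᵇ 2
      ... | true = ≤-refl
      ... | false = z≤n

      g : V → V → ℕ
      g u x = ΣL (λ e → o u e x * F u x) (oth U v u)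

      CH : V → ℕ
      CH x = g a x + g b x

      XE : V → V → ℕ
      XE u e = ΣL (λ x → p x * F u x) (oth U u e)

      XX : V → ℕ
      XX u = ΣL (XE u) (oth U v u)

      VAL : V → ℕ
      VAL u = ΣL (λ x → p x * W2 x) (oth U v u)

      -- What the slots of `u` leave unpaid. The choice of `v` itself pays 655 · 1475 = 966125
      -- towards both neighbours together.
      Cost : V → ℕ → Set
      Cost u k = p u * 1045 + XX u ≤ VAL u + k

      hit : ∀ {u e x} → deg (R x) v ≡ 2 → e ∈ oth U v u → x ∈ oth U u e → κ u ≤ g u x
      hit {u} {e} {x} h me mx = ≤-trans (≤-reflexive (trans (sym (F-2 {u} {x} h)) (trans (sym (+-identityʳ _)) (cong (_* F u x) {1} {o u e x} (sym (o-1 (nb-U (proj₁ (oth⁻ mx))) (nb-~ (proj₁ (oth⁻ mx))) (proj₂ (oth⁻ mx))))))))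
        (ΣL-∈ (λ e → o u e x * F u x) _ me)

      Good : Set
      Good = ∀ x → U x ≡ true → x ≢ v → ¬ (v ~ x) → deg (R x) v ≡ 2 → (C5at (R x) v → 37 ≤ CH x) × (KSat (R x) v → 15 ≤ CH x)

      X Y : V → ℕ
      X x = is v x 1475 + (o v a x * W2 x + o v b x * W2 x)
      Y x = nbi v x * 1045 + CH x

      does-true : ∀ {P : Set} (d : Dec P) → does d ≡ true → P
      does-true (yes q) _ = q

      nbi-0 : ∀ {x} → ¬ (v ~ x) → nbi v x * 1045 ≡ 0
      nbi-0 {x} h with nb? U v x
      ... | yes e = ⊥-elim (h (proj₂ (∧-elim {U x} e)))
      ... | no _ = refl

      point : Good → ∀ x → U x ≡ true → X x + 1045 ≤ valAt R x v + Y x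
      point gd x Ux = go (x ≟ᵥ v) (v ~? x)
        where
        z : (∀ {u} → u ∈ nb U v → o v u x ≡ 0) → o v a x * W2 x + o v b x * W2 x ≡ 0
        z h = cong₂ _+_ {_} {0} {_} {0} (cong (_* W2 x) (h av)) (cong (_* W2 x) (h bv))
        kb cb sb : Bool
        kb = does (k2? (R x) v)
        cb = does (c5? (R x) v)
        sb = does (ks? (R x) v)
        go : Dec (x ≡ v) → Dec (v ~ x) → X x + 1045 ≤ valAt R x v + Y x
        go (yes h) _ = combine {1045} {i′ = 1475} {s′ = 0} {a′ = 2520} (is-v {v} h) (z (λ {u} _ → trans (cong (o v u) h) (o-v v u))) (trans (cong (λ x → valAt R x v) h) (valAt-v v)) ≤-refl
        go (no h) (yes k) = ≤-trans (+-monoˡ-≤ 1045 (≤-reflexive (cong₂ _+_ {_} {0} {_} {0} (is-n {v} h) (z (λ m → o-0 (λ e → tri (nb-~ m) e k))))))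
          (≤-trans (≤-trans (≤-reflexive (sym (cong (_* 1045) {nbi v x} {1} (nbi-1 Ux k)))) (m≤m+n _ (CH x))) (m≤n+m _ (valAt R x v)))
        go (no h) (no k) = combine′ {1045} {i′ = 0} {s′ = b2n (adj G x a) * W2 x + b2n (adj G x b) * W2 x} (is-n {v} h)
            (cong₂ _+_ (cong (_* W2 x) (o-adj {v} {a} Ux h)) (cong (_* W2 x) (o-adj {v} {b} Ux h)))
            (valAt-R {v} h (R⁺ Ux Uv (s≢ h) (λ e → k (~-sym e))))
            (subst (λ y → 0 + (b2n (adj G x a) * W2 x + b2n (adj G x b) * W2 x) + 1045 ≤ dem (R x) v + (y + CH x)) (sym (nbi-0 k)) main)
          where
          dl : deg (R x) v ≡ left2 (adj G x a) (adj G x b)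
          dl = dleft Ux (λ e → k (~-sym e))
          main : 0 + (b2n (adj G x a) * W2 x + b2n (adj G x b) * W2 x) + 1045 ≤ dem (R x) v + (0 + CH x)
          main = subst (λ d → 0 + (b2n (adj G x a) * w2By d kb + b2n (adj G x b) * w2By d kb) + 1045 ≤ demBy d kb cb sb + (0 + CH x)) (sym dl)
            (gain2 (adj G x a) (adj G x b) kb cb sb (CH x)
              (λ e c → proj₁ (gd x Ux h k (trans dl e)) (does-true (c5? (R x) v) c)) (λ e s → proj₂ (gd x Ux h k (trans dl e)) (does-true (ks? (R x) v) s)))

      sumX : p v * 1475 + (VAL a + VAL b) ≤ ΣL (λ x → p x * X x) all
      sumX = begin
        p v * 1475 + (VAL a + VAL b) ≤⟨ +-monoˡ-≤ _ (Σis v 1475) ⟩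
        ΣL (λ x → p x * is v x 1475) all + (VAL a + VAL b) ≡⟨ cong (ΣL (λ x → p x * is v x 1475) all +_) (sym (trans (ΣL-+ (λ x → p x * (o v a x * W2 x)) (λ x → p x * (o v b x * W2 x)) all) (cong₂ _+_ (Σo v a W2) (Σo v b W2)))) ⟩
        ΣL (λ x → p x * is v x 1475) all + ΣL (λ x → p x * (o v a x * W2 x) + p x * (o v b x * W2 x)) all
          ≡⟨ sym (ΣL-+ (λ x → p x * is v x 1475) _ all) ⟩
        ΣL (λ x → p x * is v x 1475 + (p x * (o v a x * W2 x) + p x * (o v b x * W2 x))) all
          ≡⟨ ΣL-cong all (λ x _ → sym (trans (*-distribˡ-+ (p x) (is v x 1475) _) (cong (p x * is v x 1475 +_) (*-distribˡ-+ (p x) (o v a x * W2 x) _)))) ⟩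
        ΣL (λ x → p x * X x) all ∎
        where open ≤-Reasoning

      sumY : ΣL (λ x → p x * Y x) all ≡ p a * 1045 + p b * 1045 + (XX a + XX b)
      sumY = begin
        ΣL (λ x → p x * Y x) all ≡⟨ ΣL-cong all (λ x _ → trans (*-distribˡ-+ (p x) (nbi v x * 1045) _) (cong (p x * (nbi v x * 1045) +_) (*-distribˡ-+ (p x) (g a x) (g b x)))) ⟩
        ΣL (λ x → p x * (nbi v x * 1045) + (p x * g a x + p x * g b x)) all ≡⟨ ΣL-+ (λ x → p x * (nbi v x * 1045)) _ all ⟩
        ΣL (λ x → p x * (nbi v x * 1045)) all + ΣL (λ x → p x * g a x + p x * g b x) all
          ≡⟨ cong₂ _+_ (trans (Σnb v 1045) (sum2 (λ u → p u * 1045))) (trans (ΣL-+ (λ x → p x * g a x) (λ x → p x * g b x) all) (cong₂ _+_ (Σslots a (oth U v a) (F a)) (Σslots b (oth U v b) (F b)))) ⟩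
        p a * 1045 + p b * 1045 + (XX a + XX b) ∎
        where open ≡-Reasoning

      conclude : ∀ {ka kb} → Good → Cost a ka → Cost b kb → ka + kb ≤ 966125 → ΣP * 1045 ≤ ΣL (λ x → p x * valAt R x v) all
      conclude {ka} {kb} gd Ca Cb h = master v 1045 X Y (point gd) (≤-trans (≤-reflexive sumY) (≤-trans
        (cost-sum-ar {p a * 1045} {p b * 1045} {XX a} {XX b} {VAL a} {VAL b} {ka} {kb} {p v * 1475} Ca Cb
          (≤-trans h (≤-reflexive (cong (_* 1475) {655} {p v} (sym (p-2 Uv d2)))))) sumX))

      XE≤ : ∀ u e → XE u e ≤ length (oth U u e) * (1000 * κ u)
      XE≤ u e = go (oth U u e)
        where
        go : ∀ l → ΣL (λ x → p x * F u x) l ≤ length l * (1000 * κ u)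
        go [] = z≤n
        go (x ∷ l) = +-mono-≤ (*-mono-≤ {p x} {1000} (p≤1000 x) (F≤ u x)) (go l)

      XE0 : ∀ {u e} → (∀ x → x ∈ oth U u e → deg (R x) v ≤ 1) → XE u e ≡ 0
      XE0 {u} {e} h = trans (ΣL-cong (oth U u e) (λ x m → trans (cong (p x *_) (F-1 {u} {x} (h x m))) (*-zeroʳ (p x)))) (ΣL-0 (oth U u e))

      XE-len : ∀ {u e} m k → u ∈ nb U e → deg U e ≡ suc m → κ u ≡ k → XE u e ≤ m * (1000 * k)
      XE-len {u} {e} m k ue d refl = ≤-trans (XE≤ u e) (≤-reflexive (cong (_* (1000 * κ u)) {length (oth U u e)} {m} (suc-injective (trans (sym (oth-len ue)) d))))

      pw : ∀ {e w} m → W2 e ≡ w → m ≤ p e → m * w ≤ p e * W2 e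
      pw {e} m refl h = *-monoˡ-≤ (W2 e) h

      -- The share of one slot when `u` has degree three. As `v` has degree two, 948 takes the place
      -- of 1000: 495330 is half of 948 · 1045, and 54340 = 52 · 1045.
      SlotCost : V → V → ℕ → Set
      SlotCost u e k = XE u e + 495330 ≤ p e * W2 e + t e * 54340 + k

      mkSlot2 : ∀ {u e w k} x → deg U e ≡ 2 → U e ≡ true → W2 e ≡ w → XE u e ≤ x → x + 495330 ≤ 655 * w + 1 * 54340 + k → SlotCost u e k
      mkSlot2 {u} {e} {w} {k} x d Ue ew hx h = ≤-trans (+-monoˡ-≤ 495330 hx) (≤-trans h (+-monoˡ-≤ k (+-mono-≤ (pw 655 ew (≤-reflexive (sym (p-2 Ue d)))) (*-monoˡ-≤ 54340 {1} {t e} (≤-reflexive (sym (t-2 d)))))))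

      mkSlot3 : ∀ {u e w k} x → deg U e ≡ 3 → u ∈ nb U e → deg U u ≡ 3 → W2 e ≡ w → XE u e ≤ x → U e ≡ true → x + 495330 ≤ 896 * w + 0 + k → SlotCost u e k
      mkSlot3 {u} {e} {w} {k} x d m du ew hx Ue h = ≤-trans (+-monoˡ-≤ 495330 hx) (≤-trans h (+-monoˡ-≤ k (+-mono-≤ {896 * w} {p e * W2 e} {0} (pw 896 ew
          (p≥ 2 Ue d (≤-pred (≤-trans (Σt≤₁ m (t-3 du)) (≤-reflexive d))) {896} (≤-refl {1000}))) z≤n)))

      cost3 : ∀ {u k₁ k₂} → (m : u ∈ nb U v) → deg U u ≡ 3 → (H : Shape3 U v u) → SlotCost u (Shape3.e₁ H) k₁ → SlotCost u (Shape3.e₂ H) k₂ → Cost u (k₁ + k₂)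
      cost3 {u} {k₁} {k₂} m d H C₁ C₂ = ≤-trans (≤-reflexive (cong (λ l → p u * 1045 + ΣL (XE u) l) oth≡)) (≤-trans
          (two-cost-ar {p u * 1045} {54340} {495330} {t e₁} {t e₂} {XE u e₁} {XE u e₂} {p e₁ * W2 e₁} {p e₂ * W2 e₂} {k₁} {k₂} C₁ C₂
            (scale-ar 1045 52 {p u} {t e₁ + (t e₂ + 0)} {948} (cut52-ar {p u} {t e₁ + (t e₂ + 0)}
              (trans (cong (λ z → p u + z * 52) (sym (trans (oth-sum t (vu m)) (cong₂ _+_ (t-2 d2) (cong (ΣL t) oth≡))))) (p-3 (nb-U m) d)))))
          (+-monoˡ-≤ (k₁ + k₂) (≤-reflexive (sym (cong (ΣL (λ x → p x * W2 x)) oth≡)))))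
        where open Shape3 H

      costs : ∀ {u k₁ k₂ k} → (m : u ∈ nb U v) → deg U u ≡ 3 → (H : Shape3 U v u) → k₁ + k₂ ≤ k → SlotCost u (Shape3.e₁ H) k₁ → SlotCost u (Shape3.e₂ H) k₂ → Cost u k
      costs {u} {k₁} {k₂} m d H h C₁ C₂ = ≤-trans (cost3 {u} {k₁} {k₂} m d H C₁ C₂) (+-monoʳ-≤ (VAL u) h)

      cost2 : ∀ {u} → (m : u ∈ nb U v) → deg U u ≡ 2 → κ u ≡ 0 → (H : Shape2 U v u) → W2 (Shape2.e₁ H) ≡ 430 → Cost u 402825
      cost2 {u} m d k0 H ew = ≤-trans (+-mono-≤ (≤-reflexive (cong (_* 1045) {p u} {655} (p-2 (nb-U m) d))) (≤-reflexive x0))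
          (≤-trans (≤-refl {684475}) (+-monoˡ-≤ 402825 (≤-trans (pw 655 ew (p≥655 (nb-U m₁))) (≤-reflexive (sym (trans (cong (ΣL (λ x → p x * W2 x)) oth≡) (+-identityʳ _)))))))
        where
        open Shape2 H
        x0 : XX u ≡ 0
        x0 = trans (ΣL-cong (oth U v u) (λ e _ → trans (ΣL-cong (oth U u e) (λ x _ → trans (cong (p x *_) {F u x} {0} (n≤0⇒n≡0 (≤-trans (F≤ u x) (≤-reflexive k0)))) (*-zeroʳ (p x)))) (ΣL-0 (oth U u e)))) (ΣL-0 (oth U v u))

    w2case : ∀ e → W2 e ≡ 430 ⊎ (W2 e ≡ 215 × K2at (R e) v)
    w2case e with deg (R e) v | k2? (R e) v
    ... | 0 | _ = inj₁ refl
    ... | 1 | yes k = inj₂ (refl , k)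
    ... | 1 | no _ = inj₁ refl
    ... | suc (suc _) | _ = inj₁ refl

    -- In a K₂ component of R e the partner of v is the neighbour u′ of v that e misses.
    k2-partner : ∀ {u u′ e} → (∀ w → w ∈ nb U v → w ≡ u ⊎ w ≡ u′) → u ~ e → U e ≡ true → K2at (R e) v →
                 (R e u′ ≡ true) × (∀ f → f ∈ nb U u′ → f ≢ v → e ~ f)
    k2-partner {u} {u′} {e} S ue Ue K with w , m , A ← find K with S w (R-up m)
    ... | inj₁ refl = ⊥-elim (R-n~ m (~-sym ue))
    ... | inj₂ refl = nb-U m , λ f mf fv → R-lost Ue (nb-U m) mf (λ k → fv (All.lookup A k))

    -- `u` has three neighbours in `U` but at most two in `R x`; a lost one is adjacent to `x`,
    -- which yields a path `v u e x` to charge.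
    outer : ∀ {u x y} → u ∈ nb U v → deg U u ≡ 3 → U x ≡ true → R x u ≡ true → Sub2 (R x) u v y → ∃ λ e → e ∈ oth U v u × x ∈ oth U u e
    outer {u} {x} {y} m d Ux Ru S = pick′ (e₁ ≟ᵥ y)
      where
      open Shape3 (shape3 (vu m) d)
      use : ∀ {e} → e ∈ nb U u → e ≢ v → e ≢ y → ∃ λ e → e ∈ oth U v u × x ∈ oth U u e
      use {e} me ev ey = e , oth⁺ me ev , oth⁺ (nb⁺ Ux (~-sym (R-lost Ux Ru me (λ k → [ ev , ey ]′ (S e k))))) (s≢ (R-≢ Ru))
      pick′ : Dec (e₁ ≡ y) → ∃ λ e → e ∈ oth U v u × x ∈ oth U u e
      pick′ (yes h) = use m₂ n₂ (λ k → e₁≢e₂ (trans h (sym k)))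
      pick′ (no h) = use m₁ n₁ h

    swapS : ∀ {a b} → (∀ w → w ∈ nb U v → w ≡ a ⊎ w ≡ b) → (∀ w → w ∈ nb U v → w ≡ b ⊎ w ≡ a)
    swapS S w m = swap (S w m)

    c5-sub : ∀ {x} → C5at (R x) v → ∀ {u} → u ∈ nb (R x) v → ∃ λ y → Sub2 (R x) u v y
    c5-sub (a′ , b′ , c , d , P , S) {u} m with S u m
    ... | inj₁ refl = c , IsPend.Sa P
    ... | inj₂ refl = d , IsPend.Sb P

    both : ∀ {x} → deg (R x) v ≡ 2 → (a ∈ nb (R x) v) × (b ∈ nb (R x) v)
    both {x} h with a′ , b′ , ma , mb , ne ← twoOf (nb-unique (R x) v) (≤-reflexive (sym h)) with Sv a′ (R-up ma) | Sv b′ (R-up mb)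
    ... | inj₁ refl | inj₂ refl = ma , mb
    ... | inj₂ refl | inj₁ refl = mb , ma
    ... | inj₁ refl | inj₁ e = ⊥-elim (ne (sym e))
    ... | inj₂ refl | inj₂ e = ⊥-elim (ne (sym e))

  NoT2 : VSet → Set
  NoT2 U = ∀ a b v₁ v₂ v₃ → IsT2 U a b v₁ v₂ v₃ → ⊥

  NoTwin : VSet → Set
  NoTwin U = ∀ w w′ → IsTwin U w w′ → ⊥

  module Cases (U : VSet) (mindeg : ∀ v → U v ≡ true → 2 ≤ deg U v) (noB : NoB U) (noT2 : NoT2 U) (noTwin : NoTwin U)
    (v : V) (Uv : U v ≡ true) (d2 : deg U v ≡ 2) where
    open Avg U mindeg

    module Pair′ (a b : V) (av : a ∈ nb U v) (bv : b ∈ nb U v) (a≢b : a ≢ b) where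
      open Deg2 U mindeg v Uv d2 a b av bv a≢b

      Goal : Set
      Goal = ΣP * 1045 ≤ ΣL (λ x → p x * valAt R x v) all

      -- In a C₅ both `a` and `b` have lost a neighbour, and 2 · 19 ≥ 37. In the eight-vertex
      -- component one of them has, and 19 ≥ 15. At each of `a` and `b` only one slot can yield as
      -- little as 215, since two such slots would be twins.
      module C33 (da : deg U a ≡ 3) (db : deg U b ≡ 3) where
        open Kap (λ _ → 19)

        good : Good
        good x Ux _ _ h with both h
        ... | ma , mb = c5c , ksc
          where
          c5c : C5at (R x) v → 37 ≤ CH x
          c5c C with c5-sub C ma | c5-sub C mb
          ... | _ , Sa | _ , Sb with outer av da Ux (nb-U ma) Sa | outer bv db Ux (nb-U mb) Sb
          ...   | _ , m , k | _ , m′ , k′ = ≤-trans (≤ᵇ⇒≤ 37 38 _) (+-mono-≤ {19} {g a x} {19} {g b x} (hit h m k) (hit h m′ k′))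
          ksc : KSat (R x) v → 15 ≤ CH x
          ksc (w₁ , _ , _ , _ , _ , _ , _ , Q) with Sv w₁ (R-up (IsKS.m₀₁ Q))
          ... | inj₁ refl with outer av da Ux (nb-U ma) (IsKS.S₁ Q)
          ...   | _ , m , k = ≤-trans (≤ᵇ⇒≤ 15 19 _) (≤-trans (hit h m k) (m≤m+n (g a x) (g b x)))
          ksc (w₁ , _ , _ , _ , _ , _ , _ , Q) | inj₂ refl with outer bv db Ux (nb-U mb) (IsKS.S₁ Q)
          ...   | _ , m , k = ≤-trans (≤ᵇ⇒≤ 15 19 _) (≤-trans (hit h m k) (m≤n+m (g b x) (g a x)))

        module Side {u u′ : V} (uv : u ∈ nb U v) (uv′ : u′ ∈ nb U v) (S : Sub2 U v u u′) (du : deg U u ≡ 3) (du′ : deg U u′ ≡ 3) where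
          H′ : Shape3 U v u′
          H′ = shape3 (vu uv′) du′
          module H = Shape3 H′
          Closed : V → Set
          Closed e = (∀ w → w ∈ nb U e → w ≡ u ⊎ w ≡ H.e₁ ⊎ w ≡ H.e₂) × (H.e₁ ∈ nb U e) × (H.e₂ ∈ nb U e) × deg U e ≡ 3
          ne : ∀ {f} → f ∈ nb U u′ → u ≢ f
          ne m refl = nadj uv′ uv (nb-~ m)
          module Far {e : V} (me : e ∈ nb U u) where
            ue : u ∈ nb U e
            ue = nb-sym (nb-U uv) me

            slot2 : deg U e ≡ 2 → W2 e ≡ 430 → SlotCost u e 178340
            slot2 d w = mkSlot2 {u} {e} {430} {178340} 19000 d (nb-U me) w (XE-len {u} {e} 1 19 ue d refl) (≤-refl {514330})

            slot3 : deg U e ≡ 3 → W2 e ≡ 430 → SlotCost u e 178340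
            slot3 d w = mkSlot3 {u} {e} {430} {178340} 38000 d ue du w (XE-len {u} {e} 2 19 ue d refl) (nb-U me) (≤ᵇ⇒≤ 533330 563620 _)

            module Meets (h₁ : e ~ H.e₁) (h₂ : e ~ H.e₂) where
              f₁ : H.e₁ ∈ nb U e
              f₁ = nb⁺ (nb-U H.m₁) h₁
              f₂ : H.e₂ ∈ nb U e
              f₂ = nb⁺ (nb-U H.m₂) h₂
              d3 : deg U e ≡ 3
              d3 = ≤-antisym (deg≤3 U e) (3≤ ue f₁ f₂ (ne H.m₁) (ne H.m₂) H.e₁≢e₂)
              cl : ∀ w → w ∈ nb U e → w ≡ u ⊎ w ≡ H.e₁ ⊎ w ≡ H.e₂
              cl = sub3-of ue f₁ f₂ (ne H.m₁) (ne H.m₂) H.e₁≢e₂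
              -- The further neighbours of `e` are neighbours of `u′`. Choosing one of them deletes
              -- `u′`, so nothing is charged along `e`.
              low1 : ∀ x → x ∈ oth U u e → deg (R x) v ≤ 1
              low1 x m with cl x (proj₁ (oth⁻ m))
              ... | inj₁ h = ⊥-elim (proj₂ (oth⁻ m) h)
              ... | inj₂ (inj₁ refl) = lost1 uv′ (~-sym (nb-~ H.m₁))
              ... | inj₂ (inj₂ refl) = lost1 uv′ (~-sym (nb-~ H.m₂))

              slot : W2 e ≡ 215 → SlotCost u e 302690
              slot w = mkSlot3 {u} {e} {215} {302690} 0 d3 ue du w (≤-reflexive (XE0 low1)) (nb-U me) (≤-refl {495330})

            far : deg U e ≡ 2 ⊎ deg U e ≡ 3 → W2 e ≡ 430 ⊎ (W2 e ≡ 215 × K2at (R e) v) → SlotCost u e 178340 ⊎ (SlotCost u e 302690 × Closed e)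
            far (inj₁ d) (inj₁ w) = inj₁ (slot2 d w)
            far (inj₂ d) (inj₁ w) = inj₁ (slot3 d w)
            far _ (inj₂ (w , K)) = inj₂ (slot w , cl , f₁ , f₂ , d3)
              where
              h : ∀ f → f ∈ nb U u′ → f ≢ v → e ~ f
              h = proj₂ (k2-partner S (nb-~ me) (nb-U me) K)
              open Meets (h H.e₁ H.m₁ H.n₁) (h H.e₂ H.m₂ H.n₂)

          one : ∀ e → e ∈ nb U u → SlotCost u e 178340 ⊎ (SlotCost u e 302690 × Closed e)
          one e me = Far.far me (deg23 (nb-U me)) (w2case e)
          side : Cost u 481030
          side = go (one e₁ m₁) (one e₂ m₂)
            where
            open Shape3 (shape3 (vu uv) du)
            sub′ : ∀ {e e′} → e′ ∈ nb U u → Closed e → Closed e′ → ∀ w → w ∈ nb U e → w ∈ nb U e′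
            sub′ me′ (cl , _) (_ , f₁ , f₂ , _) w m with cl w m
            ... | inj₁ refl = nb-sym (nb-U uv) me′
            ... | inj₂ (inj₁ refl) = f₁
            ... | inj₂ (inj₂ refl) = f₂

            go : SlotCost u e₁ 178340 ⊎ (SlotCost u e₁ 302690 × Closed e₁) → SlotCost u e₂ 178340 ⊎ (SlotCost u e₂ 302690 × Closed e₂) → Cost u 481030
            go (inj₁ c) (inj₁ c′) = costs {u} {178340} {178340} {481030} uv du (shape3 (vu uv) du) (≤ᵇ⇒≤ 356680 481030 _) c c′
            go (inj₁ c) (inj₂ (c′ , _)) = costs {u} {178340} {302690} {481030} uv du (shape3 (vu uv) du) (≤-refl {481030}) c c′
            go (inj₂ (c , _)) (inj₁ c′) = costs {u} {302690} {178340} {481030} uv du (shape3 (vu uv) du) (≤-refl {481030}) c c′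
            go (inj₂ (_ , k₁)) (inj₂ (_ , k₂)) = ⊥-elim (noTwin e₁ e₂ (mkTwin (nb-U m₁) (nb-U m₂) e₁≢e₂ (≤-reflexive (sym (proj₂ (proj₂ (proj₂ k₁)))))
                (nb-ext (sub′ m₂ k₁ k₂) (sub′ m₁ k₂ k₁))))

        goal : Goal
        goal = conclude good (Side.side av bv Sv da db) (Side.side bv av (swapS Sv) db da) (≤ᵇ⇒≤ 962060 966125 _)

      -- Only `a` has a third neighbour, so it carries the whole charge of 37. The outcomes for
      -- which this is not enough would produce `IsB` with the path `v b`.
      module C32 (da : deg U a ≡ 3) (db : deg U b ≡ 2) where
        κ : V → ℕ
        κ u = if does (u ≟ᵥ a) then 37 else 0
        open Kap κ
        κa : κ a ≡ 37
        κa with a ≟ᵥ a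
        ... | yes _ = refl
        ... | no h = ⊥-elim (h refl)
        κb : κ b ≡ 0
        κb with b ≟ᵥ a
        ... | yes e = ⊥-elim (a≢b (sym e))
        ... | no _ = refl
        H = shape2 (vu bv) db
        c : V
        c = Shape2.e₁ H
        module HA = Shape3 (shape3 (vu av) da)
        cb : c ∈ nb U b
        cb = Shape2.m₁ H
        b∉a : ∀ {e} → e ∈ nb U a → b ≢ e
        b∉a m refl = nadj av bv (nb-~ m)

        badB : c ~ HA.e₁ → c ~ HA.e₂ → ⊥
        badB k₁ k₂ = noB v b a c HA.e₁ HA.e₂ (mkB Uv bv av (s≢ a≢b) cb (s≢ (Shape2.n₁ H)) HA.m₁ HA.m₂ HA.e₁≢e₂ c₁ c₂ (swapS Sv) (Shape2.cover H) HA.cover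
            (sub3-of (nb-sym (nb-U bv) cb) c₁ c₂ (b∉a HA.m₁) (b∉a HA.m₂) HA.e₁≢e₂))
          where
          c₁ : HA.e₁ ∈ nb U c
          c₁ = nb⁺ (nb-U HA.m₁) k₁
          c₂ : HA.e₂ ∈ nb U c
          c₂ = nb⁺ (nb-U HA.m₂) k₂

        good : Good
        good x Ux _ _ h with both h
        ... | ma , mb = c5c , ksc
          where
          big : ∀ {y} → Sub2 (R x) a v y → 37 ≤ CH x
          big S with outer av da Ux (nb-U ma) S
          ... | _ , m , k = ≤-trans (≤-reflexive (sym κa)) (≤-trans (hit h m k) (m≤m+n (g a x) (g b x)))
          c5c : C5at (R x) v → 37 ≤ CH x
          c5c C = big (proj₂ (c5-sub C ma))
          ksc : KSat (R x) v → 15 ≤ CH x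
          ksc (w₁ , w₂ , w₃ , w₄ , w₅ , _ , _ , Q) with Sv w₁ (R-up (IsKS.m₀₁ Q))
          ... | inj₁ refl = ≤-trans (≤ᵇ⇒≤ 15 37 _) (big (IsKS.S₁ Q))
          ... | inj₂ refl with Sv w₂ (R-up (IsKS.m₀₂ Q))
          ...   | inj₂ e = ⊥-elim (IsKS.1≢2 Q (sym e))
          ...   | inj₁ refl = ⊥-elim (noB v b a w₃ w₄ w₅ (mkB Uv bv av 1≢2 (R-up m₁₃) 0≢3 (R-up m₂₄) (R-up m₂₅) 4≢5 (R-up m₃₄) (R-up m₃₅)
                    (swapS Sv) (sub2-deg (≤-reflexive db) (vu bv) (R-up m₁₃) 0≢3)
                    (sub3-of (vu av) (R-up m₂₄) (R-up m₂₅) 0≢4 0≢5 4≢5) (sub3-of (nb-sym (nb-U bv) (R-up m₁₃)) (R-up m₃₄) (R-up m₃₅) 1≢4 1≢5 4≢5)))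
            where
            open IsKS Q
            open B≢ (b≢ isB)

        module Far {e : V} (me : e ∈ nb U a) where
          ae : a ∈ nb U e
          ae = nb-sym (nb-U av) me

          slot2 : deg U e ≡ 2 → W2 e ≡ 430 → SlotCost a e 196340
          slot2 d w = mkSlot2 {a} {e} {430} {196340} 37000 d (nb-U me) w (XE-len {a} {e} 1 37 ae d κa) (≤-refl {532330})

          slot3 : deg U e ≡ 3 → W2 e ≡ 430 → SlotCost a e 196340
          slot3 d w = mkSlot3 {a} {e} {430} {196340} 74000 d ae da w (XE-len {a} {e} 2 37 ae d κa) (nb-U me) (≤ᵇ⇒≤ 569330 581620 _)

          slot2′ : deg U e ≡ 2 → W2 e ≡ 215 → SlotCost a e 339690
          slot2′ d w = mkSlot2 {a} {e} {215} {339690} 37000 d (nb-U me) w (XE-len {a} {e} 1 37 ae d κa) (≤ᵇ⇒≤ 532330 534855 _)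

          slot3′ : XE a e ≤ 37000 → deg U e ≡ 3 → W2 e ≡ 215 → SlotCost a e 339690
          slot3′ h d w = mkSlot3 {a} {e} {215} {339690} 37000 d ae da w h (nb-U me) (≤-refl {532330})

          -- Choosing `c` deletes `b`, so of the two further neighbours of `e` only the other one
          -- can be charged.
          half : e ~ c → deg U e ≡ 3 → XE a e ≤ 37000
          half ec d = go (subst (c ∈_) T.oth≡ c∈)
            where
            module T = Shape3 (shape3 ae d)
            c∈ : c ∈ oth U a e
            c∈ = oth⁺ (nb⁺ (nb-U cb) ec) (λ { refl → nadj bv av (nb-~ cb) })
            lowc : deg (R c) v ≤ 1
            lowc = lost1 bv (~-sym (nb-~ cb))
            zc : ∀ {y} → c ≡ y → p y * F a y ≡ 0
            zc refl = trans (cong (p c *_) {F a c} {0} (F-1 {a} {c} lowc)) (*-zeroʳ (p c))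
            bd : ∀ y → p y * F a y ≤ 37000
            bd y = *-mono-≤ {p y} {1000} {F a y} {37} (p≤1000 y) (≤-trans (F≤ a y) (≤-reflexive κa))
            pair′ : XE a e ≡ p T.e₁ * F a T.e₁ + p T.e₂ * F a T.e₂
            pair′ = trans (cong (ΣL (λ x → p x * F a x)) T.oth≡) (cong (p T.e₁ * F a T.e₁ +_) (+-identityʳ _))
            go : c ∈ T.e₁ ∷ T.e₂ ∷ [] → XE a e ≤ 37000
            go (here k) = ≤-trans (≤-reflexive (trans pair′ (cong (_+ p T.e₂ * F a T.e₂) {p T.e₁ * F a T.e₁} {0} (zc k)))) (bd T.e₂)
            go (there (here k)) = ≤-trans (≤-reflexive (trans pair′ (trans (cong (p T.e₁ * F a T.e₁ +_) {p T.e₂ * F a T.e₂} {0} (zc k)) (+-identityʳ _)))) (bd T.e₁)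

          far : deg U e ≡ 2 ⊎ deg U e ≡ 3 → W2 e ≡ 430 ⊎ (W2 e ≡ 215 × K2at (R e) v) → SlotCost a e 196340 ⊎ (SlotCost a e 339690 × c ~ e)
          far (inj₁ d) (inj₁ w) = inj₁ (slot2 d w)
          far (inj₂ d) (inj₁ w) = inj₁ (slot3 d w)
          far d (inj₂ (w , K)) = inj₂ (slot′ d , ~-sym ec)
            where
            ec : e ~ c
            ec = proj₂ (k2-partner Sv (nb-~ me) (nb-U me) K) c cb (Shape2.n₁ H)
            slot′ : deg U e ≡ 2 ⊎ deg U e ≡ 3 → SlotCost a e 339690
            slot′ (inj₁ d) = slot2′ d w
            slot′ (inj₂ d) = slot3′ (half ec d) d w

        one : ∀ e → e ∈ nb U a → SlotCost a e 196340 ⊎ (SlotCost a e 339690 × c ~ e)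
        one e me = Far.far me (deg23 (nb-U me)) (w2case e)

        costa : Cost a 536030
        costa = go (one HA.e₁ HA.m₁) (one HA.e₂ HA.m₂)
          where
          go : SlotCost a HA.e₁ 196340 ⊎ (SlotCost a HA.e₁ 339690 × c ~ HA.e₁) → SlotCost a HA.e₂ 196340 ⊎ (SlotCost a HA.e₂ 339690 × c ~ HA.e₂) → Cost a 536030
          go (inj₁ k) (inj₁ k′) = costs {a} {196340} {196340} {536030} av da (shape3 (vu av) da) (≤ᵇ⇒≤ 392680 536030 _) k k′
          go (inj₁ k) (inj₂ (k′ , _)) = costs {a} {196340} {339690} {536030} av da (shape3 (vu av) da) (≤-refl {536030}) k k′
          go (inj₂ (k , _)) (inj₁ k′) = costs {a} {339690} {196340} {536030} av da (shape3 (vu av) da) (≤-refl {536030}) k k′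
          go (inj₂ (_ , h)) (inj₂ (_ , h′)) = ⊥-elim (badB h h′)

        costb : Cost b 402825
        costb with w2case c
        ... | inj₁ w = cost2 bv db κb H w
        ... | inj₂ (_ , K) with k2-partner (swapS Sv) (nb-~ cb) (nb-U cb) K
        ...   | _ , adj′ = ⊥-elim (badB (adj′ HA.e₁ HA.m₁ HA.n₁) (adj′ HA.e₂ HA.m₂ HA.n₂))

        goal : Goal
        goal = conclude good costa costb (≤ᵇ⇒≤ 938855 966125 _)

      -- No charge arises: a C₅ through `a`, `v`, `b` would contain `IsT2`, and an eight-vertex
      -- component needs a neighbour of degree three.
      module C22 (da : deg U a ≡ 2) (db : deg U b ≡ 2) where
        open Kap (λ _ → 0)

        t2bad : ∀ {i j c d} → i ∈ nb U v → j ∈ nb U v → Sub2 U v i j → deg U i ≡ 2 → deg U j ≡ 2 → c ∈ nb U i → d ∈ nb U j → c ≢ v → d ≢ v → c ~ d → ⊥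
        t2bad {i} {j} {c} {d} iv jv S di dj ci dj′ cv dv cd = noT2 c d i v j (mkT2 (nb-U ci) (nb⁺ (nb-U dj′) cd) (nb-sym (nb-U iv) ci) (nb-sym (nb-U jv) dj′) (vu iv) jv
            (sub2-deg (≤-reflexive di) ci (vu iv) cv) S (sub2-deg (≤-reflexive dj) (vu jv) dj′ (s≢ dv)))

        deg2of : ∀ {u} → u ∈ nb U v → deg U u ≡ 2
        deg2of m with Sv _ m
        ... | inj₁ refl = da
        ... | inj₂ refl = db

        good : Good
        good x Ux _ _ h = c5c , ksc
          where
          c5c : C5at (R x) v → 37 ≤ CH x
          c5c (a′ , b′ , c , d , P , S) = ⊥-elim (t2bad (R-up va) (R-up vb) (sub2-deg (≤-reflexive d2) (R-up va) (R-up vb) a≢b′) (deg2of (R-up va)) (deg2of (R-up vb)) (R-up ac) (R-up bd) (s≢ v≢c) (s≢ v≢d) (nb-~ cd))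
            where
            open IsPend P renaming (a≢b to a≢b′)
            open Pend≢ (pend≢ P)
          ksc : KSat (R x) v → 15 ≤ CH x
          ksc (w₁ , w₂ , w₃ , w₄ , w₅ , _ , _ , Q) = ⊥-elim (<⇒≱ (3≤ (vu (R-up m₀₂)) (R-up m₂₄) (R-up m₂₅) 0≢4 0≢5 4≢5) (≤-reflexive (deg2of (R-up m₀₂))))
            where
            open IsKS Q
            open B≢ (b≢ isB)

        cost : ∀ {u u′} → u ∈ nb U v → u′ ∈ nb U v → Sub2 U v u u′ → deg U u ≡ 2 → deg U u′ ≡ 2 → Cost u 402825
        cost {u} {u′} uv uv′ S du du′ with w2case (Shape2.e₁ (shape2 (vu uv) du))
        ... | inj₁ w = cost2 uv du refl (shape2 (vu uv) du) w
        ... | inj₂ (_ , K) with k2-partner S (nb-~ (Shape2.m₁ (shape2 (vu uv) du))) (nb-U (Shape2.m₁ (shape2 (vu uv) du))) K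
        ...   | _ , adj′ = ⊥-elim (t2bad uv uv′ S du du′ (Shape2.m₁ (shape2 (vu uv) du)) (Shape2.m₁ (shape2 (vu uv′) du′)) (Shape2.n₁ (shape2 (vu uv) du)) (Shape2.n₁ (shape2 (vu uv′) du′))
                (adj′ _ (Shape2.m₁ (shape2 (vu uv′) du′)) (Shape2.n₁ (shape2 (vu uv′) du′))))

        goal : Goal
        goal = conclude good (cost av bv Sv da db) (cost bv av (swapS Sv) db da) (≤ᵇ⇒≤ 805650 966125 _)

    deg2 : ΣP * 1045 ≤ ΣL (λ x → p x * valAt R x v) all
    deg2 with twoOf (nb-unique U v) (≤-reflexive (sym d2))
    ... | a , b , av , bv , ne with deg23 (nb-U av) | deg23 (nb-U bv)
    ...   | inj₂ da | inj₂ db = Pair′.C33.goal a b av bv ne da db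
    ...   | inj₂ da | inj₁ db = Pair′.C32.goal a b av bv ne da db
    ...   | inj₁ da | inj₂ db = Pair′.C32.goal b a bv av (s≢ ne) db da
    ...   | inj₁ da | inj₁ db = Pair′.C22.goal a b av bv ne da db

  -- The induction

  isT2? : ∀ U a b v₁ v₂ v₃ → Dec (IsT2 U a b v₁ v₂ v₃)
  isT2? U a b v₁ v₂ v₃ = map′
    (λ { (x1 , x2 , x3 , x4 , x5 , x6 , x7 , x8 , x9) → mkT2 x1 x2 x3 x4 x5 x6 x7 x8 x9 })
    (λ { (mkT2 x1 x2 x3 x4 x5 x6 x7 x8 x9) → (x1 , x2 , x3 , x4 , x5 , x6 , x7 , x8 , x9) })
    ((U a Boolₚ.≟ true) ×-dec (b ∈? nb U a) ×-dec (v₁ ∈? nb U a) ×-dec (v₃ ∈? nb U b) ×-dec (v₂ ∈? nb U v₁) ×-dec (v₃ ∈? nb U v₂)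
     ×-dec sub2? U v₁ a v₂ ×-dec sub2? U v₂ v₁ v₃ ×-dec sub2? U v₃ v₂ b)

  isTwin? : ∀ U w w′ → Dec (IsTwin U w w′)
  isTwin? U w w′ = map′
    (λ { (x1 , x2 , x3 , x4 , x5) → mkTwin x1 x2 x3 x4 x5 })
    (λ { (mkTwin x1 x2 x3 x4 x5) → (x1 , x2 , x3 , x4 , x5) })
    ((U w Boolₚ.≟ true) ×-dec (U w′ Boolₚ.≟ true) ×-dec ¬? (w ≟ᵥ w′) ×-dec (3 ≤? deg U w) ×-dec ≡-dec _≟ᵥ_ (nb U w) (nb U w′))

  shear : ∀ U {v₀} → U v₀ ≡ true → (∀ v → U v ≡ true → 2 ≤ deg U v) → NoB U → NoT2 U → NoTwin U → Rec U → Weak U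
  shear U {v₀} U₀ mindeg noB noT2 noTwin rec = average U R p colR R-~ pos enough
    where
    open Avg U mindeg
    colR : ∀ x → Col (R x)
    colR x with U x in e
    ... | true = rec (R x) (size-< {R x} {U} {x} (λ w → R-U) e (λ r → R-≢ r refl))
    ... | false = rec (R x) (size-< {R x} {U} {v₀} (λ w → R-U) U₀ (λ r → h (trans (sym e) (R-Ux r))))
      where
      h : false ≡ true → ⊥
      h ()
    pos : 0 < ΣP
    pos = ≤-trans (≤ᵇ⇒≤ 1 655 _) (≤-trans (p≥655 U₀) (ΣL-∈ p all (∈-allFin v₀)))
    enough : ∀ v → U v ≡ true → ΣP * wdem U v ≤ ΣL (λ x → p x * valAt R x v) all
    enough v Uv = go (deg23 Uv)
      where
      go : deg U v ≡ 2 ⊎ deg U v ≡ 3 → ΣP * wdem U v ≤ ΣL (λ x → p x * valAt R x v) all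
      go (inj₁ d) = ≤-trans (*-monoʳ-≤ ΣP (demBy-1045 (deg U v) _ _ (mindeg v Uv))) (Cases.deg2 U mindeg noB noT2 noTwin v Uv d)
      go (inj₂ d) = ≤-trans (*-monoʳ-≤ ΣP (≤-reflexive (wdem-3 {U} {v} (≤-reflexive (sym d))))) (Deg3H.deg3 U mindeg v Uv d)

  -- The order supplies the hypotheses: `RB` needs that no eight-vertex component is left, `leaf`
  -- and `T2` that neither `IsPend` nor `IsB` occurs, and the averaging also that there are no
  -- leaves, no `IsT2` and no twins.
  module Step (U : VSet) (rec : Rec U) where
    byAverage : NoB U → NoT2 U → NoTwin U → (∀ v → ¬ (U v ≡ true × deg U v ≤ 1)) → Weak U
    byAverage noB noT2 noTwin noLeaf with Fₚ.any? (λ v → U v Boolₚ.≟ true)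
    ... | yes (v₀ , U₀) = shear U U₀ (λ v Uv → ≰⇒> (λ h → noLeaf v (Uv , h))) noB noT2 noTwin rec
    ... | no h = weak 1 (s≤s z≤n) (fam (λ _ → ∅) (λ _ _ _ _ ())) (λ v Uv → ⊥-elim (h (v , Uv)))

    step₅ : NoB U → NoT2 U → (∀ v → ¬ (U v ≡ true × deg U v ≤ 1)) → Weak U
    step₅ noB noT2 noLeaf with Fₚ.any? (λ w → Fₚ.any? (λ w′ → isTwin? U w w′))
    ... | yes (w , w′ , T) = twin U w w′ T rec
    ... | no h = byAverage noB noT2 (λ w w′ T → h (w , w′ , T)) noLeaf

    step₄ : NoPend U → NoB U → (∀ v → ¬ (U v ≡ true × deg U v ≤ 1)) → Weak U
    step₄ noP noB noLeaf with Fₚ.any? (λ a → Fₚ.any? (λ b → Fₚ.any? (λ v₁ → Fₚ.any? (λ v₂ → Fₚ.any? (λ v₃ → isT2? U a b v₁ v₂ v₃)))))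
    ... | yes (a , b , v₁ , v₂ , v₃ , T) = T2.t2 U a b v₁ v₂ v₃ T noP noB rec
    ... | no h = step₅ noB (λ a b v₁ v₂ v₃ T → h (a , b , v₁ , v₂ , v₃ , T)) noLeaf

    step₃ : NoPend U → NoB U → Weak U
    step₃ noP noB with Fₚ.any? (λ v → (U v Boolₚ.≟ true) ×-dec (deg U v ≤? 1))
    ... | yes (v , Uv , d) = leaf U v Uv d noP noB rec
    ... | no h = step₄ noP noB (λ v k → h (v , k))

    step₂ : NoPend U → (∀ v → ¬ KSat U v) → Weak U
    step₂ noP noKS with Fₚ.any? (λ v₀ → Fₚ.any? (λ v₁ → Fₚ.any? (λ v₂ → Fₚ.any? (λ v₃ → Fₚ.any? (λ v₄ → Fₚ.any? (λ v₅ → isB? U v₀ v₁ v₂ v₃ v₄ v₅))))))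
    ... | yes (v₀ , v₁ , v₂ , v₃ , v₄ , v₅ , B) = RB.rb U v₀ v₁ v₂ v₃ v₄ v₅ B (noKS v₀) rec
    ... | no h = step₃ noP (λ v₀ v₁ v₂ v₃ v₄ v₅ B → h (v₀ , v₁ , v₂ , v₃ , v₄ , v₅ , B))

    step₁ : NoPend U → Weak U
    step₁ noP with Fₚ.any? (ks? U)
    ... | yes (v₀ , v₁ , v₂ , v₃ , v₄ , v₅ , p , q , Q) = RKS.rks U v₀ v₁ v₂ v₃ v₄ v₅ p q Q rec
    ... | no h = step₂ noP (λ v K → h (v , K))

    step : Weak U
    step with Fₚ.any? (λ v → Fₚ.any? (λ a → Fₚ.any? (λ b → Fₚ.any? (λ c → Fₚ.any? (λ d → isPend? U v a b c d)))))
    ... | yes (v , a , b , c , d , P) = T1.t1 U v a b c d P rec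
    ... | no h = step₁ (λ v a b c d P → h (v , a , b , c , d , P))

  colourable : ∀ U → Col U
  colourable U = go (suc (size U)) U (n<1+n _)
    where
    go : ∀ m U → size U < m → Col U
    go (suc m) U h = boost U (Step.step U (λ U′ k → go m U′ (≤-trans k (≤-pred h))))

  860≤dem : ∀ U v → 860 ≤ dem U v
  860≤dem U v with deg U v | does (k2? U v) | does (c5? U v) | does (ks? U v)
  ... | 0 | _ | _ | _ = ≤ᵇ⇒≤ 860 2520 _
  ... | 1 | true | _ | _ = ≤ᵇ⇒≤ 860 1260 _
  ... | 1 | false | _ | _ = ≤ᵇ⇒≤ 860 1475 _
  ... | 2 | _ | true | _ = ≤ᵇ⇒≤ 860 1008 _
  ... | 2 | _ | false | true = ≤ᵇ⇒≤ 860 1030 _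
  ... | 2 | _ | false | false = ≤ᵇ⇒≤ 860 1045 _
  ... | suc (suc (suc _)) | _ | _ | _ = ≤-refl

  fractional : FracChromatic≤ G 126 43
  fractional with K , K>0 , colK _ refl F dm ← colourable (λ _ → true)
    = K * 2520 , K * 860 , *-monoˡ-< 860 K>0 , ≤-reflexive ratio , record
      { colour = λ v → Vec.tabulate (proj₁ (T v))
      ; size = λ v → trans (∣tabulate∣ (proj₁ (T v))) (proj₂ (proj₂ (T v)))
      ; disjoint = λ u v a i iu iv → valid F u v a i (proj₁ (proj₂ (T u)) i (mem u i iu)) (proj₁ (proj₂ (T v)) i (mem v i iv)) }
    where
    T : ∀ v → Σ (PSet (K * 2520)) λ Y → Y ⊑ S F v × cnt Y ≡ K * 860
    T v = sub (S F v) (K * 860) (≤-trans (*-monoʳ-≤ K (860≤dem (λ _ → true) v)) (dm v refl))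
    mem : ∀ v i → i Subset.∈ Vec.tabulate (proj₁ (T v)) → proj₁ (T v) i ≡ true
    mem v i h = trans (sym (Vecₚ.lookup∘tabulate (proj₁ (T v)) i)) (Vecₚ.[]=⇒lookup h)
    ratio : K * 2520 * 43 ≡ 126 * (K * 860)
    -- 2520 · 43 and 860 · 126 evaluate to the same number.
    ratio = trans (*-assoc K 2520 43) (trans (sym (*-assoc K 860 126)) (*-comm (K * 860) 126))
    ∣tabulate∣ : ∀ {M} (f : PSet M) → ∣ Vec.tabulate f ∣ ≡ cnt f
    ∣tabulate∣ {zero} f = refl
    ∣tabulate∣ {suc M} f with f zero
    ... | true = cong suc (∣tabulate∣ (λ i → f (suc i)))
    ... | false = ∣tabulate∣ (λ i → f (suc i))

theorem1 : (G : Graph) → TriangleFree G → MaxDegreeAtMost 3 G →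
    FracChromatic≤ G 126 43
theorem1 = Core.fractional
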